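{- Let $d\ge 3$ and let $F_1$ and $F_2$ be two isomorphic binary forms in $\mathrm{Bin}(d,\mathbb{Z})$. Then there is a positive constant $C_{F_1,F_2}$ such that, as $N\to\infty$, $$\mathcal{N}(F_1,F_2;N)\ge \left(C_{F_1,F_2}-o_{F_1,F_2}(1)\right)N^{2/d}.$$
   Context: For an integer $d\ge 3$, $\mathrm{Bin}(d,\mathbb{Z})$ is the set of binary forms $F(X,Y)$ of degree $d$ with integer coefficients and nonzero discriminant. For $\gamma=\begin{pmatrix} a_1 & a_2 \\ a_3 & a_4 \end{pmatrix}\in \mathrm{GL}(2,\mathbb{Q})$, put $(F\circ\gamma)(X_1,X_2)=F(a_1X_1+a_2X_2,\,a_3X_1+a_4X_2)$. Two forms $F_1,F_2\in \mathrm{Bin}(d,\mathbb{Z})$ are isomorphic if there is $\gamma\in\mathrm{GL}(2,\mathbb{Q})$ with $F_1\circ\gamma=F_2$. For an integer $N\ge1$, $$\mathcal{N}(F_1,F_2;N):=\sharp\left(F_1(\mathbb{Z}^2)\cap F_2(\mathbb{Z}^2)\cap[-N,N]\right).$$ -}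

module Defs where

open import Data.Nat.Base as ℕ using (ℕ; zero; suc; _∸_)
open import Data.Nat.Properties using (m^n≢0)
open import Data.Integer.Base as ℤ using (ℤ; +_; 0ℤ; 1ℤ; -1ℤ)
open import Data.Rational.Base as ℚ using (ℚ; 0ℚ; 1ℚ)
open import Data.Fin.Base using (Fin; zero; suc; toℕ; inject₁; punchIn; splitAt)
open import Data.Vec.Base
  using (Vec; []; _∷_; _∷ʳ_; _++_; map; zipWith; replicate; lookup; tabulate)
open import Data.Product.Base using (∃; ∃₂; _×_)
open import Data.Sum.Base using ([_,_]′)
open import Function.Definitions using (Injective)
open import Level using (0ℓ)
open import Relation.Binary.PropositionalEquality.Core using (_≡_; _≢_)
open import Relation.Unary using (Pred; _∈_; _∩_)

open import Algebra.Definitions.RawMonoid ℤ.+-0-rawMonoid public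
  using () renaming (sum to ∑)
open import Algebra.Definitions.RawSemiring ℚ.+-*-rawSemiring public
  using () renaming (_^_ to _^ℚ_)

-- a₀ ∷ … ∷ a_d is the form a₀ X^d + a₁ X^(d-1) Y + … + a_d Y^d.
Form : Set → ℕ → Set
Form A d = Vec A (suc d)

-- Uses F = a₀ X^(d+1) + Y F′, where F′ has coefficients a₁, …, a_(d+1).
eval : ∀ {d} → Form ℤ d → ℤ → ℤ → ℤ
eval {zero}  (a ∷ []) x y = a
eval {suc d} (a ∷ F)  x y = a ℤ.* x ℤ.^ suc d ℤ.+ y ℤ.* eval F x y

------------------------------------------------------------------------
-- Discriminant

Matrix : ℕ → Set
Matrix n = Fin n → Fin n → ℤ

-- Laplace expansion along the first row.
det : ∀ {n} → Matrix n → ℤ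
det {zero}  M = 1ℤ
det {suc n} M =
  ∑ λ j → -1ℤ ℤ.^ toℕ j ℤ.* M zero j ℤ.* det λ i k → M (suc i) (punchIn j k)

-- The entry at a given position, 0 beyond the end.
entry : ∀ {n} → Vec ℤ n → ℕ → ℤ
entry []       _       = 0ℤ
entry (a ∷ as) zero    = a
entry (a ∷ as) (suc k) = entry as k

-- Sylvester matrix: n shifted copies of the coefficients of P (degree m),
-- followed by m shifted copies of the coefficients of Q (degree n).
sylvester : ∀ {m n} → Form ℤ m → Form ℤ n → Matrix (n ℕ.+ m)
sylvester {m} {n} P Q r k = [ shifted P , shifted Q ]′ (splitAt n r)
  where
  shifted : ∀ {e l} → Form ℤ e → Fin l → ℤ
  shifted G i = entry (replicate (toℕ i) 0ℤ ++ G) (toℕ k)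

resultant : ∀ {m n} → Form ℤ m → Form ℤ n → ℤ
resultant P Q = det (sylvester P Q)

∂X ∂Y : ∀ {n} → Form ℤ (suc n) → Form ℤ n
∂X {n} F = tabulate λ i → + (suc n ∸ toℕ i) ℤ.* lookup F (inject₁ i)
∂Y {n} F = tabulate λ i → + suc (toℕ i) ℤ.* lookup F (suc i)

-- For d ≥ 2,  disc F = (-1)^(d(d-1)/2) Res(∂F/∂X, ∂F/∂Y) / d^(d-2).
-- This agrees with ∏_{i<j} (αᵢ βⱼ - αⱼ βᵢ)² for F = ∏ᵢ (αᵢ X - βᵢ Y),
-- including when the leading coefficient of F vanishes.
-- The value in degree 0 is a convention.
discriminant : ∀ {d} → Form ℤ d → ℚ
discriminant {zero}  F = 1ℚ
discriminant {suc n} F =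
  (-1ℤ ℤ.^ ((suc n ℕ.* n) ℕ./ 2) ℤ.* resultant (∂X F) (∂Y F))
    ℚ./ (suc n ℕ.^ (n ∸ 1))
  where instance _ = m^n≢0 (suc n) (n ∸ 1)

record Bin (d : ℕ) : Set where
  constructor bin
  field
    form                : Form ℤ d
    nonzeroDiscriminant : discriminant form ≢ 0ℚ

open Bin public

------------------------------------------------------------------------
-- Isomorphism of forms

record GL₂ : Set where
  field
    a₁ a₂ a₃ a₄ : ℚ
    invertible  : a₁ ℚ.* a₄ ℚ.- a₂ ℚ.* a₃ ≢ 0ℚ

infixl 6 _⊕_
_⊕_ : ∀ {d} → Form ℚ d → Form ℚ d → Form ℚ d
_⊕_ = zipWith ℚ._+_

infixr 7 _⊙_
_⊙_ : ∀ {d} → ℚ → Form ℚ d → Form ℚ d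
c ⊙ F = map (c ℚ.*_) F

-- (p X + q Y) · F
linear· : ∀ {d} → ℚ → ℚ → Form ℚ d → Form ℚ (suc d)
linear· p q F = zipWith ℚ._+_ ((p ⊙ F) ∷ʳ 0ℚ) (0ℚ ∷ q ⊙ F)

-- (p X + q Y)^n
linear^ : ℚ → ℚ → (n : ℕ) → Form ℚ n
linear^ p q zero    = 1ℚ ∷ []
linear^ p q (suc n) = linear· p q (linear^ p q n)

-- F(a₁ X + a₂ Y, a₃ X + a₄ Y), expanded as a form, by the same recursion
-- F = a X^(d+1) + Y F′ as in eval.
infixl 8 _∘ᶠ_
_∘ᶠ_ : ∀ {d} → Form ℚ d → GL₂ → Form ℚ d
_∘ᶠ_ {zero}  (a ∷ []) γ = a ∷ []
_∘ᶠ_ {suc d} (a ∷ F)  γ =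
  a ⊙ linear^ a₁ a₂ (suc d) ⊕ linear· a₃ a₄ (F ∘ᶠ γ)
  where open GL₂ γ

toℚ : ℤ → ℚ
toℚ z = z ℚ./ 1

Isomorphic : ∀ {d} → Bin d → Bin d → Set
Isomorphic F₁ F₂ = ∃ λ γ → map toℚ (form F₁) ∘ᶠ γ ≡ map toℚ (form F₂)

------------------------------------------------------------------------
-- Common values

Values : ∀ {d} → Bin d → Pred ℤ 0ℓ
Values F m = ∃₂ λ x y → eval (form F) x y ≡ m

Interval : ℕ → Pred ℤ 0ℓ
Interval N m = ℤ.- (+ N) ℤ.≤ m × m ℤ.≤ + N

-- 𝒩(F₁,F₂;N) is the number of elements of this set.
CommonValues : ∀ {d} → Bin d → Bin d → ℕ → Pred ℤ 0ℓ
CommonValues F₁ F₂ N = Values F₁ ∩ Values F₂ ∩ Interval N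

-- k ≤ ♯ S: S contains k distinct integers. Injectivity is required of the
-- integers themselves, not of pairs (integer, membership proof), so an
-- integer represented in several ways counts once. (♯ S itself is not a
-- term of type ℕ, since membership in Values is not evidently decidable.)
infix 4 _≤♯_
_≤♯_ : ℕ → Pred ℤ 0ℓ → Set
k ≤♯ S = ∃ λ (f : Fin k → ℤ) → Injective _≡_ _≡_ f × (∀ i → f i ∈ S)

------------------------------------------------------------------------
-- Asymptotics

-- q · N^(2/d) ≤ k, for d ≥ 1. It holds trivially when q < 0; otherwise both
-- sides are nonnegative and may be raised to the power d.
infix 4 _·_^[2/_]≤_
_·_^[2/_]≤_ : ℚ → ℕ → ℕ → ℕ → Set
q · N ^[2/ d ]≤ k =
  0ℚ ℚ.≤ q → (q ^ℚ d) ℚ.* toℚ (+ (N ℕ.^ 2)) ℚ.≤ toℚ (+ (k ℕ.^ d))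

-- 𝒩(F₁,F₂;N) ≥ q · N^(2/d)
𝒩[_,_⨾_]≥_·N^2/d : ∀ {d} → Bin d → Bin d → ℕ → ℚ → Set
𝒩[_,_⨾_]≥_·N^2/d {d} F₁ F₂ N q =
  ∃ λ k → k ≤♯ CommonValues F₁ F₂ N × q · N ^[2/ d ]≤ k

-- o(1) as N → ∞. For a lower bound of the shape C - o(1) with C > 0, rational
-- C and o lose nothing: a real C > 0 may be lowered to a positive rational,
-- and a real null sequence is dominated by a rational one.
Vanishing : (ℕ → ℚ) → Set
Vanishing o = ∀ ε → 0ℚ ℚ.< ε → ∃ λ N₀ → ∀ N → N₀ ℕ.≤ N → ℚ.∣ o N ∣ ℚ.< ε

{-# OPTIONS --safe #-}
module Submission where

-- Clearing the denominators of γ shows that a fixed multiple of every value of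
-- F = F₂ is a value of both forms, so it suffices that F takes at least c B²
-- distinct values at the points of a box of side B (Erdős–Mahler).
--
-- Put B = z^T with T depending on d only, and split F(P) = s q, where s collects
-- the primes ≤ z. Counting zeros of F modulo prime powers, together with the
-- estimate Σ_{p ≤ z} (log p)/p = O(log z) coming from z!, shows that s is at most
-- a small power of B for a positive proportion of the coprime points, so that
-- q > const · B², as d ≥ 3. Since q has boundedly many prime factors and
-- F has at most d projective zeros modulo each, the points with a given value fall
-- into boundedly many classes of points proportional modulo every prime factor
-- of q. By Hensel's lemma, which is where the discriminant enters, points of
-- one class are proportional modulo q; their determinant is O(B²) < q, hence
-- zero, and coprimality makes them equal. So every value is taken boundedly often.

-- The zeros of F modulo a value w form up to d^ω(w) projective classes, and the number ω(w) of
-- prime factors is unbounded. Dropping the primes up to z = B^(1/T) leaves at most t = T d factors,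
-- but costs the smooth part s, and this cost fixes the exponents. In a row of the box the smooth
-- parts at coprime points have product at most z^(E B) with E = 4 d + 1, so at most a quarter of
-- the row has s ≥ S = z^(4E). Taking B = S² makes q at least of order B^(d - 1/2), which beats B²
-- for d ≥ 3. Noncoprime points fill at most half of the box, so a quarter of it survives. Zero
-- counting fails at primes dividing the leading coefficient, Hensel's lemma at primes dividing the
-- resultant of the partial derivatives. Both are kept out of the relevant factor of F by fixing
-- residue classes for the coordinates. A shear (x, y) ↦ (x, c x + y) with F(1, c) ≠ 0 provides a
-- nonzero leading coefficient, which also bounds F from below where x dominates y. Only the boxes
-- of side z^T are treated; consecutive ones have bounded ratio, so every large N is reached at the
-- cost of a constant.

open import Defs

-- Column operations on determinants; common zeros modulo p and the resultant.

module Determinants where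
  open import Data.Nat.Base as ℕ using (ℕ; zero; suc; s≤s)
  import Data.Nat.Properties as ℕ
  open import Data.Integer.Base using (ℤ; 0ℤ; 1ℤ; -1ℤ; _+_; _*_; _^_)
  open import Data.Integer.Properties using (+-identityˡ; +-identityʳ; *-identityˡ; *-zeroʳ)
  open import Data.Integer.Divisibility.Signed using (_∣_; divides; ∣n⇒∣m*n)
  open import Data.Integer.Tactic.RingSolver using (solve-∀)
  open import Data.Fin.Base using (Fin; zero; suc; toℕ; inject₁; punchIn; punchOut; splitAt; fromℕ; fromℕ<)
  open import Data.Fin.Properties
    using (_≟_; punchIn-punchOut; punchInᵢ≢i; punchIn-injective; toℕ-inject₁; toℕ<n; toℕ-fromℕ; toℕ-fromℕ<; toℕ-injective)
  open import Data.Vec.Base using (Vec; []; _∷_; _++_; replicate; head)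
  open import Data.Bool.Base using (if_then_else_)
  open import Data.Product.Base using (∃; _×_; _,_)
  open import Data.Sum.Base using (_⊎_; inj₁; inj₂; [_,_]′)
  open import Data.Empty using (⊥-elim)
  open import Function.Base using (_∘_; case_of_)
  open import Relation.Nullary using (yes; no; does; ¬_)
  open import Relation.Nullary.Decidable using (dec-true; dec-false)
  open import Relation.Binary.PropositionalEquality

  ∑-cong : ∀ {n} {f g : Fin n → ℤ} → (∀ i → f i ≡ g i) → ∑ f ≡ ∑ g
  ∑-cong {zero}  eq = refl
  ∑-cong {suc n} eq = cong₂ _+_ (eq zero) (∑-cong (eq ∘ suc))

  ∑-zero : ∀ {n} {f : Fin n → ℤ} → (∀ i → f i ≡ 0ℤ) → ∑ f ≡ 0ℤ
  ∑-zero {zero}  eq = refl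
  ∑-zero {suc n} eq rewrite eq zero | ∑-zero (eq ∘ suc) = refl

  ∑-linear : ∀ {n} (α β : ℤ) {f g h : Fin n → ℤ} →
             (∀ i → h i ≡ α * f i + β * g i) → ∑ h ≡ α * ∑ f + β * ∑ g
  ∑-linear {zero}  α β eq = sym (cong₂ _+_ (*-zeroʳ α) (*-zeroʳ β))
  ∑-linear {suc n} α β {f} {g} eq
    rewrite eq zero | ∑-linear α β (eq ∘ suc) =
    lemma α β (f zero) (g zero) (∑ (f ∘ suc)) (∑ (g ∘ suc))
    where
    lemma : ∀ α β a b c d → (α * a + β * b) + (α * c + β * d) ≡ α * (a + c) + β * (b + d)
    lemma = solve-∀

  -- The shape of a Laplace expansion with two equal adjacent columns: only the terms deleting one
  -- of the two survive, and they cancel.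
  ∑-adjacent : ∀ {n} (f : Fin (suc n) → ℤ) (k : Fin n) →
               (∀ j → j ≢ inject₁ k → j ≢ suc k → f j ≡ 0ℤ) →
               f (inject₁ k) + f (suc k) ≡ 0ℤ → ∑ f ≡ 0ℤ
  ∑-adjacent f zero others pair
    rewrite ∑-zero {f = λ i → f (suc (suc i))} (λ i → others (suc (suc i)) (λ ()) (λ ()))
          | +-identityʳ (f (suc zero)) = pair
  ∑-adjacent f (suc k) others pair
    rewrite others zero (λ ()) (λ ()) =
    trans (+-identityˡ _)
      (∑-adjacent (f ∘ suc) k
        (λ j j≢k j≢sk → others (suc j) (λ { refl → j≢k refl }) (λ { refl → j≢sk refl }))
        pair)

  minor : ∀ {n} → Matrix (suc n) → Fin (suc n) → Matrix n
  minor M j i k = M (suc i) (punchIn j k)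

  det-cong : ∀ {n} {M N : Matrix n} → (∀ i j → M i j ≡ N i j) → det M ≡ det N
  det-cong {zero}  eq = refl
  det-cong {suc n} eq = ∑-cong λ j →
    cong₂ _*_ (cong (-1ℤ ^ toℕ j *_) (eq zero j)) (det-cong λ i k → eq (suc i) (punchIn j k))

  -- Column `k` enters the expansion either through the first-row factor of the term `j = k`, whose
  -- minor omits it, or through the minor of a term `j ≢ k`, where induction applies. The case β = 0
  -- extracts a common factor.
  det-linear : ∀ {n} (k : Fin n) (α β : ℤ) {A B C : Matrix n} →
               (∀ i j → j ≢ k → C i j ≡ A i j) → (∀ i j → j ≢ k → C i j ≡ B i j) →
               (∀ i → C i k ≡ α * A i k + β * B i k) →
               det C ≡ α * det A + β * det B
  det-linear {suc n} k α β {A} {B} {C} CA CB Ck = ∑-linear α β term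
    where
    collect : ∀ s a b α β m → s * (α * a + β * b) * m ≡ α * (s * a * m) + β * (s * b * m)
    collect = solve-∀

    distribute : ∀ s c a b α β → s * c * (α * a + β * b) ≡ α * (s * c * a) + β * (s * c * b)
    distribute = solve-∀

    avoid : ∀ {j} (j≢k : j ≢ k) {l} → l ≢ punchOut j≢k → punchIn j l ≢ k
    avoid {j} j≢k {l} l≢ eq = l≢ (punchIn-injective j l _ (trans eq (sym (punchIn-punchOut j≢k))))

    term : ∀ j → -1ℤ ^ toℕ j * C zero j * det (minor C j)
               ≡ α * (-1ℤ ^ toℕ j * A zero j * det (minor A j))
               + β * (-1ℤ ^ toℕ j * B zero j * det (minor B j))
    term j with j ≟ k
    ... | yes refl
      rewrite Ck zero
            | sym (det-cong {M = minor C j} {minor A j} λ i l → CA (suc i) (punchIn j l) (punchInᵢ≢i j l))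
            | sym (det-cong {M = minor C j} {minor B j} λ i l → CB (suc i) (punchIn j l) (punchInᵢ≢i j l))
      = collect (-1ℤ ^ toℕ j) (A zero j) (B zero j) α β _
    ... | no j≢k
      rewrite sym (CA zero j j≢k) | sym (CB zero j j≢k)
            | det-linear (punchOut j≢k) α β {minor A j} {minor B j} {minor C j}
                (λ i l l≢ → CA (suc i) (punchIn j l) (avoid j≢k l≢))
                (λ i l l≢ → CB (suc i) (punchIn j l) (avoid j≢k l≢))
                (λ i → subst (λ c → C (suc i) c ≡ α * A (suc i) c + β * B (suc i) c)
                         (sym (punchIn-punchOut j≢k)) (Ck (suc i)))
      = distribute (-1ℤ ^ toℕ j) (C zero j) _ _ α β

  -- Deleting one or the other of two adjacent columns leaves lists of columns that differ only
  -- where the survivor of the two stands. If the two columns are equal, so are the minors.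
  punchIn-adjacent : ∀ {n} (k l : Fin n) →
    punchIn (inject₁ k) l ≡ punchIn (suc k) l ⊎
    (punchIn (inject₁ k) l ≡ suc k × punchIn (suc k) l ≡ inject₁ k)
  punchIn-adjacent zero    zero    = inj₂ (refl , refl)
  punchIn-adjacent zero    (suc l) = inj₁ refl
  punchIn-adjacent (suc k) zero    = inj₁ refl
  punchIn-adjacent (suc k) (suc l) with punchIn-adjacent k l
  ... | inj₁ eq        = inj₁ (cong suc eq)
  ... | inj₂ (eq , eq′) = inj₂ (cong suc eq , cong suc eq′)

  -- Adjacent columns stay adjacent when a third one is deleted, which carries the induction of
  -- `det-alternating` to the minors.
  adjacent-preimage : ∀ {n} (j : Fin (suc (suc n))) (k : Fin (suc n)) →
    j ≢ inject₁ k → j ≢ suc k →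
    ∃ λ k′ → punchIn j (inject₁ k′) ≡ inject₁ k × punchIn j (suc k′) ≡ suc k
  adjacent-preimage zero          zero     j≢k _ = ⊥-elim (j≢k refl)
  adjacent-preimage zero          (suc k)  _ _   = k , refl , refl
  adjacent-preimage (suc zero)    zero     _ j≢  = ⊥-elim (j≢ refl)
  adjacent-preimage {suc n} (suc (suc j)) zero _ _ = zero , refl , refl
  adjacent-preimage {suc n} (suc j) (suc k) j≢k j≢sk
    with adjacent-preimage j k (j≢k ∘ cong suc) (j≢sk ∘ cong suc)
  ... | k′ , eq , eq′ = suc k′ , cong suc eq , cong suc eq′

  -- The minors of all other columns vanish by induction; the two remaining terms have equal minors
  -- and opposite signs. Adjacent columns suffice, because the Horner scheme only adds multiples of
  -- a column to its neighbour.
  det-alternating : ∀ {n} (k : Fin n) {A : Matrix (suc n)} →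
                    (∀ i → A i (inject₁ k) ≡ A i (suc k)) → det A ≡ 0ℤ
  det-alternating {suc n} k {A} eq = ∑-adjacent _ k others pair
    where
    others : ∀ j → j ≢ inject₁ k → j ≢ suc k → -1ℤ ^ toℕ j * A zero j * det (minor A j) ≡ 0ℤ
    others j j≢k j≢sk with adjacent-preimage j k j≢k j≢sk
    ... | k′ , eq₁ , eq₂
      rewrite det-alternating k′ {minor A j} (λ i →
                trans (cong (A (suc i)) eq₁) (trans (eq (suc i)) (cong (A (suc i)) (sym eq₂))))
      = *-zeroʳ (-1ℤ ^ toℕ j * A zero j)

    same : ∀ i l → minor A (inject₁ k) i l ≡ minor A (suc k) i l
    same i l with punchIn-adjacent k l
    ... | inj₁ e        = cong (A (suc i)) e
    ... | inj₂ (e , e′) = trans (cong (A (suc i)) e) (trans (sym (eq (suc i))) (cong (A (suc i)) (sym e′)))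

    cancel : ∀ s a m → s * a * m + -1ℤ * s * a * m ≡ 0ℤ
    cancel = solve-∀

    pair : -1ℤ ^ toℕ (inject₁ k) * A zero (inject₁ k) * det (minor A (inject₁ k))
         + -1ℤ ^ suc (toℕ k) * A zero (suc k) * det (minor A (suc k)) ≡ 0ℤ
    pair rewrite toℕ-inject₁ k | eq zero
               | det-cong {M = minor A (inject₁ k)} {minor A (suc k)} same
      = cancel (-1ℤ ^ toℕ k) (A zero (suc k)) (det (minor A (suc k)))

  replaceColumn : ∀ {n} → Matrix n → Fin n → (Fin n → ℤ) → Matrix n
  replaceColumn A k c i j = if does (j ≟ k) then c i else A i j

  replaceColumn-at : ∀ {n} (A : Matrix n) k c i → replaceColumn A k c i k ≡ c i
  replaceColumn-at A k c i with k ≟ k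
  ... | yes _  = refl
  ... | no k≢k = ⊥-elim (k≢k refl)

  replaceColumn-off : ∀ {n} (A : Matrix n) k c i j → j ≢ k → replaceColumn A k c i j ≡ A i j
  replaceColumn-off A k c i j j≢k with j ≟ k
  ... | yes j≡k = ⊥-elim (j≢k j≡k)
  ... | no _    = refl

  det-addColumn : ∀ {n} (k : Fin n) (t : ℤ) {A C : Matrix (suc n)} →
                  (∀ i j → j ≢ suc k → C i j ≡ A i j) →
                  (∀ i → C i (suc k) ≡ A i (suc k) + t * A i (inject₁ k)) → det C ≡ det A
  det-addColumn k t {A} {C} off at = begin
    det C  ≡⟨ det-linear (suc k) 1ℤ t off
            (λ i j j≢ → trans (off i j j≢) (sym (replaceColumn-off A (suc k) column i j j≢)))
            (λ i → trans (at i) (cong₂ _+_ (sym (*-identityˡ (A i (suc k))))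
            (cong (t *_) (sym (replaceColumn-at A (suc k) column i))))) ⟩
    1ℤ * det A + t * det B  ≡⟨ cong (λ z → 1ℤ * det A + t * z) (det-alternating k {B} equal) ⟩
    1ℤ * det A + t * 0ℤ  ≡⟨ lemma (det A) t ⟩
    det A  ∎
    where
    open ≡-Reasoning
    lemma : ∀ d t → 1ℤ * d + t * 0ℤ ≡ d
    lemma = solve-∀
    column = λ i → A i (inject₁ k)
    B = replaceColumn A (suc k) column
    inject₁≢suc : ∀ {n} (k : Fin n) → inject₁ k ≢ suc k
    inject₁≢suc k eq = ℕ.1+n≢n {toℕ k} (trans (sym (cong toℕ eq)) (toℕ-inject₁ k))
    equal : ∀ i → B i (inject₁ k) ≡ B i (suc k)
    equal i = trans (replaceColumn-off A (suc k) column i (inject₁ k) (inject₁≢suc k))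
                (sym (replaceColumn-at A (suc k) column i))

  det-∣-column : ∀ {n} (p : ℤ) (k : Fin n) {A : Matrix n} → (∀ i → p ∣ A i k) → p ∣ det A
  det-∣-column p k {A} p∣ = divides (det B) (begin
    det A  ≡⟨ det-linear k p 0ℤ off off at ⟩
    p * det B + 0ℤ * det B  ≡⟨ lemma p (det B) ⟩
    det B * p  ∎)
    where
    open ≡-Reasoning
    lemma : ∀ p d → p * d + 0ℤ * d ≡ d * p
    lemma = solve-∀
    column = λ i → _∣_.quotient (p∣ i)
    B = replaceColumn A k column
    off : ∀ i j → j ≢ k → A i j ≡ B i j
    off i j j≢k = sym (replaceColumn-off A k column i j j≢k)
    swap : ∀ p q → q * p ≡ p * q + 0ℤ * q
    swap = solve-∀
    at : ∀ i → A i k ≡ p * B i k + 0ℤ * B i k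
    at i = trans (_∣_.equality (p∣ i)) (trans (swap p (column i))
             (cong (λ b → p * b + 0ℤ * b) (sym (replaceColumn-at A k column i))))

  -- The value r₀ t^k + r₁ t^(k-1) + ... + r_k, accumulated so that column k of a matrix needs only
  -- the updated column k - 1.
  horner : ℤ → (ℕ → ℤ) → ℕ → ℤ
  horner t r zero    = r zero
  horner t r (suc k) = r (suc k) + t * horner t r k

  -- Adding t times each column to the next one, from left to right, turns
  -- the last column into the Horner values of the rows.
  det-∣-horner : ∀ {n} (p t : ℤ) (ρ : Fin (suc n) → ℕ → ℤ) →
                 (∀ i → p ∣ horner t (ρ i) n) → p ∣ det (λ i j → ρ i (toℕ j))
  det-∣-horner {n} p t ρ p∣ = subst (p ∣_) (trans (det-stage n ℕ.≤-refl) stage₀) (det-∣-column p (fromℕ n) {stage n} lastColumn)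
    where
    -- At stage m the columns 0, ..., m hold their Horner values and the later ones are untouched;
    -- column 0 is its own Horner value.
    stage : ℕ → Matrix (suc n)
    stage m i j = if does (toℕ j ℕ.≤? m) then horner t (ρ i) (toℕ j) else ρ i (toℕ j)

    below : ∀ {m i j} → toℕ j ℕ.≤ m → stage m i j ≡ horner t (ρ i) (toℕ j)
    below {m} {i} {j} le = cong (if_then horner t (ρ i) (toℕ j) else ρ i (toℕ j)) (dec-true (toℕ j ℕ.≤? m) le)

    above : ∀ {m i j} → ¬ (toℕ j ℕ.≤ m) → stage m i j ≡ ρ i (toℕ j)
    above {m} {i} {j} ¬le = cong (if_then horner t (ρ i) (toℕ j) else ρ i (toℕ j)) (dec-false (toℕ j ℕ.≤? m) ¬le)

    stage₀ : det (stage 0) ≡ det (λ i j → ρ i (toℕ j))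
    stage₀ = det-cong eq
      where
      eq : ∀ i j → stage 0 i j ≡ ρ i (toℕ j)
      eq i zero    = refl
      eq i (suc j) = refl

    det-stage : ∀ m → m ℕ.≤ n → det (stage m) ≡ det (stage 0)
    det-stage zero    _   = refl
    det-stage (suc m) m<n = trans (det-addColumn k t off at) (det-stage m (ℕ.<⇒≤ m<n))
      where
      k = fromℕ< m<n
      toℕk = toℕ-fromℕ< m<n
      off : ∀ i j → j ≢ suc k → stage (suc m) i j ≡ stage m i j
      off i j j≢ = case toℕ j ℕ.≤? m of λ where
        (yes le) → trans (below (ℕ.m≤n⇒m≤1+n le)) (sym (below le))
        (no ¬le) → trans (above λ le → j≢ (toℕ-injective (trans (ℕ.≤-antisym le (ℕ.≰⇒> ¬le)) (cong suc (sym toℕk)))))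
                     (sym (above ¬le))
      at : ∀ i → stage (suc m) i (suc k) ≡ stage m i (suc k) + t * stage m i (inject₁ k)
      at i = begin
        stage (suc m) i (suc k) ≡⟨ below (s≤s (ℕ.≤-reflexive toℕk)) ⟩
        ρ i (suc (toℕ k)) + t * horner t (ρ i) (toℕ k)
          ≡⟨ cong₂ (λ a b → a + t * b)
               (sym (above {m} {i} {suc k} (ℕ.<⇒≱ (s≤s (ℕ.≤-reflexive (sym toℕk))))))
               (trans (cong (horner t (ρ i)) (sym (toℕ-inject₁ k)))
                 (sym (below {m} {i} {inject₁ k} (ℕ.≤-reflexive (trans (toℕ-inject₁ k) toℕk))))) ⟩
        stage m i (suc k) + t * stage m i (inject₁ k) ∎
        where open ≡-Reasoning

    lastColumn : ∀ i → p ∣ stage n i (fromℕ n)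
    lastColumn i = subst (p ∣_)
      (sym (trans (below (ℕ.≤-reflexive (toℕ-fromℕ n))) (cong (horner t (ρ i)) (toℕ-fromℕ n)))) (p∣ i)

  -- Peels off the top coefficient instead of the bottom one: this matches the recursion of `eval`
  -- and removes leading zeros.
  horner-shift : ∀ t r k → horner t r (suc k) ≡ r 0 * t ^ suc k + horner t (r ∘ suc) k
  horner-shift t r zero    = lemma (r 0) (r 1) t
    where
    lemma : ∀ a b t → b + t * a ≡ a * (t * 1ℤ) + b
    lemma = solve-∀
  horner-shift t r (suc k) rewrite horner-shift t r k = lemma (r (suc (suc k))) (r 0) t (t ^ suc k) (horner t (r ∘ suc) k)
    where
    lemma : ∀ a b t u h → a + t * (b * u + h) ≡ b * (t * u) + (a + t * h)
    lemma = solve-∀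

  horner-eval : ∀ {e} (G : Form ℤ e) t → horner t (entry G) e ≡ eval G t 1ℤ
  horner-eval {zero}  (a ∷ [])  t = refl
  horner-eval {suc e} (a ∷ G) t =
    trans (horner-shift t (entry (a ∷ G)) e)
      (cong (a * t ^ suc e +_) (trans (horner-eval G t) (sym (*-identityˡ _))))

  entry-beyond : ∀ {n} (v : Vec ℤ n) k → n ℕ.≤ k → entry v k ≡ 0ℤ
  entry-beyond []      k       _         = refl
  entry-beyond (a ∷ v) (suc k) (s≤s n≤k) = entry-beyond v k n≤k

  -- Leading zeros do not change the Horner value, and each trailing zero multiplies it by t.
  ∣-horner-padded : ∀ {e} {p t} (G : Form ℤ e) → p ∣ eval G t 1ℤ →
                    ∀ i k → i ℕ.+ e ℕ.≤ k → p ∣ horner t (entry (replicate i 0ℤ ++ G)) k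
  ∣-horner-padded {e} {p} {t} G p∣ zero k e≤k
    with ℕ.m≤n⇒∃[o]m+o≡n e≤k
  ... | o , refl = beyond o
    where
    beyond : ∀ o → p ∣ horner t (entry G) (e ℕ.+ o)
    beyond zero rewrite ℕ.+-identityʳ e | horner-eval G t = p∣
    beyond (suc o) rewrite ℕ.+-suc e o | entry-beyond G (suc (e ℕ.+ o)) (s≤s (ℕ.m≤m+n e o))
                         | +-identityˡ (t * horner t (entry G) (e ℕ.+ o)) = ∣n⇒∣m*n t (beyond o)
  ∣-horner-padded {e} {p} {t} G p∣ (suc i) (suc k) (s≤s le) =
    subst (p ∣_) (sym (trans (horner-shift t (entry (replicate (suc i) 0ℤ ++ G)) k) (+-identityˡ _))) (∣-horner-padded G p∣ i k le)

  -- Modulo p, every row of the Sylvester matrix annihilates the vector of powers of t.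
  ∣-resultant : ∀ {n} (P Q : Form ℤ (suc n)) p t → p ∣ eval P t 1ℤ → p ∣ eval Q t 1ℤ →
                p ∣ resultant P Q
  ∣-resultant {n} P Q p t p∣P p∣Q =
    subst (p ∣_) (det-cong (λ r k → agree r (toℕ k))) (det-∣-horner p t row p∣row)
    where
    -- The rows are rebuilt as functions on all of ℕ, as `det-∣-horner` expects; `agree` identifies
    -- them with those of `sylvester`.
    G : Fin (suc n ℕ.+ suc n) → Form ℤ (suc n)
    G r = [ (λ _ → P) , (λ _ → Q) ]′ (splitAt (suc n) r)
    pos : Fin (suc n ℕ.+ suc n) → Fin (suc n)
    pos r = [ (λ i → i) , (λ i → i) ]′ (splitAt (suc n) r)
    row : Fin (suc n ℕ.+ suc n) → ℕ → ℤ
    row r = entry (replicate (toℕ (pos r)) 0ℤ ++ G r)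
    agree : ∀ r k → row r k ≡ [ (λ i → entry (replicate (toℕ i) 0ℤ ++ P) k) , (λ i → entry (replicate (toℕ i) 0ℤ ++ Q) k) ]′ (splitAt (suc n) r)
    agree r k with splitAt (suc n) r
    ... | inj₁ _ = refl
    ... | inj₂ _ = refl
    p∣G : ∀ r → p ∣ eval (G r) t 1ℤ
    p∣G r with splitAt (suc n) r
    ... | inj₁ _ = p∣P
    ... | inj₂ _ = p∣Q
    p∣row : ∀ r → p ∣ horner t (row r) (n ℕ.+ suc n)
    p∣row r = ∣-horner-padded (G r) (p∣G r) (toℕ (pos r)) _ (ℕ.+-monoˡ-≤ (suc n) (ℕ.s≤s⁻¹ (toℕ<n (pos r))))

  -- The common zero (1, 0), which is not of the form (t, 1): the first column contains only zeros
  -- and the two leading coefficients.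
  ∣-resultant-heads : ∀ {n} (P Q : Form ℤ (suc n)) p → p ∣ head P → p ∣ head Q →
                      p ∣ resultant P Q
  ∣-resultant-heads {n} P Q p p∣P p∣Q = det-∣-column p zero {sylvester P Q} first
    where
    padded : ∀ i (G : Form ℤ (suc n)) → p ∣ head G → p ∣ entry (replicate i 0ℤ ++ G) 0
    padded zero    (a ∷ G) p∣a = p∣a
    padded (suc i) G       _   = divides 0ℤ refl
    first : ∀ r → p ∣ sylvester P Q r zero
    first r with splitAt (suc n) r
    ... | inj₁ i = padded (toℕ i) P p∣P
    ... | inj₂ i = padded (toℕ i) Q p∣Q

-- Divisibility by primes, and cancellation of coprime factors.

module PrimeDivisors where
  open import Data.Nat.Base as ℕ using (ℕ; zero; suc; NonZero; ≢-nonZero⁻¹)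
  import Data.Nat.Properties as ℕ
  import Data.Nat.Divisibility as ℕ
  open import Data.Nat.GCD using (module Bézout)
  open import Data.Nat.Coprimality as Coprimality using (Coprime; coprime-Bézout; coprime-divisor)
  open import Data.Nat.Primality using (Prime; euclidsLemma; prime⇒irreducible; ¬prime[1])
  open import Data.Nat.Primality.Factorisation using (factorise)
  open import Data.Integer.Base using (+_; -[1+_]; 1ℤ; _+_; _-_; _*_; -_; _^_; ∣_∣)
  open import Data.Integer.Properties using (abs-*; pos-*; pos-+)
  open import Data.Integer.Divisibility.Signed
  open import Data.Integer.Tactic.RingSolver using (solve-∀)
  open import Data.List.Base using ([]; _∷_)
  open import Data.List.Relation.Unary.All using ([]; _∷_)
  open import Data.Product.Base using (∃; _×_; _,_)
  open import Data.Sum.Base using (_⊎_; inj₁; inj₂)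
  open import Data.Empty using (⊥-elim)
  open import Relation.Nullary using (¬_; yes; no)
  open import Relation.Binary.PropositionalEquality

  prime-∣-* : ∀ {p} → Prime p → ∀ a b → + p ∣ a * b → (+ p ∣ a) ⊎ (+ p ∣ b)
  prime-∣-* {p} pr a b p∣ab with euclidsLemma ∣ a ∣ ∣ b ∣ pr (subst (p ℕ.∣_) (abs-* a b) (∣⇒∣ᵤ p∣ab))
  ... | inj₁ d = inj₁ (∣ᵤ⇒∣ d)
  ... | inj₂ d = inj₂ (∣ᵤ⇒∣ d)

  prime∤1 : ∀ {p} → Prime p → ¬ (+ p ∣ 1ℤ)
  prime∤1 pr p∣1 with refl ← ℕ.∣1⇒≡1 (∣⇒∣ᵤ p∣1) = ¬prime[1] pr

  prime-∣-^ : ∀ {p} → Prime p → ∀ a n → + p ∣ a ^ n → + p ∣ a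
  prime-∣-^ pr a zero    p∣ = ⊥-elim (prime∤1 pr p∣)
  prime-∣-^ pr a (suc n) p∣ with prime-∣-* pr a (a ^ n) p∣
  ... | inj₁ p∣a  = p∣a
  ... | inj₂ p∣aⁿ = prime-∣-^ pr a n p∣aⁿ

  ∣-cong : ∀ {k a b} → a ≡ b → k ∣ a → k ∣ b
  ∣-cong {k} = subst (k ∣_)

  inverse : ∀ {p} → Prime p → ∀ w → ¬ (+ p ∣ w) → ∃ λ v → + p ∣ v * w - 1ℤ
  inverse {p} pr w p∤w = signed w (natural (coprime-Bézout coprime))
    where
    coprime : Coprime p ∣ w ∣
    coprime (d∣p , d∣w) with prime⇒irreducible pr d∣p
    ... | inj₁ d≡1 = d≡1
    ... | inj₂ refl = ⊥-elim (p∤w (∣ᵤ⇒∣ d∣w))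
    natural : ∀ {n} → Bézout.Identity 1 p n → ∃ λ v → + p ∣ v * + n - 1ℤ
    natural {n} (Bézout.+- x y eq) = - (+ y) , divides (- (+ x)) (begin
      - (+ y) * + n - 1ℤ  ≡⟨ lemma (+ y) (+ n) ⟩
      - (1ℤ + + y * + n)  ≡⟨ cong (λ z → - (1ℤ + z)) (sym (pos-* y n)) ⟩
      - (1ℤ + + (y ℕ.* n))  ≡⟨ cong -_ (sym (pos-+ 1 (y ℕ.* n))) ⟩
      - (+ (1 ℕ.+ y ℕ.* n))  ≡⟨ cong (λ z → - (+ z)) eq ⟩
      - (+ (x ℕ.* p))  ≡⟨ cong -_ (pos-* x p) ⟩
      - (+ x * + p)  ≡⟨ lemma′ (+ x) (+ p) ⟩
      - (+ x) * + p  ∎)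
      where
      open ≡-Reasoning
      lemma : ∀ y n → - y * n - 1ℤ ≡ - (1ℤ + y * n)
      lemma = solve-∀
      lemma′ : ∀ x p → - (x * p) ≡ - x * p
      lemma′ = solve-∀
    natural {n} (Bézout.-+ x y eq) = + y , divides (+ x) (begin
      + y * + n - 1ℤ  ≡⟨ cong (_- 1ℤ) (sym (pos-* y n)) ⟩
      + (y ℕ.* n) - 1ℤ  ≡⟨ cong (λ z → + z - 1ℤ) (sym eq) ⟩
      + (1 ℕ.+ x ℕ.* p) - 1ℤ  ≡⟨ cong (_- 1ℤ) (pos-+ 1 (x ℕ.* p)) ⟩
      1ℤ + + (x ℕ.* p) - 1ℤ  ≡⟨ lemma (+ (x ℕ.* p)) ⟩
      + (x ℕ.* p)  ≡⟨ pos-* x p ⟩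
      + x * + p  ∎)
      where
      open ≡-Reasoning
      lemma : ∀ z → 1ℤ + z - 1ℤ ≡ z
      lemma = solve-∀
    signed : ∀ w → (∃ λ v → + p ∣ v * + ∣ w ∣ - 1ℤ) → ∃ λ v → + p ∣ v * w - 1ℤ
    signed (+ n)    (v , p∣) = v , p∣
    signed -[1+ n ] (v , p∣) = - v , ∣-cong (lemma v (+ suc n)) p∣
      where
      lemma : ∀ v n → v * n - 1ℤ ≡ - v * - n - 1ℤ
      lemma = solve-∀

  prime-divisor : ∀ n → .{{NonZero n}} → n ≢ 1 → ∃ λ p → Prime p × p ℕ.∣ n
  prime-divisor n n≢1 with factorise n
  ... | record { factors = [] ; isFactorisation = eq } = ⊥-elim (n≢1 eq)
  ... | record { factors = p ∷ ps ; isFactorisation = eq ; factorsPrime = pr ∷ _ } =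
    p , pr , subst (p ℕ.∣_) (sym eq) (ℕ.m∣m*n _)

  -- A common divisor of `q` and `b` other than 1 would have a prime factor. Through this lemma,
  -- information modulo single primes yields divisibility by `q`.
  ∣-*-cancel : ∀ q → .{{NonZero q}} → ∀ a b → + q ∣ a * b →
               (∀ p → Prime p → p ℕ.∣ q → ¬ (+ p ∣ b)) → + q ∣ a
  ∣-*-cancel q a b q∣ab p∤b =
    ∣ᵤ⇒∣ (coprime-divisor coprime (subst (q ℕ.∣_) (trans (abs-* a b) (ℕ.*-comm ∣ a ∣ ∣ b ∣)) (∣⇒∣ᵤ q∣ab)))
    where
    nonZero : ∀ {i} → i ℕ.∣ q → NonZero i
    nonZero {zero}  0∣q = ⊥-elim (≢-nonZero⁻¹ q (ℕ.0∣⇒≡0 0∣q))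
    nonZero {suc i} _   = _
    coprime : Coprime q ∣ b ∣
    coprime {i} (i∣q , i∣b) with i ℕ.≟ 1
    ... | yes i≡1 = i≡1
    ... | no i≢1
      with p , pr , p∣i ← prime-divisor i {{nonZero i∣q}} i≢1 =
      ⊥-elim (p∤b p pr (ℕ.∣-trans p∣i i∣q) (∣ᵤ⇒∣ (ℕ.∣-trans p∣i i∣b)))

-- Partial derivatives, Taylor expansion and Hensel's lemma for binary forms.

module FormCalculus where
  open Determinants
  open PrimeDivisors
  open import Data.Nat.Base as ℕ using (ℕ; zero; suc; NonZero)
  import Data.Nat.Properties as ℕ
  import Data.Nat.Divisibility as ℕ
  open import Data.Nat.Primality using (Prime)
  open import Data.Integer.Base using (ℤ; +_; 0ℤ; 1ℤ; _+_; _-_; _*_; -_; _^_)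
  open import Data.Integer.Properties using (pos-+; *-identityˡ; *-zeroʳ)
  open import Data.Integer.Divisibility.Signed
  open import Data.Integer.Tactic.RingSolver using (solve-∀)
  open import Data.Fin.Base using (toℕ)
  open import Data.Vec.Base using ([]; _∷_; head; tabulate; lookup)
  open import Data.Vec.Properties using (tabulate-cong)
  open import Data.Product.Base using (∃; _×_; _,_)
  open import Data.Sum.Base using (inj₁; inj₂; [_,_]′)
  open import Data.Empty using (⊥-elim)
  open import Relation.Nullary using (¬_; yes; no)
  open import Relation.Binary.PropositionalEquality

  -- Values of the partial derivatives, obtained by differentiating the recursion F = a X^(d+1) + Y
  -- F′.
  evX evY : ∀ {d} → Form ℤ d → ℤ → ℤ → ℤ
  evX {zero}  (a ∷ []) x w = 0ℤ
  evX {suc d} (a ∷ F)  x w = + suc d * a * x ^ d + w * evX F x w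
  evY {zero}  (a ∷ []) x w = 0ℤ
  evY {suc d} (a ∷ F)  x w = eval F x w + w * evY F x w

  eval-∂X : ∀ {n} (F : Form ℤ (suc n)) x w → eval (∂X F) x w ≡ evX F x w
  eval-∂X {zero}  (a ∷ b ∷ []) x w = lemma a w
    where
    lemma : ∀ a w → 1ℤ * a ≡ 1ℤ * a * 1ℤ + w * 0ℤ
    lemma = solve-∀
  eval-∂X {suc n} (a ∷ F)      x w =
    cong (λ e → + suc (suc n) * a * x ^ suc n + w * e) (eval-∂X F x w)

  -- The weights 1, 2, ... of `∂Y` shift along the recursion, so the induction needs an arbitrary
  -- offset; it contributes k F.
  eval-weighted : ∀ k {d} (F : Form ℤ d) x w →
    eval (tabulate λ i → + (k ℕ.+ toℕ i) * lookup F i) x w ≡ + k * eval F x w + w * evY F x w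
  eval-weighted k {zero} (a ∷ []) x w rewrite ℕ.+-identityʳ k = lemma (+ k) a w
    where
    lemma : ∀ k a w → k * a ≡ k * a + w * 0ℤ
    lemma = solve-∀
  eval-weighted k {suc d} (a ∷ F) x w = begin
    + (k ℕ.+ 0) * a * x ^ suc d + w * eval (tabulate λ i → + (k ℕ.+ suc (toℕ i)) * lookup F i) x w
      ≡⟨ cong₂ (λ c G → + c * a * x ^ suc d + w * eval G x w) (ℕ.+-identityʳ k)
           (tabulate-cong λ i → cong (λ c → + c * lookup F i) (ℕ.+-suc k (toℕ i))) ⟩
    + k * a * x ^ suc d + w * eval (tabulate λ i → + (suc k ℕ.+ toℕ i) * lookup F i) x w
      ≡⟨ cong (λ e → + k * a * x ^ suc d + w * e) (eval-weighted (suc k) F x w) ⟩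
    + k * a * x ^ suc d + w * (+ suc k * eval F x w + w * evY F x w)
      ≡⟨ cong (λ c → + k * a * x ^ suc d + w * (c * eval F x w + w * evY F x w)) (pos-+ 1 k) ⟩
    + k * a * x ^ suc d + w * ((1ℤ + + k) * eval F x w + w * evY F x w)
      ≡⟨ lemma (+ k) a (x ^ suc d) w (eval F x w) (evY F x w) ⟩
    + k * (a * x ^ suc d + w * eval F x w) + w * (eval F x w + w * evY F x w) ∎
    where
    open ≡-Reasoning
    lemma : ∀ k a u w f g → k * a * u + w * ((1ℤ + k) * f + w * g) ≡ k * (a * u + w * f) + w * (f + w * g)
    lemma = solve-∀

  eval-∂Y : ∀ {n} (F : Form ℤ (suc n)) x w → eval (∂Y F) x w ≡ evY F x w
  eval-∂Y (a ∷ F) x w = trans (eval-weighted 1 F x w) (cong (_+ w * evY F x w) (*-identityˡ (eval F x w)))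

  euler : ∀ {d} (F : Form ℤ d) x w → + d * eval F x w ≡ x * evX F x w + w * evY F x w
  euler {zero} (a ∷ []) x w = lemma a x w
    where
    lemma : ∀ a x w → 0ℤ * a ≡ x * 0ℤ + w * 0ℤ
    lemma = solve-∀
  euler {suc d} (a ∷ F) x w = begin
    + suc d * (a * (x * x ^ d) + w * eval F x w)
      ≡⟨ split (+ suc d) a x (x ^ d) w (eval F x w) ⟩
    + suc d * a * (x * x ^ d) + w * (+ suc d * eval F x w)
      ≡⟨ cong (λ e → + suc d * a * (x * x ^ d) + w * e) step ⟩
    + suc d * a * (x * x ^ d) + w * (eval F x w + (x * evX F x w + w * evY F x w))
      ≡⟨ lemma (+ suc d) a x (x ^ d) w (eval F x w) (evX F x w) (evY F x w) ⟩
    x * (+ suc d * a * x ^ d + w * evX F x w) + w * (eval F x w + w * evY F x w) ∎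
    where
    open ≡-Reasoning
    split : ∀ n a x u w f → n * (a * (x * u) + w * f) ≡ n * a * (x * u) + w * (n * f)
    split = solve-∀
    peel : ∀ n f → (1ℤ + n) * f ≡ f + n * f
    peel = solve-∀
    step : + suc d * eval F x w ≡ eval F x w + (x * evX F x w + w * evY F x w)
    step = trans (cong (_* eval F x w) (pos-+ 1 d))
             (trans (peel (+ d) (eval F x w)) (cong (λ z → eval F x w + z) (euler F x w)))
    lemma : ∀ n a x u w f g h →
      n * a * (x * u) + w * (f + (x * g + w * h)) ≡ x * (n * a * u + w * g) + w * (f + w * h)
    lemma = solve-∀

  *-^ : ∀ a b n → (a * b) ^ n ≡ a ^ n * b ^ n
  *-^ a b zero    = refl
  *-^ a b (suc n) rewrite *-^ a b n = lemma a b (a ^ n) (b ^ n)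
    where
    lemma : ∀ a b u v → a * b * (u * v) ≡ a * u * (b * v)
    lemma = solve-∀

  eval-homogeneous : ∀ {d} (F : Form ℤ d) s x w → eval F (s * x) (s * w) ≡ s ^ d * eval F x w
  eval-homogeneous {zero} (a ∷ []) s x w = sym (*-identityˡ a)
  eval-homogeneous {suc d} (a ∷ F) s x w
    rewrite *-^ s x (suc d) | eval-homogeneous F s x w =
    lemma a s (s ^ d) (x ^ suc d) w (eval F x w)
    where
    lemma : ∀ a s u v w f → a * (s * u * v) + s * w * (u * f) ≡ s * u * (a * v + w * f)
    lemma = solve-∀

  -- The factor s on the left avoids the exponent d - 1, which makes no sense for d = 0.
  evX-homogeneous : ∀ {d} (F : Form ℤ d) s x w → s * evX F (s * x) (s * w) ≡ s ^ d * evX F x w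
  evX-homogeneous {zero} (a ∷ []) s x w = *-zeroʳ s
  evX-homogeneous {suc d} (a ∷ F) s x w = begin
    s * (+ suc d * a * (s * x) ^ d + s * w * evX F (s * x) (s * w))
      ≡⟨ expand s (+ suc d * a) ((s * x) ^ d) w (evX F (s * x) (s * w)) ⟩
    s * (+ suc d * a * (s * x) ^ d) + s * w * (s * evX F (s * x) (s * w))
      ≡⟨ cong₂ (λ u v → s * (+ suc d * a * u) + s * w * v) (*-^ s x d) (evX-homogeneous F s x w) ⟩
    s * (+ suc d * a * (s ^ d * x ^ d)) + s * w * (s ^ d * evX F x w)
      ≡⟨ lemma s (+ suc d * a) (s ^ d) (x ^ d) w (evX F x w) ⟩
    s * s ^ d * (+ suc d * a * x ^ d + w * evX F x w) ∎
    where
    open ≡-Reasoning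
    expand : ∀ s b u w f → s * (b * u + s * w * f) ≡ s * (b * u) + s * w * (s * f)
    expand = solve-∀
    lemma : ∀ s b u v w f → s * (b * (u * v)) + s * w * (u * f) ≡ s * u * (b * v + w * f)
    lemma = solve-∀

  evY-homogeneous : ∀ {d} (F : Form ℤ d) s x w → s * evY F (s * x) (s * w) ≡ s ^ d * evY F x w
  evY-homogeneous {zero} (a ∷ []) s x w = *-zeroʳ s
  evY-homogeneous {suc d} (a ∷ F) s x w = begin
    s * (eval F (s * x) (s * w) + s * w * evY F (s * x) (s * w))
      ≡⟨ expand s (eval F (s * x) (s * w)) w (evY F (s * x) (s * w)) ⟩
    s * eval F (s * x) (s * w) + s * w * (s * evY F (s * x) (s * w))
      ≡⟨ cong₂ (λ u v → s * u + s * w * v) (eval-homogeneous F s x w) (evY-homogeneous F s x w) ⟩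
    s * (s ^ d * eval F x w) + s * w * (s ^ d * evY F x w)
      ≡⟨ lemma s (s ^ d) w (eval F x w) (evY F x w) ⟩
    s * s ^ d * (eval F x w + w * evY F x w) ∎
    where
    open ≡-Reasoning
    expand : ∀ s u w f → s * (u + s * w * f) ≡ s * u + s * w * (s * f)
    expand = solve-∀
    lemma : ∀ s u w f g → s * (u * f) + s * w * (u * g) ≡ s * u * (f + w * g)
    lemma = solve-∀

  -- The derivative in the direction (1, c), along which the sheared coordinate y of a point (x, c x
  -- + y) is constant.
  slope : ∀ {d} → ℤ → Form ℤ d → ℤ → ℤ → ℤ
  slope c F x w = evX F x w + c * evY F x w

  slope-homogeneous : ∀ {d} c (F : Form ℤ d) s x w → s * slope c F (s * x) (s * w) ≡ s ^ d * slope c F x w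
  slope-homogeneous {d} c F s x w = begin
    s * (evX F (s * x) (s * w) + c * evY F (s * x) (s * w))
      ≡⟨ expand s (evX F (s * x) (s * w)) c (evY F (s * x) (s * w)) ⟩
    s * evX F (s * x) (s * w) + c * (s * evY F (s * x) (s * w))
      ≡⟨ cong₂ (λ u v → u + c * v) (evX-homogeneous F s x w) (evY-homogeneous F s x w) ⟩
    s ^ d * evX F x w + c * (s ^ d * evY F x w)
      ≡⟨ lemma (s ^ d) (evX F x w) c (evY F x w) ⟩
    s ^ d * (evX F x w + c * evY F x w) ∎
    where
    open ≡-Reasoning
    expand : ∀ s a c b → s * (a + c * b) ≡ s * a + c * (s * b)
    expand = solve-∀
    lemma : ∀ s a c b → s * a + c * (s * b) ≡ s * (a + c * b)
    lemma = solve-∀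

  taylor-power : ∀ n x h → ∃ λ e → (x + h) ^ suc n ≡ x ^ suc n + h * (+ suc n * x ^ n) + h * h * e
  taylor-power zero x h = 0ℤ , lemma x h
    where
    lemma : ∀ x h → (x + h) * 1ℤ ≡ x * 1ℤ + h * (1ℤ * 1ℤ) + h * h * 0ℤ
    lemma = solve-∀
  taylor-power (suc n) x h with taylor-power n x h
  ... | e , eq = + suc n * x ^ n + (x + h) * e , (begin
    (x + h) * (x + h) ^ suc n
      ≡⟨ cong ((x + h) *_) eq ⟩
    (x + h) * (x * x ^ n + h * (+ suc n * x ^ n) + h * h * e)
      ≡⟨ lemma x h (+ suc n) (x ^ n) e ⟩
    x * (x * x ^ n) + h * ((1ℤ + + suc n) * (x * x ^ n)) + h * h * (+ suc n * x ^ n + (x + h) * e)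
      ≡⟨ cong (λ m → x * (x * x ^ n) + h * (m * (x * x ^ n)) + h * h * (+ suc n * x ^ n + (x + h) * e)) (sym (pos-+ 1 (suc n))) ⟩
    x * (x * x ^ n) + h * (+ suc (suc n) * (x * x ^ n)) + h * h * (+ suc n * x ^ n + (x + h) * e) ∎)
    where
    open ≡-Reasoning
    lemma : ∀ x h m u e → (x + h) * (x * u + h * (m * u) + h * h * e)
          ≡ x * (x * u) + h * ((1ℤ + m) * (x * u)) + h * h * (m * u + (x + h) * e)
    lemma = solve-∀

  taylor : ∀ {d} c (F : Form ℤ d) x w h →
           ∃ λ e → eval F (x + h) (w + h * c) ≡ eval F x w + h * slope c F x w + h * h * e
  taylor {zero} c (a ∷ []) x w h = 0ℤ , lemma a c h
    where
    lemma : ∀ a c h → a ≡ a + h * (0ℤ + c * 0ℤ) + h * h * 0ℤ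
    lemma = solve-∀
  taylor {suc d} c (a ∷ F) x w h with taylor-power d x h | taylor c F x w h
  ... | e₁ , eq₁ | e₂ , eq₂ =
    a * e₁ + c * slope c F x w + (w + h * c) * e₂ , (begin
    a * (x + h) ^ suc d + (w + h * c) * eval F (x + h) (w + h * c)
      ≡⟨ cong₂ (λ u v → a * u + (w + h * c) * v) eq₁ eq₂ ⟩
    a * (x ^ suc d + h * (+ suc d * x ^ d) + h * h * e₁) +
      (w + h * c) * (eval F x w + h * slope c F x w + h * h * e₂)
      ≡⟨ collect a (x ^ suc d) h (+ suc d * x ^ d) e₁ w c (eval F x w) (slope c F x w) e₂ ⟩
    eval (a ∷ F) x w + h * (a * (+ suc d * x ^ d) + w * slope c F x w + c * eval F x w) + h * h * e
      ≡⟨ cong (λ s → eval (a ∷ F) x w + h * s + h * h * e)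
           (regroup a (+ suc d) (x ^ d) w c (evX F x w) (evY F x w) (eval F x w)) ⟩
    eval (a ∷ F) x w + h * slope c (a ∷ F) x w + h * h * e ∎)
    where
    open ≡-Reasoning
    e = a * e₁ + c * slope c F x w + (w + h * c) * e₂
    collect : ∀ a u h v e₁ w c f s e₂ →
      a * (u + h * v + h * h * e₁) + (w + h * c) * (f + h * s + h * h * e₂)
      ≡ (a * u + w * f) + h * (a * v + w * s + c * f) + h * h * (a * e₁ + c * s + (w + h * c) * e₂)
    collect = solve-∀
    regroup : ∀ a n v w c g k f → a * (n * v) + w * (g + c * k) + c * f ≡ (n * a * v + w * g) + c * (f + w * k)
    regroup = solve-∀

  eval-∣-difference : ∀ {d k} (F : Form ℤ d) x {w w′} → k ∣ w - w′ → k ∣ eval F x w - eval F x w′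
  eval-∣-difference {zero} (a ∷ []) x k∣ = ∣-cong (lemma a) (divides 0ℤ refl)
    where
    lemma : ∀ a → 0ℤ ≡ a - a
    lemma = solve-∀
  eval-∣-difference {suc d} (a ∷ F) x {w} {w′} k∣ =
    ∣-cong (lemma a (x ^ suc d) w w′ (eval F x w) (eval F x w′))
      (∣m∣n⇒∣m+n (∣m⇒∣m*n (eval F x w) k∣) (∣n⇒∣m*n w′ (eval-∣-difference F x k∣)))
    where
    lemma : ∀ a u w w′ f f′ → (w - w′) * f + w′ * (f - f′) ≡ (a * u + w * f) - (a * u + w′ * f′)
    lemma = solve-∀

  eval-∣-head : ∀ {d k} (F : Form ℤ d) x w → k ∣ w → k ∣ eval F x w → k ∣ head F * x ^ d
  eval-∣-head {zero} (a ∷ []) x w _ k∣ = ∣m⇒∣m*n 1ℤ k∣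
  eval-∣-head {suc d} (a ∷ F) x w k∣w k∣ = ∣m+n∣n⇒∣m k∣ (∣m⇒∣m*n (eval F x w) k∣w)

  -- Opaque because unfolding the determinant exhausts the type checker.
  opaque
    ∂-resultant : ∀ {n} → Form ℤ (suc (suc n)) → ℤ
    ∂-resultant F = resultant (∂X F) (∂Y F)

    ∂-resultant-≡ : ∀ {n} (F : Form ℤ (suc (suc n))) → ∂-resultant F ≡ resultant (∂X F) (∂Y F)
    ∂-resultant-≡ F = refl

    ∣-∂-resultant : ∀ {n} (F : Form ℤ (suc (suc n))) p t → p ∣ eval (∂X F) t 1ℤ → p ∣ eval (∂Y F) t 1ℤ →
                    p ∣ ∂-resultant F
    ∣-∂-resultant F = ∣-resultant (∂X F) (∂Y F)

    ∣-∂-resultant-heads : ∀ {n} (F : Form ℤ (suc (suc n))) p → p ∣ head (∂X F) → p ∣ head (∂Y F) →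
                          p ∣ ∂-resultant F
    ∣-∂-resultant-heads F = ∣-resultant-heads (∂X F) (∂Y F)

  -- Modulo p, a common zero of the partial derivatives is a multiple either
  -- of (1, 0) or of some (t, 1).
  common-zero-∣ : ∀ {n} (F : Form ℤ (suc (suc n))) {p} → Prime p → ∀ x w → ¬ (+ p ∣ x × + p ∣ w) →
                  + p ∣ evX F x w → + p ∣ evY F x w → + p ∣ ∂-resultant F
  common-zero-∣ F {p} pr x w nonzero p∣X p∣Y with + p ∣? w
  ... | yes p∣w = ∣-∂-resultant-heads F (+ p)
                    (head-∣ (∂X F) (∣-cong (sym (eval-∂X F x w)) p∣X))
                    (head-∣ (∂Y F) (∣-cong (sym (eval-∂Y F x w)) p∣Y))
    where
    head-∣ : ∀ {d} (G : Form ℤ d) → + p ∣ eval G x w → + p ∣ head G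
    head-∣ {d} G p∣G with prime-∣-* pr (head G) (x ^ d) (eval-∣-head G x w p∣w p∣G)
    ... | inj₁ p∣a = p∣a
    ... | inj₂ p∣xᵈ with () ← nonzero (prime-∣-^ pr x d p∣xᵈ , p∣w)
  ... | no p∤w with v , p∣vw-1 ← inverse pr w p∤w =
    ∣-∂-resultant F (+ p) (v * x)
      (at-1 (∂X F) (∣-cong (sym (eval-∂X F x w)) p∣X))
      (at-1 (∂Y F) (∣-cong (sym (eval-∂Y F x w)) p∣Y))
    where
    lemma : ∀ a b → a - (a - b) ≡ b
    lemma = solve-∀
    at-1 : ∀ {d} (G : Form ℤ d) → + p ∣ eval G x w → + p ∣ eval G (v * x) 1ℤ
    at-1 {d} G p∣G = ∣-cong (lemma (eval G (v * x) (v * w)) (eval G (v * x) 1ℤ))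
      (∣m∣n⇒∣m-n (∣-cong (sym (eval-homogeneous G v x w)) (∣n⇒∣m*n (v ^ d) p∣G))
        (eval-∣-difference G (v * x) p∣vw-1))

  -- As a form in x and y, this has F(1, c) as its coefficient of x^d.
  sheared : ∀ {d} → ℤ → Form ℤ d → ℤ → ℤ → ℤ
  sheared c F x y = eval F x (c * x + y)

  -- In sheared coordinates Euler's identity reads d F = x · slope + y F_Y. At a zero modulo p with
  -- y prime to p, a vanishing slope would force F_Y and then F_X to vanish modulo p.
  ∤slope : ∀ {n} c (F : Form ℤ (suc (suc n))) {p} → Prime p → ¬ (+ p ∣ ∂-resultant F) →
           ∀ x y → ¬ (+ p ∣ y) → + p ∣ sheared c F x y → ¬ (+ p ∣ slope c F x (c * x + y))
  ∤slope {n} c F {p} pr p∤R x y p∤y p∣F p∣s = p∤R (common-zero-∣ F pr x w nonzero p∣X p∣Y)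
    where
    w = c * x + y
    nonzero : ¬ (+ p ∣ x × + p ∣ w)
    nonzero (p∣x , p∣w) = p∤y (∣m+n∣m⇒∣n p∣w (∣n⇒∣m*n c p∣x))
    lemma : ∀ x y c g h → x * g + (c * x + y) * h ≡ x * (g + c * h) + y * h
    lemma = solve-∀
    p∣yY : + p ∣ y * evY F x w
    p∣yY = ∣m+n∣m⇒∣n {m = x * slope c F x w}
      (∣-cong (trans (euler F x w) (lemma x y c (evX F x w) (evY F x w))) (∣n⇒∣m*n (+ suc (suc n)) {eval F x w} p∣F))
      (∣n⇒∣m*n x {slope c F x w} p∣s)
    p∣Y : + p ∣ evY F x w
    p∣Y = [ (λ p∣y → ⊥-elim (p∤y p∣y)) , (λ p∣Y → p∣Y) ]′ (prime-∣-* pr y (evY F x w) p∣yY)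
    p∣X : + p ∣ evX F x w
    p∣X = ∣m+n∣n⇒∣m {m = evX F x w} {n = c * evY F x w} p∣s (∣n⇒∣m*n c {evY F x w} p∣Y)

  infix 8 _∧_
  _∧_ : ℤ × ℤ → ℤ × ℤ → ℤ
  (x , y) ∧ (x₁ , y₁) = x * y₁ - x₁ * y

  -- Hensel's lemma for projective zeros: Taylor expansion of
  -- y₁^d F(x, y) = F(y x₁ + D, …) at y (x₁, y₁), where D is the determinant.
  ∣-∧ : ∀ {n} c (F : Form ℤ (suc (suc n))) q → .{{NonZero q}} → ∀ x y x₁ y₁ →
        + q ∣ sheared c F x y → + q ∣ sheared c F x₁ y₁ →
        (∀ p → Prime p → p ℕ.∣ q → ¬ (+ p ∣ ∂-resultant F) × ¬ (+ p ∣ y) × ¬ (+ p ∣ y₁) ×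
            + p ∣ (x , y) ∧ (x₁ , y₁)) →
        + q ∣ (x , y) ∧ (x₁ , y₁)
  ∣-∧ {n} c F q x y x₁ y₁ q∣P q∣P₁ local with taylor c F (y * x₁) (y * (c * x₁ + y₁)) ((x , y) ∧ (x₁ , y₁))
  ... | e , eq = ∣-*-cancel q D (y ^ d * s + y * D * e) q∣product coprime
    where
    d = suc (suc n)
    D = (x , y) ∧ (x₁ , y₁)
    w₁ = c * x₁ + y₁
    s = slope c F x₁ w₁
    expansion : y * (y₁ ^ d * sheared c F x y) ≡ y * (y ^ d * sheared c F x₁ y₁) + D * (y ^ d * s + y * D * e)
    expansion = begin
      y * (y₁ ^ d * sheared c F x y)
        ≡⟨ cong (y *_) (sym (eval-homogeneous F y₁ x (c * x + y))) ⟩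
      y * eval F (y₁ * x) (y₁ * (c * x + y))
        ≡⟨ cong₂ (λ a b → y * eval F a b) (first x y x₁ y₁) (second c x y x₁ y₁) ⟩
      y * eval F (y * x₁ + D) (y * w₁ + D * c)
        ≡⟨ cong (y *_) eq ⟩
      y * (eval F (y * x₁) (y * w₁) + D * slope c F (y * x₁) (y * w₁) + D * D * e)
        ≡⟨ expand y (eval F (y * x₁) (y * w₁)) D (slope c F (y * x₁) (y * w₁)) e ⟩
      y * eval F (y * x₁) (y * w₁) + D * (y * slope c F (y * x₁) (y * w₁) + y * D * e)
        ≡⟨ cong₂ (λ a b → y * a + D * (b + y * D * e)) (eval-homogeneous F y x₁ w₁) (slope-homogeneous c F y x₁ w₁) ⟩
      y * (y ^ d * eval F x₁ w₁) + D * (y ^ d * s + y * D * e) ∎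
      where
      open ≡-Reasoning
      first : ∀ x y x₁ y₁ → y₁ * x ≡ y * x₁ + (x * y₁ - x₁ * y)
      first = solve-∀
      second : ∀ c x y x₁ y₁ → y₁ * (c * x + y) ≡ y * (c * x₁ + y₁) + (x * y₁ - x₁ * y) * c
      second = solve-∀
      expand : ∀ y f D s e → y * (f + D * s + D * D * e) ≡ y * f + D * (y * s + y * D * e)
      expand = solve-∀
    q∣product : + q ∣ D * (y ^ d * s + y * D * e)
    q∣product = ∣m+n∣m⇒∣n {m = y * (y ^ d * sheared c F x₁ y₁)}
                  (∣-cong expansion (∣n⇒∣m*n y {y₁ ^ d * sheared c F x y} (∣n⇒∣m*n (y₁ ^ d) {sheared c F x y} q∣P)))
                  (∣n⇒∣m*n y {y ^ d * sheared c F x₁ y₁} (∣n⇒∣m*n (y ^ d) {sheared c F x₁ y₁} q∣P₁))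
    -- A prime p dividing q divides D, so the cofactor is y^d s modulo p, and neither y nor the
    -- slope s vanishes there.
    coprime : ∀ p → Prime p → p ℕ.∣ q → ¬ (+ p ∣ y ^ d * s + y * D * e)
    coprime p pr p∣q p∣ = let p∤R , p∤y , p∤y₁ , p∣D = local p pr p∣q in
      [ (λ p∣yᵈ → p∤y (prime-∣-^ pr y d p∣yᵈ))
      , ∤slope c F pr p∤R x₁ y₁ p∤y₁ (∣-trans {+ p} {+ q} (∣ᵤ⇒∣ p∣q) q∣P₁)
      ]′ (prime-∣-* pr (y ^ d) s
            (∣m+n∣n⇒∣m {m = y ^ d * s} {n = y * D * e} p∣ (∣m⇒∣m*n {m = y * D} e (∣n⇒∣m*n y {D} p∣D))))

-- Counting projective zeros modulo primes.

module Lagrange where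
  open PrimeDivisors
  open FormCalculus
  open import Data.Nat.Base as ℕ using (ℕ; zero; suc; z≤n)
  import Data.Nat.Properties as ℕ
  open import Data.Nat.Primality using (Prime)
  open import Data.Integer.Base using (ℤ; +_; 0ℤ; 1ℤ; _+_; _-_; _*_; _^_)
  open import Data.Integer.Properties using (*-identityʳ; ^-zeroˡ)
  open import Data.Integer.Divisibility.Signed
  open import Data.Integer.Tactic.RingSolver using (solve-∀)
  open import Data.List.Base using ([]; _∷_; length; filter)
  open import Data.List.Membership.Propositional using (_∈_)
  open import Data.List.Relation.Unary.All as All using (All; []; _∷_)
  open import Data.List.Relation.Unary.All.Properties using (filter⁺; all-filter)
  open import Data.List.Relation.Unary.Unique.Propositional using (Unique)
  import Data.List.Relation.Unary.Unique.Propositional.Properties as Unique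
  open import Data.Vec.Base using ([]; _∷_)
  open import Data.Product.Base using (∃; _×_; _,_; proj₁; proj₂)
  open import Data.Sum.Base using ([_,_]′)
  open import Data.Empty using (⊥-elim)
  open import Function.Base using (id; _∘_)
  open import Level using (0ℓ)
  open import Relation.Nullary using (¬_; yes; no)
  open import Relation.Nullary.Decidable using (¬?)
  open import Relation.Unary using (Pred; Decidable)
  open import Relation.Binary.PropositionalEquality

  -- Forms of degree n with coefficient a at xⁿ, characterised by the factor
  -- theorem, which is all that the counting of zeros needs.
  data IsForm : ℕ → ℤ → (ℤ → ℤ → ℤ) → Set where
    constant : ∀ {a f} → (∀ x y → f x y ≡ a) → IsForm zero a f
    divided  : ∀ {n a f} →
      (∀ x₁ y₁ → ∃ λ g → IsForm n (a * y₁ ^ n) g ×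
        (∀ x y → y₁ ^ suc n * f x y ≡ y ^ suc n * f x₁ y₁ + (x , y) ∧ (x₁ , y₁) * g x y)) →
      IsForm (suc n) a f

  isForm-lead : ∀ {n a b f} → a ≡ b → IsForm n a f → IsForm n b f
  isForm-lead refl F = F

  isForm-+ : ∀ n {a b f g} → IsForm n a f → IsForm n b g → IsForm n (a + b) (λ x y → f x y + g x y)
  isForm-+ zero    (constant F) (constant G) = constant λ x y → cong₂ _+_ (F x y) (G x y)
  isForm-+ (suc n) {a} {b} {f} {g} (divided F) (divided G) = divided λ x₁ y₁ →
    let f′ , F′ , eqF = F x₁ y₁ ; g′ , G′ , eqG = G x₁ y₁ in
    (λ x y → f′ x y + g′ x y) ,
    isForm-lead {n} (distrib a b (y₁ ^ n)) (isForm-+ n F′ G′) ,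
    λ x y → trans (expand (y₁ ^ suc n) (f x y) (g x y))
      (trans (cong₂ _+_ (eqF x y) (eqG x y))
        (collect (y ^ suc n) (f x₁ y₁) ((x , y) ∧ (x₁ , y₁)) (f′ x y) (g x₁ y₁) (g′ x y)))
    where
    distrib : ∀ a b u → a * u + b * u ≡ (a + b) * u
    distrib = solve-∀
    expand : ∀ u f g → u * (f + g) ≡ u * f + u * g
    expand = solve-∀
    collect : ∀ u f D f′ g g′ → (u * f + D * f′) + (u * g + D * g′) ≡ u * (f + g) + D * (f′ + g′)
    collect = solve-∀

  isForm-* : ∀ n k {a f} → IsForm n a f → IsForm n (k * a) (λ x y → k * f x y)
  isForm-* zero    k (constant F) = constant λ x y → cong (k *_) (F x y)
  isForm-* (suc n) k {a} {f} (divided F) = divided λ x₁ y₁ → let f′ , F′ , eqF = F x₁ y₁ in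
    (λ x y → k * f′ x y) ,
    isForm-lead {n} (assoc k a (y₁ ^ n)) (isForm-* n k F′) ,
    λ x y → trans (swap (y₁ ^ suc n) k (f x y))
      (trans (cong (k *_) (eqF x y))
        (distrib k (y ^ suc n) (f x₁ y₁) ((x , y) ∧ (x₁ , y₁)) (f′ x y)))
    where
    assoc : ∀ k a u → k * (a * u) ≡ k * a * u
    assoc = solve-∀
    swap : ∀ u k f → u * (k * f) ≡ k * (u * f)
    swap = solve-∀
    distrib : ∀ k u f D g → k * (u * f + D * g) ≡ u * (k * f) + D * (k * g)
    distrib = solve-∀

  -- For l = α x + β y and the determinant D one has y₁ l(x, y) = y l(x₁, y₁) + α D. The part α D
  -- puts a multiple of y^(n+1) into the quotient, hence the mutual recursion with the powers of y.
  isForm-linear : ∀ n α β {a f} → IsForm n a f → IsForm (suc n) (α * a) (λ x y → (α * x + β * y) * f x y)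
  -- Existential, because the coefficient of xⁿ is 1 for n = 0 and 0 otherwise.
  isForm-yⁿ : ∀ n → ∃ λ a → IsForm n a (λ x y → y ^ n)
  isForm-y¹⁺ⁿ : ∀ n → IsForm (suc n) 0ℤ (λ x y → y ^ suc n)

  isForm-linear zero α β {a} {f} (constant F) = divided λ x₁ y₁ →
    (λ _ _ → α * a) , constant (λ _ _ → sym (*-identityʳ (α * a))) ,
    λ x y → trans (cong (λ b → y₁ ^ 1 * ((α * x + β * y) * b)) (F x y))
      (trans (lemma x y x₁ y₁ α β a)
        (cong (λ b → y ^ 1 * ((α * x₁ + β * y₁) * b) + (x , y) ∧ (x₁ , y₁) * (α * a)) (sym (F x₁ y₁))))
    where
    lemma : ∀ x y x₁ y₁ α β a →
      y₁ * 1ℤ * ((α * x + β * y) * a) ≡ y * 1ℤ * ((α * x₁ + β * y₁) * a) + (x * y₁ - x₁ * y) * (α * a)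
    lemma = solve-∀
  isForm-linear (suc n) α β {a} {f} (divided F) = divided λ x₁ y₁ → let g , G , eqF = F x₁ y₁ in
    (λ x y → y₁ * ((α * x + β * y) * g x y) + α * f x₁ y₁ * y ^ suc n) ,
    isForm-lead {suc n} (lead α a y₁ (y₁ ^ n) (f x₁ y₁))
      (isForm-+ (suc n) (isForm-* (suc n) y₁ (isForm-linear n α β G)) (isForm-* (suc n) (α * f x₁ y₁) (isForm-y¹⁺ⁿ n))) ,
    λ x y → trans (swap y₁ (y₁ ^ suc n) (α * x + β * y) (f x y))
      (trans (cong (λ z → y₁ * ((α * x + β * y) * z)) (eqF x y))
        (lemma x y x₁ y₁ α β (f x₁ y₁) (y ^ suc n) (g x y)))
    where
    lead : ∀ α a y u f → y * (α * (a * u)) + α * f * 0ℤ ≡ α * a * (y * u)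
    lead = solve-∀
    swap : ∀ y u l f → y * u * (l * f) ≡ y * (l * (u * f))
    swap = solve-∀
    lemma : ∀ x y x₁ y₁ α β f u g →
      y₁ * ((α * x + β * y) * (u * f + (x * y₁ - x₁ * y) * g))
      ≡ y * u * ((α * x₁ + β * y₁) * f) + (x * y₁ - x₁ * y) * (y₁ * ((α * x + β * y) * g) + α * f * u)
    lemma = solve-∀

  isForm-cong : ∀ n {a f g} → (∀ x y → f x y ≡ g x y) → IsForm n a f → IsForm n a g
  isForm-cong zero    eq (constant F) = constant λ x y → trans (sym (eq x y)) (F x y)
  isForm-cong (suc n) eq (divided F) = divided λ x₁ y₁ → let h , H , eqF = F x₁ y₁ in h , H , λ x y →
    trans (cong (y₁ ^ suc n *_) (sym (eq x y)))
      (trans (eqF x y) (cong (λ z → y ^ suc n * z + (x , y) ∧ (x₁ , y₁) * h x y) (eq x₁ y₁)))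

  isForm-yⁿ zero    = 1ℤ , constant λ _ _ → refl
  isForm-yⁿ (suc n) = 0ℤ , isForm-y¹⁺ⁿ n

  isForm-y¹⁺ⁿ n = isForm-cong (suc n) (λ x y → lemma x y (y ^ n)) (isForm-linear n 0ℤ 1ℤ (proj₂ (isForm-yⁿ n)))
    where
    lemma : ∀ x y u → (0ℤ * x + 1ℤ * y) * u ≡ y * u
    lemma = solve-∀

  isForm-xⁿ : ∀ n → IsForm n 1ℤ (λ x y → x ^ n)
  isForm-xⁿ zero    = constant λ _ _ → refl
  isForm-xⁿ (suc n) = isForm-cong (suc n) (λ x y → lemma x y (x ^ n)) (isForm-linear n 1ℤ 0ℤ (isForm-xⁿ n))
    where
    lemma : ∀ x y u → (1ℤ * x + 0ℤ * y) * u ≡ x * u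
    lemma = solve-∀

  isForm-sheared : ∀ {d} c (F : Form ℤ d) → IsForm d (eval F 1ℤ c) (sheared c F)
  isForm-sheared {zero}  c (a ∷ []) = constant λ _ _ → refl
  isForm-sheared {suc d} c (a ∷ F) =
    isForm-cong (suc d) (λ x y → cong (λ l → a * x ^ suc d + l * sheared c F x y) (one c x y))
      (isForm-lead {suc d} (cong (λ u → a * u + c * eval F 1ℤ c) (sym (^-zeroˡ (suc d))))
        (isForm-+ (suc d) (isForm-* (suc d) a (isForm-xⁿ (suc d))) (isForm-linear d c 1ℤ (isForm-sheared c F))))
    where
    one : ∀ c x y → c * x + 1ℤ * y ≡ c * x + y
    one = solve-∀

  length-filter-split : ∀ {A : Set} {P : Pred A 0ℓ} (P? : Decidable P) xs →
    length xs ≡ length (filter P? xs) ℕ.+ length (filter (¬? ∘ P?) xs)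
  length-filter-split P? [] = refl
  length-filter-split P? (x ∷ xs) with P? x
  ... | yes _ = cong suc (length-filter-split P? xs)
  ... | no _  = trans (cong suc (length-filter-split P? xs)) (sym (ℕ.+-suc _ _))

  length-filter-filter : ∀ {A : Set} {P Q : Pred A 0ℓ} (P? : Decidable P) (Q? : Decidable Q) xs →
    length (filter P? (filter Q? xs)) ℕ.≤ length (filter P? xs)
  length-filter-filter P? Q? [] = z≤n
  length-filter-filter P? Q? (x ∷ xs) with Q? x
  ... | yes _ with P? x
  ...   | yes _ = ℕ.s≤s (length-filter-filter P? Q? xs)
  ...   | no _  = length-filter-filter P? Q? xs
  length-filter-filter P? Q? (x ∷ xs) | no _ with P? x
  ...   | yes _ = ℕ.m≤n⇒m≤1+n (length-filter-filter P? Q? xs)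
  ...   | no _  = length-filter-filter P? Q? xs

  module _ {A : Set} (point : A → ℤ × ℤ) where

    private
      X Y : A → ℤ
      X P = proj₁ (point P)
      Y P = proj₂ (point P)

    proportional? : ∀ p (Q : A) → Decidable (λ P → + p ∣ point P ∧ point Q)
    proportional? p Q P = + p ∣? point P ∧ point Q

    -- Lagrange's bound over the field of p elements, with ℓ bounding the size of each projective
    -- class. Removing the class of one zero Q turns the other points into zeros of the quotient
    -- form, whose lead a y₁^n is still prime to p.
    length-zeros : ∀ {p} → Prime p → ∀ {ℓ} n {a f} → IsForm n a f → ¬ (+ p ∣ a) → ∀ L →
      All (λ P → ¬ (+ p ∣ Y P) × (+ p ∣ f (X P) (Y P))) L →
      (∀ Q → ¬ (+ p ∣ Y Q) → length (filter (proportional? p Q) L) ℕ.≤ ℓ) →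
      length L ℕ.≤ n ℕ.* ℓ
    length-zeros pr n F p∤a [] zeros classes = z≤n
    length-zeros {p} pr zero (constant F) p∤a (Q ∷ L) ((_ , p∣f) ∷ _) classes =
      ⊥-elim (p∤a (∣-cong (F (X Q) (Y Q)) p∣f))
    length-zeros {p} pr {ℓ} (suc n) {a} {f} (divided F) p∤a (Q ∷ L) zeros@((p∤Q , p∣fQ) ∷ _) classes = begin
      length (Q ∷ L)
        ≡⟨ length-filter-split (proportional? p Q) (Q ∷ L) ⟩
      length (filter (proportional? p Q) (Q ∷ L)) ℕ.+ length others
        ≤⟨ ℕ.+-mono-≤ (classes Q p∤Q) (length-zeros pr n G p∤lead others othersZeros
             (λ R p∤R → ℕ.≤-trans (length-filter-filter (proportional? p R) (¬? ∘ proportional? p Q) (Q ∷ L)) (classes R p∤R))) ⟩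
      ℓ ℕ.+ n ℕ.* ℓ ∎
      where
      open ℕ.≤-Reasoning
      y₁ = Y Q
      others = filter (¬? ∘ proportional? p Q) (Q ∷ L)
      g = proj₁ (F (X Q) y₁)
      G = proj₁ (proj₂ (F (X Q) y₁))
      eq = proj₂ (proj₂ (F (X Q) y₁))
      p∤lead : ¬ (+ p ∣ a * y₁ ^ n)
      p∤lead p∣ = [ p∤a , (λ p∣yⁿ → p∤Q (prime-∣-^ pr y₁ n p∣yⁿ)) ]′ (prime-∣-* pr a (y₁ ^ n) p∣)
      zero′ : ∀ {P} → (¬ (+ p ∣ Y P) × (+ p ∣ f (X P) (Y P))) × ¬ (+ p ∣ point P ∧ point Q) →
              ¬ (+ p ∣ Y P) × (+ p ∣ g (X P) (Y P))
      zero′ {P} ((p∤P , p∣fP) , p∤D) = p∤P ,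
        [ (λ p∣D → ⊥-elim (p∤D p∣D)) , id ]′
          (prime-∣-* pr (point P ∧ point Q) (g (X P) (Y P))
            (∣m+n∣m⇒∣n {m = Y P ^ suc n * f (X Q) y₁}
              (∣-cong (eq (X P) (Y P)) (∣n⇒∣m*n (y₁ ^ suc n) {f (X P) (Y P)} p∣fP))
              (∣n⇒∣m*n (Y P ^ suc n) {f (X Q) y₁} p∣fQ)))
      othersZeros = All.map zero′
        (All.zip (filter⁺ (¬? ∘ proportional? p Q) zeros , all-filter (¬? ∘ proportional? p Q) (Q ∷ L)))

    -- Each prime sorts the points into at most n projective classes. `Good` is kept abstract so
    -- that the recursion can add to it proportionality to a fixed point Q.
    length-common-zeros : ∀ {ℓ} n {a f} → IsForm n a f → ∀ ps → All Prime ps → All (λ p → ¬ (+ p ∣ a)) ps →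
      (Good : Pred A 0ℓ) →
      (∀ {P} → Good P → All (λ p → ¬ (+ p ∣ Y P) × (+ p ∣ f (X P) (Y P))) ps) →
      (∀ L → Unique L → All Good L → (∀ {P Q} → P ∈ L → Q ∈ L → All (λ p → + p ∣ point P ∧ point Q) ps) → length L ℕ.≤ ℓ) →
      ∀ L → Unique L → All Good L → length L ℕ.≤ n ℕ.^ length ps ℕ.* ℓ
    length-common-zeros {ℓ} n F [] [] [] Good zeros classes L uL gL =
      subst (length L ℕ.≤_) (sym (ℕ.+-identityʳ ℓ)) (classes L uL gL (λ _ _ → []))
    length-common-zeros {ℓ} n F (p ∷ ps) (pr ∷ prs) (p∤a ∷ ps∤a) Good zeros classes L uL gL =
      subst (length L ℕ.≤_) (sym (ℕ.*-assoc n (n ℕ.^ length ps) ℓ))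
        (length-zeros pr n F p∤a L (All.map (λ good → All.head (zeros good)) gL) class)
      where
      class : ∀ Q → ¬ (+ p ∣ Y Q) → length (filter (proportional? p Q) L) ℕ.≤ n ℕ.^ length ps ℕ.* ℓ
      class Q p∤Q = length-common-zeros n F ps prs ps∤a (λ P → Good P × (+ p ∣ point P ∧ point Q))
        (λ (good , _) → All.tail (zeros good))
        (λ L′ uL′ gL′ pairs → classes L′ uL′ (All.map proj₁ gL′)
          (λ {P} {R} P∈ R∈ → proportional (proj₂ (All.lookup gL′ P∈)) (proj₂ (All.lookup gL′ R∈)) ∷ pairs P∈ R∈))
        (filter (proportional? p Q) L)
        (Unique.filter⁺ (proportional? p Q) uL)
        (All.zip (filter⁺ (proportional? p Q) gL , all-filter (proportional? p Q) L))
        where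
        lemma : ∀ x y x′ y′ u v → y′ * (x * v - u * y) - y * (x′ * v - u * y′) ≡ v * (x * y′ - x′ * y)
        lemma = solve-∀
        -- Two points proportional to Q are proportional to each other, since p does not divide the
        -- second coordinate of Q.
        proportional : ∀ {P R} → + p ∣ point P ∧ point Q → + p ∣ point R ∧ point Q → + p ∣ point P ∧ point R
        proportional {P} {R} p∣PQ p∣RQ = [ (λ p∣Q → ⊥-elim (p∤Q p∣Q)) , id ]′
          (prime-∣-* pr (Y Q) (point P ∧ point R)
            (∣-cong (lemma (X P) (Y P) (X R) (Y R) (X Q) (Y Q))
              (∣m∣n⇒∣m-n (∣n⇒∣m*n (Y R) {point P ∧ point Q} p∣PQ) (∣n⇒∣m*n (Y P) {point R ∧ point Q} p∣RQ))))

-- Smooth and rough parts, and the product of the smooth parts of a family.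

module SmoothParts where
  open import Data.Nat.Base
  open import Data.Nat.Properties
  open import Data.Nat.Divisibility
  open import Data.Nat.DivMod using (m/n*n≤m; m/n/o≡m/[n*o]; n/1≡n; +-distrib-/-∣ʳ; n/n≡1; /-monoˡ-≤; m≡m%n+[m/n]*n; m%n<n)
  open import Data.Nat.ListAction using (product; sum)
  open import Data.Nat.Primality using (Prime; prime?; ¬prime[0]; prime⇒nonTrivial; prime⇒nonZero)
  open import Data.Nat.Primality.Factorisation using (PrimeFactorisation; factorise)
  open import Data.Nat.Tactic.RingSolver using (solve-∀)
  open import Data.Bool.Base using (if_then_else_; true; false)
  open import Data.List.Base using (List; []; _∷_; length; filter; map)
  open import Data.List.Relation.Unary.All as All using (All; []; _∷_)
  open import Data.List.Relation.Unary.All.Properties using (filter⁺; all-filter)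
  open import Data.Product.Base using (_×_; _,_)
  open import Data.Empty using (⊥-elim)
  open import Function.Base using (_∘_)
  open import Level using (0ℓ)
  open import Relation.Nullary using (Dec; ¬_; yes; no; does)
  open import Relation.Nullary.Decidable using (¬?; dec-true; dec-false)
  open import Relation.Unary using (Pred; Decidable)
  open import Relation.Binary.PropositionalEquality

  m<[1+m/n]*n : ∀ m n → .{{_ : NonZero n}} → m < suc (m / n) * n
  m<[1+m/n]*n m n = subst (_< suc (m / n) * n) (sym (m≡m%n+[m/n]*n m n)) (+-monoˡ-< (m / n * n) (m%n<n m n))

  Σ< Π< : ℕ → (ℕ → ℕ) → ℕ
  Σ< zero    f = 0
  Σ< (suc n) f = Σ< n f + f n
  Π< zero    f = 1
  Π< (suc n) f = Π< n f * f n

  Σ<-mono : ∀ n {f g} → (∀ k → k < n → f k ≤ g k) → Σ< n f ≤ Σ< n g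
  Σ<-mono zero    le = z≤n
  Σ<-mono (suc n) le = +-mono-≤ (Σ<-mono n (λ k k<n → le k (m<n⇒m<1+n k<n))) (le n ≤-refl)

  Σ<-+ : ∀ n f g → Σ< n (λ k → f k + g k) ≡ Σ< n f + Σ< n g
  Σ<-+ zero    f g = refl
  Σ<-+ (suc n) f g rewrite Σ<-+ n f g = lemma (Σ< n f) (Σ< n g) (f n) (g n)
    where
    lemma : ∀ a b c d → a + b + (c + d) ≡ a + c + (b + d)
    lemma = solve-∀

  Σ<-* : ∀ n c f → Σ< n (λ k → c * f k) ≡ c * Σ< n f
  Σ<-* zero    c f = sym (*-zeroʳ c)
  Σ<-* (suc n) c f rewrite Σ<-* n c f = sym (*-distribˡ-+ c (Σ< n f) (f n))

  Σ<-const : ∀ n c → Σ< n (λ _ → c) ≡ n * c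
  Σ<-const zero    c = refl
  Σ<-const (suc n) c rewrite Σ<-const n c = +-comm (n * c) c

  Σ<-shift : ∀ n f → Σ< (suc n) f ≡ f 0 + Σ< n (f ∘ suc)
  Σ<-shift zero    f = sym (+-identityʳ (f 0))
  Σ<-shift (suc n) f = trans (cong (_+ f (suc n)) (Σ<-shift n f)) (+-assoc (f 0) _ _)

  Σ<-cong : ∀ n {f g} → (∀ k → f k ≡ g k) → Σ< n f ≡ Σ< n g
  Σ<-cong zero    eq = refl
  Σ<-cong (suc n) eq = cong₂ _+_ (Σ<-cong n eq) (eq n)

  Π<-mono : ∀ n {f g} → (∀ k → k < n → f k ≤ g k) → Π< n f ≤ Π< n g
  Π<-mono zero    le = ≤-refl
  Π<-mono (suc n) le = *-mono-≤ (Π<-mono n (λ k k<n → le k (m<n⇒m<1+n k<n))) (le n ≤-refl)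

  Π<-cong : ∀ n {f g} → (∀ k → f k ≡ g k) → Π< n f ≡ Π< n g
  Π<-cong zero    eq = refl
  Π<-cong (suc n) eq = cong₂ _*_ (Π<-cong n eq) (eq n)

  Π<-* : ∀ n f g → Π< n (λ k → f k * g k) ≡ Π< n f * Π< n g
  Π<-* zero    f g = refl
  Π<-* (suc n) f g rewrite Π<-* n f g = lemma (Π< n f) (Π< n g) (f n) (g n)
    where
    lemma : ∀ a b c d → a * b * (c * d) ≡ a * c * (b * d)
    lemma = solve-∀

  *-^ : ∀ a b n → (a * b) ^ n ≡ a ^ n * b ^ n
  *-^ a b zero    = refl
  *-^ a b (suc n) rewrite *-^ a b n = lemma a b (a ^ n) (b ^ n)
    where
    lemma : ∀ a b u v → a * b * (u * v) ≡ a * u * (b * v)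
    lemma = solve-∀

  Π<-^ : ∀ n f c → Π< n (λ k → f k ^ c) ≡ Π< n f ^ c
  Π<-^ zero    f c = sym (^-zeroˡ c)
  Π<-^ (suc n) f c rewrite Π<-^ n f c = sym (*-^ (Π< n f) (f n) c)

  Π<-const : ∀ n c → Π< n (λ _ → c) ≡ c ^ n
  Π<-const zero    c = refl
  Π<-const (suc n) c rewrite Π<-const n c = *-comm (c ^ n) c

  ⟦_⟧ : ∀ {P : Set} → Dec P → ℕ
  ⟦ P? ⟧ = if does P? then 1 else 0

  ⟦⟧-true : ∀ {P : Set} (P? : Dec P) → P → ⟦ P? ⟧ ≡ 1
  ⟦⟧-true P? p rewrite dec-true P? p = refl

  ⟦⟧-false : ∀ {P : Set} (P? : Dec P) → ¬ P → ⟦ P? ⟧ ≡ 0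
  ⟦⟧-false P? ¬p rewrite dec-false P? ¬p = refl

  count : ℕ → List ℕ → ℕ
  count p []       = 0
  count p (q ∷ qs) = ⟦ p ≟ q ⟧ + count p qs

  Π<-indicator-≥ : ∀ z x → z ≤ x → Π< z (λ p → p ^ ⟦ p ≟ x ⟧) ≡ 1
  Π<-indicator-≥ zero    x _   = refl
  Π<-indicator-≥ (suc z) x z<x
    rewrite Π<-indicator-≥ z x (<⇒≤ z<x) | ⟦⟧-false (z ≟ x) (<⇒≢ z<x) = refl

  Π<-indicator-< : ∀ z x → x < z → Π< z (λ p → p ^ ⟦ p ≟ x ⟧) ≡ x
  Π<-indicator-< (suc z) x (s≤s x≤z) with z ≟ x
  ... | yes refl rewrite Π<-indicator-≥ z z ≤-refl | ⟦⟧-true (z ≟ z) refl =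
    trans (*-identityˡ (z * 1)) (*-identityʳ z)
  ... | no z≢x rewrite Π<-indicator-< z x (≤∧≢⇒< x≤z (≢-sym z≢x)) | ⟦⟧-false (z ≟ x) z≢x = *-identityʳ x

  Π<-count : ∀ z qs → Π< z (λ p → p ^ count p qs) ≡ product (filter (_<? z) qs)
  Π<-count z [] = trans (Π<-const z 1) (^-zeroˡ z)
  Π<-count z (q ∷ qs) = trans
    (trans (Π<-cong z (λ p → ^-distribˡ-+-* p ⟦ p ≟ q ⟧ (count p qs)))
      (Π<-* z (λ p → p ^ ⟦ p ≟ q ⟧) (λ p → p ^ count p qs)))
    rest
    where
    rest : Π< z (λ p → p ^ ⟦ p ≟ q ⟧) * Π< z (λ p → p ^ count p qs) ≡ product (filter (_<? z) (q ∷ qs))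
    rest with q <? z
    ... | yes q<z rewrite dec-true (q <? z) q<z = cong₂ _*_ (Π<-indicator-< z q q<z) (Π<-count z qs)
    ... | no q≮z rewrite dec-false (q <? z) q≮z =
      trans (cong₂ _*_ (Π<-indicator-≥ z q (≮⇒≥ q≮z)) (Π<-count z qs)) (*-identityˡ _)

  ^-count-∣ : ∀ p qs → p ^ count p qs ∣ product qs
  ^-count-∣ p [] = ∣-refl
  ^-count-∣ p (q ∷ qs) with p ≟ q
  ... | yes refl rewrite dec-true (p ≟ p) refl = *-monoʳ-∣ p (^-count-∣ p qs)
  ... | no p≢q rewrite dec-false (p ≟ q) p≢q = ∣n⇒∣m*n q (^-count-∣ p qs)

  count-absent : ∀ p qs → All (p ≢_) qs → count p qs ≡ 0
  count-absent p [] [] = refl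
  count-absent p (q ∷ qs) (p≢q ∷ p∉) rewrite ⟦⟧-false (p ≟ q) p≢q = count-absent p qs p∉

  product-filter : ∀ {P : Pred ℕ 0ℓ} (P? : Decidable P) qs →
                   product (filter P? qs) * product (filter (¬? ∘ P?) qs) ≡ product qs
  product-filter P? [] = refl
  product-filter P? (q ∷ qs) with does (P? q)
  ... | true  = trans (*-assoc q _ _) (cong (q *_) (product-filter P? qs))
  ... | false = trans (swap (product (filter P? qs)) q _) (cong (q *_) (product-filter P? qs))
    where
    swap : ∀ a q b → a * (q * b) ≡ q * (a * b)
    swap = solve-∀

  primeFactors : ℕ → List ℕ
  primeFactors zero    = []
  primeFactors (suc n) = PrimeFactorisation.factors (factorise (suc n))

  primeFactors-prime : ∀ n → All Prime (primeFactors n)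
  primeFactors-prime zero    = []
  primeFactors-prime (suc n) = PrimeFactorisation.factorsPrime (factorise (suc n))

  product-primeFactors : ∀ n → .{{NonZero n}} → product (primeFactors n) ≡ n
  product-primeFactors (suc n) = sym (PrimeFactorisation.isFactorisation (factorise (suc n)))

  -- Multiplicity in the list of prime factors, hence 0 when p is not prime: products over all p < z
  -- are products over primes.
  valuation : ℕ → ℕ → ℕ
  valuation p n = count p (primeFactors n)

  ^-valuation-∣ : ∀ p n → .{{_ : NonZero n}} → p ^ valuation p n ∣ n
  ^-valuation-∣ p n = subst (p ^ valuation p n ∣_) (product-primeFactors n) (^-count-∣ p (primeFactors n))

  valuation-¬prime : ∀ p n → ¬ Prime p → valuation p n ≡ 0
  valuation-¬prime p n ¬pr = count-absent p (primeFactors n)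
    (All.map (λ pr p≡q → ¬pr (subst Prime (sym p≡q) pr)) (primeFactors-prime n))

  roughFactors : ℕ → ℕ → List ℕ
  roughFactors z n = filter (¬? ∘ (_<? z)) (primeFactors n)

  -- The bound is strict, so the primes up to z belong to `smooth (suc z)`.
  smooth rough : ℕ → ℕ → ℕ
  smooth z n = product (filter (_<? z) (primeFactors n))
  rough  z n = product (roughFactors z n)

  smooth*rough : ∀ z n → .{{_ : NonZero n}} → smooth z n * rough z n ≡ n
  smooth*rough z n = trans (product-filter (_<? z) (primeFactors n)) (product-primeFactors n)

  smooth-valuation : ∀ z n → smooth z n ≡ Π< z (λ p → p ^ valuation p n)
  smooth-valuation z n = sym (Π<-count z (primeFactors n))

  roughFactors-prime : ∀ z n → All Prime (roughFactors z n)
  roughFactors-prime z n = filter⁺ (¬? ∘ (_<? z)) (primeFactors-prime n)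

  roughFactors-≥ : ∀ z n → All (z ≤_) (roughFactors z n)
  roughFactors-≥ z n = All.map ≮⇒≥ (all-filter (¬? ∘ (_<? z)) (primeFactors n))

  product≥1 : ∀ {qs} → All (1 ≤_) qs → 1 ≤ product qs
  product≥1 []        = ≤-refl
  product≥1 (le ∷ les) = *-mono-≤ le (product≥1 les)

  product-≥^ : ∀ z {qs} → All (z ≤_) qs → z ^ length qs ≤ product qs
  product-≥^ z []         = ≤-refl
  product-≥^ z (le ∷ les) = *-mono-≤ le (product-≥^ z les)

  prime≥2 : ∀ {p} → Prime p → 2 ≤ p
  prime≥2 {p} pr = nonTrivial⇒n>1 p {{prime⇒nonTrivial pr}}

  smooth≥1 : ∀ z n → 1 ≤ smooth z n
  smooth≥1 z n = product≥1 (All.map (<⇒≤ ∘ prime≥2) (filter⁺ (_<? z) (primeFactors-prime n)))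

  rough≥1 : ∀ z n → 1 ≤ rough z n
  rough≥1 z n = product≥1 (All.map (<⇒≤ ∘ prime≥2) (roughFactors-prime z n))

  smooth≤ : ∀ z n → .{{_ : NonZero n}} → smooth z n ≤ n
  smooth≤ z n = begin
    smooth z n  ≡⟨ *-identityʳ _ ⟨
    smooth z n * 1  ≤⟨ *-monoʳ-≤ (smooth z n) (rough≥1 z n) ⟩
    smooth z n * rough z n ≡⟨ smooth*rough z n ⟩
    n  ∎
    where open ≤-Reasoning

  rough∣ : ∀ z n → .{{_ : NonZero n}} → rough z n ∣ n
  rough∣ z n = divides (smooth z n) (sym (smooth*rough z n))

  -- Division with the junk value 0 for divisor 0, so that no instance is needed for p ^ k.
  infixl 7 _div_
  _div_ : ℕ → ℕ → ℕ
  m div zero  = 0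
  m div suc n = m / suc n

  valuation≥1 : ∀ {p} n → .{{_ : NonZero n}} → Prime p → p ∣ n → 1 ≤ valuation p n
  valuation≥1 {p} n pr p∣n = present (primeFactors n) (factorisationHas (primeFactors-prime n))
    where
    open import Data.List.Membership.Propositional using (_∈_)
    open import Data.List.Relation.Unary.Any using (here; there)
    open import Data.Nat.Primality.Factorisation using (factorisationHasAllPrimeFactors)
    factorisationHas : All Prime (primeFactors n) → p ∈ primeFactors n
    factorisationHas = factorisationHasAllPrimeFactors pr (subst (p ∣_) (sym (product-primeFactors n)) p∣n)
    present : ∀ qs → p ∈ qs → 1 ≤ count p qs
    present (q ∷ qs) (here refl) rewrite ⟦⟧-true (p ≟ p) refl = s≤s z≤n
    present (q ∷ qs) (there p∈)  = ≤-trans (present qs p∈) (m≤n+m _ ⟦ p ≟ q ⟧)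

  -- The quotient grows only when m + 1 is a multiple of p, and then by one.
  div-suc : ∀ m p → Prime p → suc m div p ≤ m div p + valuation p (suc m)
  div-suc m zero    pr = ⊥-elim (¬prime[0] pr)
  div-suc m (suc p) pr with suc m / suc p ≤? m / suc p
  ... | yes le = ≤-trans le (m≤m+n _ _)
  ... | no gt = begin
    q  ≤⟨ step ⟩
    m / suc p + 1  ≤⟨ +-monoʳ-≤ (m / suc p) (valuation≥1 (suc m) pr (divides q (≤-antisym above (m/n*n≤m (suc m) (suc p))))) ⟩
    m / suc p + valuation (suc p) (suc m)  ∎
    where
    open ≤-Reasoning
    q = suc m / suc p
    step : q ≤ m / suc p + 1
    step = begin
      suc m / suc p  ≤⟨ /-monoˡ-≤ (suc p) (≤-trans (s≤s (m≤m+n m p)) (≤-reflexive (sym (+-suc m p)))) ⟩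
      (m + suc p) / suc p  ≡⟨ +-distrib-/-∣ʳ m ∣-refl ⟩
      m / suc p + suc p / suc p ≡⟨ cong (m / suc p +_) (n/n≡1 (suc p)) ⟩
      m / suc p + 1  ∎
    above : suc m ≤ q * suc p
    above = ≤-trans (m<[1+m/n]*n m (suc p)) (*-monoˡ-≤ (suc p) (≰⇒> gt))

  -- The right-hand side is the exponent of p in m!.
  div-≤-Σ-valuation : ∀ {p} → Prime p → ∀ m → m div p ≤ Σ< m (λ n → valuation p (suc n))
  div-≤-Σ-valuation {zero}  pr zero = z≤n
  div-≤-Σ-valuation {suc p} pr zero = z≤n
  div-≤-Σ-valuation {p} pr (suc m) = ≤-trans (div-suc m p pr) (+-monoˡ-≤ (valuation p (suc m)) (div-≤-Σ-valuation pr m))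

  -- The left-hand side is the part of m! made of primes below z, so it is at most m!.
  Π-^-Σ-valuation : ∀ z w m → m ≤ w → Π< z (λ p → p ^ Σ< m (λ n → valuation p (suc n))) ≤ w ^ m
  Π-^-Σ-valuation z w zero    _   = ≤-reflexive (trans (Π<-const z 1) (^-zeroˡ z))
  Π-^-Σ-valuation z w (suc m) m<w = begin
    Π< z (λ p → p ^ (V p + valuation p (suc m)))
      ≡⟨ Π<-cong z (λ p → ^-distribˡ-+-* p (V p) (valuation p (suc m))) ⟩
    Π< z (λ p → p ^ V p * p ^ valuation p (suc m))
      ≡⟨ Π<-* z (λ p → p ^ V p) (λ p → p ^ valuation p (suc m)) ⟩
    Π< z (λ p → p ^ V p) * Π< z (λ p → p ^ valuation p (suc m))
      ≡⟨ cong (Π< z (λ p → p ^ V p) *_) (sym (smooth-valuation z (suc m))) ⟩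
    Π< z (λ p → p ^ V p) * smooth z (suc m)
      ≤⟨ *-mono-≤ (Π-^-Σ-valuation z w m (<⇒≤ m<w)) (≤-trans (smooth≤ z (suc m)) m<w) ⟩
    w ^ m * w
      ≡⟨ *-comm (w ^ m) w ⟩
    w ^ suc m ∎
    where
    open ≤-Reasoning
    V : ℕ → ℕ
    V p = Σ< m (λ n → valuation p (suc n))

  Σ-valuation-¬prime : ∀ {p} → ¬ Prime p → ∀ m → Σ< m (λ n → valuation p (suc n)) ≡ 0
  Σ-valuation-¬prime     ¬pr zero    = refl
  Σ-valuation-¬prime {p} ¬pr (suc m) rewrite Σ-valuation-¬prime ¬pr m = valuation-¬prime p (suc m) ¬pr

  -- An upper bound of Mertens type, Σ_{p ≤ z} ⌊z/p⌋ log p ≤ z log z.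
  mertens : ∀ z → Π< (suc z) (λ p → p ^ (⟦ prime? p ⟧ * (z div p))) ≤ z ^ z
  mertens z = ≤-trans (Π<-mono (suc z) term) (Π-^-Σ-valuation (suc z) z z ≤-refl)
    where
    term : ∀ p → p < suc z → p ^ (⟦ prime? p ⟧ * (z div p)) ≤ p ^ Σ< z (λ n → valuation p (suc n))
    term p _ with prime? p
    ... | yes pr rewrite +-identityʳ (z div p) = ^-monoʳ-≤ p {{prime⇒nonZero pr}} (div-≤-Σ-valuation pr z)
    ... | no ¬pr rewrite Σ-valuation-¬prime ¬pr z = ≤-refl

  div-* : ∀ b m n → b div (m * n) ≡ (b div m) div n
  div-* b zero    zero    = refl
  div-* b zero    (suc n) = refl
  div-* b (suc m) zero    rewrite *-zeroʳ m = refl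
  div-* b (suc m) (suc n) = sym (m/n/o≡m/[n*o] b (suc m) (suc n))

  -- A geometric series: each division by p at least halves.
  Σ<-div-^ : ∀ p → .{{_ : NonTrivial p}} → ∀ κ b → Σ< κ (λ k → b div p ^ k) ≤ 2 * b
  Σ<-div-^ p zero    b = z≤n
  Σ<-div-^ p (suc κ) b = begin
    Σ< (suc κ) (λ k → b div p ^ k)  ≡⟨ Σ<-shift κ (λ k → b div p ^ k) ⟩
    b div 1 + Σ< κ (λ k → b div (p * p ^ k))  ≡⟨ cong (_+ Σ< κ (λ k → b div (p * p ^ k))) (n/1≡n b) ⟩
    b + Σ< κ (λ k → b div (p * p ^ k))  ≤⟨ +-monoʳ-≤ b (Σ<-mono κ (λ k _ → ≤-reflexive (div-* b p (p ^ k)))) ⟩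
    b + Σ< κ (λ k → (b div p) div p ^ k)  ≤⟨ +-monoʳ-≤ b (Σ<-div-^ p κ (b div p)) ⟩
    b + 2 * (b div p)  ≤⟨ +-monoʳ-≤ b (half p) ⟩
    b + b  ≡⟨ cong (b +_) (+-identityʳ b) ⟨
    2 * b  ∎
    where
    open ≤-Reasoning
    half : ∀ p → .{{_ : NonTrivial p}} → 2 * (b div p) ≤ b
    half (suc (suc p)) = begin
      2 * (b / suc (suc p))  ≡⟨ *-comm 2 (b / suc (suc p)) ⟩
      b / suc (suc p) * 2  ≤⟨ *-monoʳ-≤ (b / suc (suc p)) (s≤s (s≤s z≤n)) ⟩
      b / suc (suc p) * suc (suc p)  ≤⟨ m/n*n≤m b (suc (suc p)) ⟩
      b  ∎

  ≤-Σ-indicator : ∀ κ v (f : ℕ → ℕ) → v ≤ κ → (∀ k → k < v → 1 ≤ f k) → v ≤ Σ< κ f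
  ≤-Σ-indicator κ       zero    f _         one = z≤n
  ≤-Σ-indicator (suc κ) (suc v) f (s≤s v≤κ) one = begin
    suc v  ≤⟨ +-mono-≤ (one 0 z<s) (≤-Σ-indicator κ v (f ∘ suc) v≤κ (λ k k<v → one (suc k) (s≤s k<v))) ⟩
    f 0 + Σ< κ (f ∘ suc)  ≡⟨ Σ<-shift κ f ⟨
    Σ< (suc κ) f  ∎
    where open ≤-Reasoning

  module _ {A : Set} (U : A → ℕ) where

    multiples : ℕ → List A → ℕ
    multiples m L = length (filter (λ P → m ∣? U P) L)

    multiples-∷ : ∀ m P L → multiples m (P ∷ L) ≡ ⟦ m ∣? U P ⟧ + multiples m L
    multiples-∷ m P L with m ∣? U P
    ... | yes _ = refl
    ... | no _  = refl

    -- As in Legendre's formula, a valuation is the number of powers p^(k+1) that divide, and the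
    -- two summations are exchanged. The bound 2^κ keeps all valuations at most κ.
    Σ-valuation-≤ : ∀ {p} → Prime p → ∀ κ L → All (λ P → NonZero (U P) × U P < 2 ^ κ) L →
      sum (map (valuation p ∘ U) L) ≤ Σ< κ (λ k → multiples (p ^ suc k) L)
    Σ-valuation-≤ pr κ [] [] = z≤n
    Σ-valuation-≤ {p} pr κ (P ∷ L) ((U≢0 , U<) ∷ bounds) = begin
      v + sum (map (valuation p ∘ U) L)
        ≤⟨ +-mono-≤ (≤-Σ-indicator κ v (λ k → ⟦ p ^ suc k ∣? U P ⟧) v≤κ
             (λ k k<v → ≤-reflexive (sym (⟦⟧-true (p ^ suc k ∣? U P) (∣-trans (^-∣ k<v) (^-valuation-∣ p (U P) {{U≢0}}))))))
             (Σ-valuation-≤ pr κ L bounds) ⟩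
      Σ< κ (λ k → ⟦ p ^ suc k ∣? U P ⟧) + Σ< κ (λ k → multiples (p ^ suc k) L)
        ≡⟨ Σ<-+ κ (λ k → ⟦ p ^ suc k ∣? U P ⟧) (λ k → multiples (p ^ suc k) L) ⟨
      Σ< κ (λ k → ⟦ p ^ suc k ∣? U P ⟧ + multiples (p ^ suc k) L)
        ≤⟨ Σ<-mono κ (λ k _ → ≤-reflexive (sym (multiples-∷ (p ^ suc k) P L))) ⟩
      Σ< κ (λ k → multiples (p ^ suc k) (P ∷ L)) ∎
      where
      open ≤-Reasoning
      v = valuation p (U P)
      ^-∣ : ∀ {k v} → k < v → p ^ suc k ∣ p ^ v
      ^-∣ {k} k<v with m≤n⇒∃[o]m+o≡n k<v
      ... | o , refl = subst (p ^ suc k ∣_) (sym (^-distribˡ-+-* p (suc k) o)) (m∣m*n (p ^ o))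
      v≤κ : v ≤ κ
      v≤κ = ≮⇒≥ λ κ<v → <-irrefl refl (begin-strict
        U P  <⟨ U< ⟩
        2 ^ κ  ≤⟨ ^-monoʳ-≤ 2 (<⇒≤ κ<v) ⟩
        2 ^ v  ≤⟨ ^-monoˡ-≤ v (prime≥2 pr) ⟩
        p ^ v  ≤⟨ ∣⇒≤ {{U≢0}} (^-valuation-∣ p (U P) {{U≢0}}) ⟩
        U P  ∎)

    sum-valuation-¬prime : ∀ {p} → ¬ Prime p → ∀ L → sum (map (valuation p ∘ U) L) ≡ 0
    sum-valuation-¬prime     ¬pr []      = refl
    sum-valuation-¬prime {p} ¬pr (P ∷ L) rewrite valuation-¬prime p (U P) ¬pr = sum-valuation-¬prime ¬pr L

    product-smooth : ∀ z L → product (map (smooth z ∘ U) L) ≡ Π< z (λ p → p ^ sum (map (valuation p ∘ U) L))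
    product-smooth z [] = sym (trans (Π<-const z 1) (^-zeroˡ z))
    product-smooth z (P ∷ L) = begin
      smooth z (U P) * product (map (smooth z ∘ U) L)
        ≡⟨ cong₂ _*_ (smooth-valuation z (U P)) (product-smooth z L) ⟩
      Π< z (λ p → p ^ valuation p (U P)) * Π< z (λ p → p ^ sum (map (valuation p ∘ U) L))
        ≡⟨ Π<-* z (λ p → p ^ valuation p (U P)) (λ p → p ^ sum (map (valuation p ∘ U) L)) ⟨
      Π< z (λ p → p ^ valuation p (U P) * p ^ sum (map (valuation p ∘ U) L))
        ≡⟨ Π<-cong z (λ p → ^-distribˡ-+-* p (valuation p (U P)) (sum (map (valuation p ∘ U) L))) ⟨
      Π< z (λ p → p ^ sum (map (valuation p ∘ U) (P ∷ L))) ∎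
      where open ≡-Reasoning

    -- The exponent of p is at most d Σ_k (⌊z b / p^(k+1)⌋ + 1) ≤ d (4 b ⌊z/p⌋ + κ). The first part
    -- is summed over p by `mertens` at z, which is why the side z b has the factor z; the second
    -- costs at most z^(d κ) for each p ≤ z.
    product-smooth-≤ : ∀ z b d κ L → .{{_ : NonZero z}} → All (λ P → NonZero (U P) × U P < 2 ^ κ) L →
      (∀ {p} → Prime p → ∀ k → multiples (p ^ suc k) L ≤ d * (z * b div p ^ suc k + 1)) →
      product (map (smooth (suc z) ∘ U) L) ≤ z ^ (4 * d * (z * b) + d * κ * suc z)
    product-smooth-≤ z b d κ L bounds few = begin
      product (map (smooth (suc z) ∘ U) L)
        ≡⟨ product-smooth (suc z) L ⟩
      Π< (suc z) (λ p → p ^ S p)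
        ≤⟨ Π<-mono (suc z) (λ p p≤z → term p (s≤s⁻¹ p≤z)) ⟩
      Π< (suc z) (λ p → (p ^ M p) ^ (4 * d * b) * z ^ (d * κ))
        ≡⟨ Π<-* (suc z) (λ p → (p ^ M p) ^ (4 * d * b)) (λ _ → z ^ (d * κ)) ⟩
      Π< (suc z) (λ p → (p ^ M p) ^ (4 * d * b)) * Π< (suc z) (λ _ → z ^ (d * κ))
        ≡⟨ cong₂ _*_ (Π<-^ (suc z) (λ p → p ^ M p) (4 * d * b)) (Π<-const (suc z) (z ^ (d * κ))) ⟩
      Π< (suc z) (λ p → p ^ M p) ^ (4 * d * b) * (z ^ (d * κ)) ^ suc z
        ≤⟨ *-monoˡ-≤ ((z ^ (d * κ)) ^ suc z) (^-monoˡ-≤ (4 * d * b) (mertens z)) ⟩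
      (z ^ z) ^ (4 * d * b) * (z ^ (d * κ)) ^ suc z
        ≡⟨ cong₂ _*_ (^-*-assoc z z (4 * d * b)) (^-*-assoc z (d * κ) (suc z)) ⟩
      z ^ (z * (4 * d * b)) * z ^ (d * κ * suc z)
        ≡⟨ ^-distribˡ-+-* z (z * (4 * d * b)) (d * κ * suc z) ⟨
      z ^ (z * (4 * d * b) + d * κ * suc z)
        ≡⟨ cong (λ e → z ^ (e + d * κ * suc z)) (rearrange z d b) ⟩
      z ^ (4 * d * (z * b) + d * κ * suc z) ∎
      where
      open ≤-Reasoning
      rearrange : ∀ z d b → z * (4 * d * b) ≡ 4 * d * (z * b)
      rearrange = solve-∀
      S M : ℕ → ℕ
      S p = sum (map (valuation p ∘ U) L)
      M p = ⟦ prime? p ⟧ * (z div p)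

      -- Rounding z/p down loses at most a factor 2, because ⌊z/p⌋ ≥ 1.
      div-multiple : ∀ p → Prime p → p ≤ z → z * b div p ≤ 2 * (b * (z div p))
      div-multiple zero    pr _   = ⊥-elim (¬prime[0] pr)
      div-multiple (suc p) pr p≤z = *-cancelʳ-≤ _ _ (suc p) (begin
        z * b / suc p * suc p  ≤⟨ m/n*n≤m (z * b) (suc p) ⟩
        z * b  ≤⟨ *-monoˡ-≤ b z≤ ⟩
        2 * (z / suc p) * suc p * b  ≡⟨ shuffle (z / suc p) (suc p) b ⟩
        2 * (b * (z / suc p)) * suc p  ∎)
        where
        shuffle : ∀ q p b → 2 * q * p * b ≡ 2 * (b * q) * p
        shuffle = solve-∀
        q≥1 : 1 ≤ z / suc p
        q≥1 = ≤-trans (≤-reflexive (sym (n/n≡1 (suc p)))) (/-monoˡ-≤ (suc p) p≤z)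
        z≤ : z ≤ 2 * (z / suc p) * suc p
        z≤ = begin
          z  ≤⟨ <⇒≤ (m<[1+m/n]*n z (suc p)) ⟩
          suc (z / suc p) * suc p  ≤⟨ *-monoˡ-≤ (suc p) (+-monoˡ-≤ (z / suc p) q≥1) ⟩
          (z / suc p + z / suc p) * suc p ≡⟨ cong (λ e → (z / suc p + e) * suc p) (+-identityʳ (z / suc p)) ⟨
          2 * (z / suc p) * suc p  ∎

      exponent : ∀ p → Prime p → p ≤ z → S p ≤ (z div p) * (4 * d * b) + d * κ
      exponent p pr p≤z = begin
        S p
          ≤⟨ Σ-valuation-≤ pr κ L bounds ⟩
        Σ< κ (λ k → multiples (p ^ suc k) L)
          ≤⟨ Σ<-mono κ (λ k _ → few pr k) ⟩
        Σ< κ (λ k → d * (z * b div p ^ suc k + 1))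
          ≡⟨ Σ<-* κ d (λ k → z * b div p ^ suc k + 1) ⟩
        d * Σ< κ (λ k → z * b div p ^ suc k + 1)
          ≡⟨ cong (d *_) (trans (Σ<-+ κ (λ k → z * b div p ^ suc k) (λ _ → 1)) (cong (Σ< κ (λ k → z * b div p ^ suc k) +_) (trans (Σ<-const κ 1) (*-identityʳ κ)))) ⟩
        d * (Σ< κ (λ k → z * b div p ^ suc k) + κ)
          ≤⟨ *-monoʳ-≤ d (+-monoˡ-≤ κ geometric) ⟩
        d * (2 * (2 * (b * (z div p))) + κ)
          ≡⟨ shuffle d b (z div p) κ ⟩
        (z div p) * (4 * d * b) + d * κ ∎
        where
        shuffle : ∀ d b q κ → d * (2 * (2 * (b * q)) + κ) ≡ q * (4 * d * b) + d * κ
        shuffle = solve-∀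
        instance nontrivial = prime⇒nonTrivial pr
        geometric : Σ< κ (λ k → z * b div p ^ suc k) ≤ 2 * (2 * (b * (z div p)))
        geometric = begin
          Σ< κ (λ k → z * b div (p * p ^ k))  ≡⟨ Σ<-cong κ (λ k → div-* (z * b) p (p ^ k)) ⟩
          Σ< κ (λ k → (z * b div p) div p ^ k)  ≤⟨ Σ<-div-^ p κ (z * b div p) ⟩
          2 * (z * b div p)  ≤⟨ *-monoʳ-≤ 2 (div-multiple p pr p≤z) ⟩
          2 * (2 * (b * (z div p)))  ∎

      term : ∀ p → p ≤ z → p ^ S p ≤ (p ^ M p) ^ (4 * d * b) * z ^ (d * κ)
      term p p≤z with prime? p
      ... | yes pr rewrite +-identityʳ (z div p) = begin
        p ^ S p  ≤⟨ ^-monoʳ-≤ p {{prime⇒nonZero pr}} (exponent p pr p≤z) ⟩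
        p ^ ((z div p) * (4 * d * b) + d * κ)  ≡⟨ ^-distribˡ-+-* p ((z div p) * (4 * d * b)) (d * κ) ⟩
        p ^ ((z div p) * (4 * d * b)) * p ^ (d * κ)  ≡⟨ cong (_* p ^ (d * κ)) (^-*-assoc p (z div p) (4 * d * b)) ⟨
        (p ^ (z div p)) ^ (4 * d * b) * p ^ (d * κ)  ≤⟨ *-monoʳ-≤ ((p ^ (z div p)) ^ (4 * d * b)) (^-monoˡ-≤ (d * κ) p≤z) ⟩
        (p ^ (z div p)) ^ (4 * d * b) * z ^ (d * κ)  ∎
      ... | no ¬pr rewrite sum-valuation-¬prime ¬pr L = begin
        1  ≤⟨ m^n>0 z (d * κ) ⟩
        z ^ (d * κ)  ≡⟨ *-identityˡ _ ⟨
        1 * z ^ (d * κ)  ≡⟨ cong (_* z ^ (d * κ)) (^-zeroˡ (4 * d * b)) ⟨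
        1 ^ (4 * d * b) * z ^ (d * κ)  ∎

    -- Markov's inequality in multiplicative form: the factors below w are still at least 1.
    markov : ∀ (s : A → ℕ) w L → (∀ P → 1 ≤ s P) → w ^ length (filter (λ P → w ≤? s P) L) ≤ product (map s L)
    markov s w [] s≥1 = ≤-refl
    markov s w (P ∷ L) s≥1 with w ≤? s P
    ... | yes le rewrite dec-true (w ≤? s P) le = *-mono-≤ le (markov s w L s≥1)
    ... | no ≰ rewrite dec-false (w ≤? s P) ≰ = ≤-trans (markov s w L s≥1) (≤-trans (≤-reflexive (sym (*-identityˡ _))) (*-monoˡ-≤ (product (map s L)) (s≥1 P)))

-- Upper and lower bounds for the absolute value of a sheared form.

module Growth where
  open FormCalculus
  open import Data.Nat.Base as ℕ using (ℕ; zero; suc)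
  import Data.Nat.Properties as ℕ
  import Data.Nat.Tactic.RingSolver as ℕ
  open import Data.Integer.Base using (ℤ; +_; 0ℤ; 1ℤ; _+_; _-_; _*_; _^_) renaming (∣_∣ to abs)
  open import Data.Integer.Properties using (abs-*; ∣i∣≡0⇒i≡0; ∣i+j∣≤∣i∣+∣j∣; ∣i-j∣≤∣i∣+∣j∣; ^-zeroˡ)
  open import Data.Integer.Tactic.RingSolver using (solve-∀)
  open import Data.Vec.Base using ([]; _∷_)
  open import Data.Product.Base using (∃; _,_; proj₁; proj₂)
  open import Relation.Binary.PropositionalEquality

  abs-^ : ∀ i n → abs (i ^ n) ≡ abs i ℕ.^ n
  abs-^ i zero    = refl
  abs-^ i (suc n) = trans (abs-* i (i ^ n)) (cong (abs i ℕ.*_) (abs-^ i n))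

  ∣c*x+y∣≤ : ∀ c {x y} → y ℕ.≤ x → abs (c * + x + + y) ℕ.≤ (abs c ℕ.+ 1) ℕ.* x
  ∣c*x+y∣≤ c {x} {y} y≤x = begin
    abs (c * + x + + y)  ≤⟨ ∣i+j∣≤∣i∣+∣j∣ (c * + x) (+ y) ⟩
    abs (c * + x) ℕ.+ y  ≤⟨ ℕ.+-mono-≤ (ℕ.≤-reflexive (abs-* c (+ x))) y≤x ⟩
    abs c ℕ.* x ℕ.+ x  ≡⟨ lemma (abs c) x ⟩
    (abs c ℕ.+ 1) ℕ.* x  ∎
    where
    open ℕ.≤-Reasoning
    lemma : ∀ c x → c ℕ.* x ℕ.+ x ≡ (c ℕ.+ 1) ℕ.* x
    lemma = ℕ.solve-∀

  sheared-≤ : ∀ {d} c (F : Form ℤ d) → ∃ λ A → ∀ x y → y ℕ.≤ x → abs (sheared c F (+ x) (+ y)) ℕ.≤ A ℕ.* x ℕ.^ d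
  sheared-≤ {zero} c (a ∷ []) = (abs a) , λ x y _ → ℕ.≤-reflexive (sym (ℕ.*-identityʳ (abs a)))
  sheared-≤ {suc d} c (a ∷ F) = abs a ℕ.+ (abs c ℕ.+ 1) ℕ.* A , bound
    where
    open ℕ.≤-Reasoning
    A = proj₁ (sheared-≤ c F)
    bound : ∀ x y → y ℕ.≤ x → abs (sheared c (a ∷ F) (+ x) (+ y)) ℕ.≤ (abs a ℕ.+ (abs c ℕ.+ 1) ℕ.* A) ℕ.* x ℕ.^ suc d
    bound x y y≤x = begin
      abs (a * (+ x) ^ suc d + w * f)
        ≤⟨ ∣i+j∣≤∣i∣+∣j∣ (a * (+ x) ^ suc d) (w * f) ⟩
      abs (a * (+ x) ^ suc d) ℕ.+ abs (w * f)
        ≡⟨ cong₂ ℕ._+_ (trans (abs-* a ((+ x) ^ suc d)) (cong (abs a ℕ.*_) (abs-^ (+ x) (suc d)))) (abs-* w f) ⟩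
      abs a ℕ.* x ℕ.^ suc d ℕ.+ abs w ℕ.* (abs f)
        ≤⟨ ℕ.+-monoʳ-≤ (abs a ℕ.* x ℕ.^ suc d) (ℕ.*-mono-≤ (∣c*x+y∣≤ c y≤x) (proj₂ (sheared-≤ c F) x y y≤x)) ⟩
      abs a ℕ.* x ℕ.^ suc d ℕ.+ (abs c ℕ.+ 1) ℕ.* x ℕ.* (A ℕ.* x ℕ.^ d)
        ≡⟨ lemma (abs a) x (x ℕ.^ d) (abs c) A ⟩
      (abs a ℕ.+ (abs c ℕ.+ 1) ℕ.* A) ℕ.* x ℕ.^ suc d ∎
      where
      w = c * + x + + y
      f = sheared c F (+ x) (+ y)
      lemma : ∀ a x u c A → a ℕ.* (x ℕ.* u) ℕ.+ (c ℕ.+ 1) ℕ.* x ℕ.* (A ℕ.* u) ≡ (a ℕ.+ (c ℕ.+ 1) ℕ.* A) ℕ.* (x ℕ.* u)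
      lemma = ℕ.solve-∀

  -- Everything outside the x^d term has a factor y. The bound for h, a form of degree d - 1,
  -- carries a factor x so that this exponent does not occur.
  record Remainder {d} (c : ℤ) (F : Form ℤ d) : Set where
    field
      h           : ℤ → ℤ → ℤ
      H           : ℕ
      decompose   : ∀ x y → sheared c F x y ≡ eval F 1ℤ c * x ^ d + y * h x y
      h-≤         : ∀ x y → y ℕ.≤ x → x ℕ.* abs (h (+ x) (+ y)) ℕ.≤ H ℕ.* x ℕ.^ d

  remainder : ∀ {d} c (F : Form ℤ d) → Remainder c F
  remainder {zero} c (a ∷ []) = record
    { h = λ _ _ → 0ℤ ; H = 0
    ; decompose = λ x y → lemma a y
    ; h-≤ = λ x y _ → ℕ.≤-reflexive (ℕ.*-zeroʳ x)
    }
    where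
    lemma : ∀ a y → a ≡ a * 1ℤ + y * 0ℤ
    lemma = solve-∀
  remainder {suc d} c (a ∷ F) = record
    { h = h ; H = abs c ℕ.* R.H ℕ.+ A ; decompose = decompose ; h-≤ = h-≤ }
    where
    module R = Remainder (remainder c F)
    A = proj₁ (sheared-≤ c F)
    h : ℤ → ℤ → ℤ
    h x y = c * x * R.h x y + sheared c F x y
    decompose : ∀ x y → sheared c (a ∷ F) x y ≡ eval (a ∷ F) 1ℤ c * x ^ suc d + y * h x y
    decompose x y = begin
      a * x ^ suc d + (c * x + y) * sheared c F x y
        ≡⟨ split a (x ^ suc d) c x y (sheared c F x y) ⟩
      a * x ^ suc d + c * x * sheared c F x y + y * sheared c F x y
        ≡⟨ cong (λ s → a * x ^ suc d + c * x * s + y * sheared c F x y) (R.decompose x y) ⟩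
      a * x ^ suc d + c * x * (eval F 1ℤ c * x ^ d + y * R.h x y) + y * sheared c F x y
        ≡⟨ lemma a x (x ^ d) c (eval F 1ℤ c) y (R.h x y) (sheared c F x y) ⟩
      (a * 1ℤ + c * eval F 1ℤ c) * x ^ suc d + y * h x y
        ≡⟨ cong (λ u → (a * u + c * eval F 1ℤ c) * x ^ suc d + y * h x y) (sym (^-zeroˡ (suc d))) ⟩
      eval (a ∷ F) 1ℤ c * x ^ suc d + y * h x y ∎
      where
      open ≡-Reasoning
      split : ∀ a u c x y s → a * u + (c * x + y) * s ≡ a * u + c * x * s + y * s
      split = solve-∀
      lemma : ∀ a x u c f y h s → a * (x * u) + c * x * (f * u + y * h) + y * s
            ≡ (a * 1ℤ + c * f) * (x * u) + y * (c * x * h + s)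
      lemma = solve-∀
    h-≤ : ∀ x y → y ℕ.≤ x → x ℕ.* abs (h (+ x) (+ y)) ℕ.≤ (abs c ℕ.* R.H ℕ.+ A) ℕ.* x ℕ.^ suc d
    h-≤ x y y≤x = begin
      x ℕ.* abs (c * + x * R.h (+ x) (+ y) + f)
        ≤⟨ ℕ.*-monoʳ-≤ x (∣i+j∣≤∣i∣+∣j∣ (c * + x * R.h (+ x) (+ y)) f) ⟩
      x ℕ.* (abs (c * + x * R.h (+ x) (+ y)) ℕ.+ abs f)
        ≡⟨ cong (λ u → x ℕ.* (u ℕ.+ (abs f))) (trans (abs-* (c * + x) (R.h (+ x) (+ y))) (cong (ℕ._* h′) (abs-* c (+ x)))) ⟩
      x ℕ.* (abs c ℕ.* x ℕ.* h′ ℕ.+ abs f)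
        ≡⟨ expand x (abs c) h′ (abs f) ⟩
      abs c ℕ.* x ℕ.* (x ℕ.* h′) ℕ.+ x ℕ.* (abs f)
        ≤⟨ ℕ.+-mono-≤ (ℕ.*-monoʳ-≤ (abs c ℕ.* x) (R.h-≤ x y y≤x)) (ℕ.*-monoʳ-≤ x (proj₂ (sheared-≤ c F) x y y≤x)) ⟩
      abs c ℕ.* x ℕ.* (R.H ℕ.* x ℕ.^ d) ℕ.+ x ℕ.* (A ℕ.* x ℕ.^ d)
        ≡⟨ lemma (abs c) x R.H (x ℕ.^ d) A ⟩
      (abs c ℕ.* R.H ℕ.+ A) ℕ.* x ℕ.^ suc d ∎
      where
      open ℕ.≤-Reasoning
      f = sheared c F (+ x) (+ y)
      h′ = abs (R.h (+ x) (+ y))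
      expand : ∀ x c h f → x ℕ.* (c ℕ.* x ℕ.* h ℕ.+ f) ≡ c ℕ.* x ℕ.* (x ℕ.* h) ℕ.+ x ℕ.* f
      expand = ℕ.solve-∀
      lemma : ∀ c x H u A → c ℕ.* x ℕ.* (H ℕ.* u) ℕ.+ x ℕ.* (A ℕ.* u) ≡ (c ℕ.* H ℕ.+ A) ℕ.* (x ℕ.* u)
      lemma = ℕ.solve-∀

  -- The leading term is at least x^d in absolute value, and y |h| ≤ H y x^(d-1) ≤ x^d / 2. The
  -- calculation is this estimate multiplied by 2 x.
  sheared-≥ : ∀ {d} c (F : Form ℤ d) → eval F 1ℤ c ≢ 0ℤ → ∀ x y → .{{ℕ.NonZero x}} → y ℕ.≤ x →
              2 ℕ.* (Remainder.H (remainder c F) ℕ.* y) ℕ.≤ x → x ℕ.^ d ℕ.≤ 2 ℕ.* abs (sheared c F (+ x) (+ y))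
  sheared-≥ {d} c F a≢0 x y y≤x 2Hy≤x = ℕ.*-cancelˡ-≤ x (ℕ.+-cancelˡ-≤ (x ℕ.* X) (x ℕ.* X) (x ℕ.* (2 ℕ.* s)) (begin
    x ℕ.* X ℕ.+ x ℕ.* X
      ≡⟨ double x X ⟩
    2 ℕ.* (x ℕ.* X)
      ≤⟨ ℕ.*-monoʳ-≤ 2 (ℕ.*-monoʳ-≤ x lead) ⟩
    2 ℕ.* (x ℕ.* (s ℕ.+ y ℕ.* h′))
      ≡⟨ expand x s y h′ ⟩
    2 ℕ.* y ℕ.* (x ℕ.* h′) ℕ.+ x ℕ.* (2 ℕ.* s)
      ≤⟨ ℕ.+-monoˡ-≤ (x ℕ.* (2 ℕ.* s)) (ℕ.*-monoʳ-≤ (2 ℕ.* y) (R.h-≤ x y y≤x)) ⟩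
    2 ℕ.* y ℕ.* (R.H ℕ.* X) ℕ.+ x ℕ.* (2 ℕ.* s)
      ≡⟨ cong (ℕ._+ x ℕ.* (2 ℕ.* s)) (regroup y R.H X) ⟩
    2 ℕ.* (R.H ℕ.* y) ℕ.* X ℕ.+ x ℕ.* (2 ℕ.* s)
      ≤⟨ ℕ.+-monoˡ-≤ (x ℕ.* (2 ℕ.* s)) (ℕ.*-monoˡ-≤ X 2Hy≤x) ⟩
    x ℕ.* X ℕ.+ x ℕ.* (2 ℕ.* s) ∎))
    where
    open ℕ.≤-Reasoning
    module R = Remainder (remainder c F)
    X = x ℕ.^ d
    s = abs (sheared c F (+ x) (+ y))
    h′ = abs (R.h (+ x) (+ y))
    a = eval F 1ℤ c
    double : ∀ x X → x ℕ.* X ℕ.+ x ℕ.* X ≡ 2 ℕ.* (x ℕ.* X)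
    double = ℕ.solve-∀
    expand : ∀ x s y h → 2 ℕ.* (x ℕ.* (s ℕ.+ y ℕ.* h)) ≡ 2 ℕ.* y ℕ.* (x ℕ.* h) ℕ.+ x ℕ.* (2 ℕ.* s)
    expand = ℕ.solve-∀
    regroup : ∀ y H X → 2 ℕ.* y ℕ.* (H ℕ.* X) ≡ 2 ℕ.* (H ℕ.* y) ℕ.* X
    regroup = ℕ.solve-∀
    isolate : ∀ s u v → s ≡ u + v → u ≡ s - v
    isolate s u v refl = lemma u v
      where
      lemma : ∀ u v → u ≡ u + v - v
      lemma = solve-∀
    ∣a∣≥1 : 1 ℕ.≤ (abs a)
    ∣a∣≥1 = ℕ.n≢0⇒n>0 λ eq → a≢0 (∣i∣≡0⇒i≡0 eq)
    lead : X ℕ.≤ s ℕ.+ y ℕ.* h′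
    lead = begin
      X  ≡⟨ ℕ.*-identityˡ X ⟨
      1 ℕ.* X  ≤⟨ ℕ.*-monoˡ-≤ X ∣a∣≥1 ⟩
      abs a ℕ.* X  ≡⟨ cong (abs a ℕ.*_) (abs-^ (+ x) d) ⟨
      abs a ℕ.* abs ((+ x) ^ d)  ≡⟨ abs-* a ((+ x) ^ d) ⟨
      abs (a * (+ x) ^ d)  ≡⟨ cong abs (isolate (sheared c F (+ x) (+ y)) (a * (+ x) ^ d) (+ y * R.h (+ x) (+ y)) (R.decompose (+ x) (+ y))) ⟩
      abs (sheared c F (+ x) (+ y) - + y * R.h (+ x) (+ y))
        ≤⟨ ∣i-j∣≤∣i∣+∣j∣ (sheared c F (+ x) (+ y)) (+ y * R.h (+ x) (+ y)) ⟩
      s ℕ.+ abs (+ y * R.h (+ x) (+ y))  ≡⟨ cong (s ℕ.+_) (abs-* (+ y) (R.h (+ x) (+ y))) ⟩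
      s ℕ.+ y ℕ.* h′  ∎

-- The points of the box and the primes dividing the values there.

module Box where
  open PrimeDivisors
  open FormCalculus
  open Growth
  open import Data.Nat.Base as ℕ using (ℕ; suc; z≤n; s≤s; _≤_; _<_; NonZero)
  import Data.Nat.Properties as ℕ
  import Data.Nat.Divisibility as ℕ
  open import Data.Nat.Coprimality using (Coprime)
  open import Data.Nat.Primality using (Prime; ¬prime[1]; euclidsLemma)
  import Data.Nat.Tactic.RingSolver as ℕ
  open import Data.Integer.Base as ℤ using (ℤ; +_; -[1+_]; 0ℤ; 1ℤ) renaming (∣_∣ to abs)
  open import Data.Integer.Properties using (abs-*; pos-*; *-assoc; ∣i∣≡0⇒i≡0)
  open import Data.Integer.Divisibility.Signed as ℤ using ()
  open import Data.Integer.Tactic.RingSolver using (solve-∀)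
  open import Data.Product.Base using (_×_; _,_; proj₁; proj₂)
  open import Data.Sum.Base using (inj₁; inj₂; [_,_]′)
  open import Function.Base using (_∘_)
  open import Relation.Nullary using (¬_)
  open import Relation.Binary.PropositionalEquality

  +abs²≡² : ∀ a → + (abs a ℕ.* abs a) ≡ a ℤ.* a
  +abs²≡² (+ n)    = pos-* n n
  +abs²≡² -[1+ n ] = refl

  -- As x ≡ 1 and y ≡ 0 modulo the resultant and a, F = a u at (x i, y j)
  -- with u coprime to both.
  -- The factor 12 excludes the common divisors 2, 3 and 4 of x and y.
  module Points {n} (F : Form ℤ (suc (suc n))) (c : ℤ)
                (a≢0 : eval F 1ℤ c ≢ 0ℤ) (R≢0 : ∂-resultant F ≢ 0ℤ) where

    d : ℕ
    d = suc (suc n)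

    a : ℤ
    a = eval F 1ℤ c

    module R = Remainder (remainder c F)

    -- One factor |a| of M is divided out in u; the other keeps u ≡ x^d modulo a. K makes x at least
    -- y and at least 2 H y, as `sheared-≥` demands. V comes from `sheared-≤` and x ≤ M (K + 1) B.
    A K N M V : ℕ
    A = proj₁ (sheared-≤ c F)
    K = suc (2 ℕ.* R.H)
    N = abs a ℕ.* (abs (∂-resultant F) ℕ.* 12)
    M = abs a ℕ.* N
    V = A ℕ.* (M ℕ.* suc K) ℕ.^ d

    abs≢0 : ∀ {z} → z ≢ 0ℤ → 1 ≤ abs z
    abs≢0 z≢0 = ℕ.n≢0⇒n>0 (z≢0 ∘ ∣i∣≡0⇒i≡0)

    N≥1 : 1 ≤ N
    N≥1 = ℕ.*-mono-≤ (abs≢0 a≢0) (ℕ.*-mono-≤ {1} {abs (∂-resultant F)} {1} {12} (abs≢0 R≢0) (s≤s z≤n))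

    M≥1 : 1 ≤ M
    M≥1 = ℕ.*-mono-≤ (abs≢0 a≢0) N≥1

    module InBox (B : ℕ) (B≥1 : 1 ≤ B) where

      x y : ℕ → ℕ
      x i = suc (M ℕ.* (K ℕ.* B ℕ.+ i))
      y j = M ℕ.* suc j

      value : ℕ → ℕ → ℤ
      value i j = sheared c F (+ x i) (+ y j)

      step : ℕ → ℤ
      step j = a ℤ.* + (abs (∂-resultant F) ℕ.* 12 ℕ.* suc j)

      u : ℕ → ℕ → ℤ
      u i j = (+ x i) ℤ.^ d ℤ.+ step j ℤ.* R.h (+ x i) (+ y j)

      U : ℕ → ℕ → ℕ
      U i j = abs (u i j)

      +y≡ : ∀ j → + y j ≡ a ℤ.* step j
      +y≡ j = begin
        + (abs a ℕ.* (abs a ℕ.* W) ℕ.* suc j)  ≡⟨ cong +_ (regroup (abs a) W (suc j)) ⟩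
        + (abs a ℕ.* abs a ℕ.* (W ℕ.* suc j))  ≡⟨ pos-* (abs a ℕ.* abs a) (W ℕ.* suc j) ⟩
        + (abs a ℕ.* abs a) ℤ.* + (W ℕ.* suc j)  ≡⟨ cong (ℤ._* + (W ℕ.* suc j)) (+abs²≡² a) ⟩
        a ℤ.* a ℤ.* + (W ℕ.* suc j)  ≡⟨ *-assoc a a (+ (W ℕ.* suc j)) ⟩
        a ℤ.* step j  ∎
        where
        open ≡-Reasoning
        W = abs (∂-resultant F) ℕ.* 12
        regroup : ∀ e w s → e ℕ.* (e ℕ.* w) ℕ.* s ≡ e ℕ.* e ℕ.* (w ℕ.* s)
        regroup = ℕ.solve-∀

      value≡a*u : ∀ i j → value i j ≡ a ℤ.* u i j
      value≡a*u i j = begin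
        value i j
          ≡⟨ R.decompose (+ x i) (+ y j) ⟩
        a ℤ.* X ℤ.+ + y j ℤ.* h
          ≡⟨ cong (λ z → a ℤ.* X ℤ.+ z ℤ.* h) (+y≡ j) ⟩
        a ℤ.* X ℤ.+ a ℤ.* step j ℤ.* h
          ≡⟨ lemma a X (step j) h ⟩
        a ℤ.* (X ℤ.+ step j ℤ.* h) ∎
        where
        open ≡-Reasoning
        X = (+ x i) ℤ.^ d
        h = R.h (+ x i) (+ y j)
        lemma : ∀ a X s h → a ℤ.* X ℤ.+ a ℤ.* s ℤ.* h ≡ a ℤ.* (X ℤ.+ s ℤ.* h)
        lemma = solve-∀

      abs-value : ∀ i j → abs (value i j) ≡ abs a ℕ.* U i j
      abs-value i j = trans (cong abs (value≡a*u i j)) (abs-* a (u i j))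

      x≤ : ∀ {i} → i < B → x i ≤ M ℕ.* (suc K ℕ.* B)
      x≤ {i} i<B = begin
        suc (M ℕ.* (K ℕ.* B ℕ.+ i))  ≤⟨ ℕ.+-monoˡ-≤ (M ℕ.* (K ℕ.* B ℕ.+ i)) M≥1 ⟩
        M ℕ.+ M ℕ.* (K ℕ.* B ℕ.+ i)  ≡⟨ ℕ.*-suc M (K ℕ.* B ℕ.+ i) ⟨
        M ℕ.* suc (K ℕ.* B ℕ.+ i)  ≡⟨ cong (M ℕ.*_) (ℕ.+-suc (K ℕ.* B) i) ⟨
        M ℕ.* (K ℕ.* B ℕ.+ suc i)  ≤⟨ ℕ.*-monoʳ-≤ M (ℕ.+-monoʳ-≤ (K ℕ.* B) i<B) ⟩
        M ℕ.* (K ℕ.* B ℕ.+ B)  ≡⟨ cong (M ℕ.*_) (ℕ.+-comm (K ℕ.* B) B) ⟩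
        M ℕ.* (suc K ℕ.* B)  ∎
        where open ℕ.≤-Reasoning

      x≥ : ∀ i → M ℕ.* (K ℕ.* B) ≤ x i
      x≥ i = ℕ.m≤n⇒m≤1+n (ℕ.*-monoʳ-≤ M (ℕ.m≤m+n (K ℕ.* B) i))

      y≤ : ∀ {j} → j < B → y j ≤ M ℕ.* B
      y≤ j<B = ℕ.*-monoʳ-≤ M j<B

      y≤x : ∀ {i j} → j < B → y j ≤ x i
      y≤x {i} j<B = ℕ.≤-trans (y≤ j<B) (ℕ.≤-trans (ℕ.*-monoʳ-≤ M (ℕ.m≤m+n B (2 ℕ.* R.H ℕ.* B))) (x≥ i))

      2Hy≤x : ∀ {i j} → j < B → 2 ℕ.* (R.H ℕ.* y j) ≤ x i
      2Hy≤x {i} {j} j<B = begin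
        2 ℕ.* (R.H ℕ.* y j)  ≤⟨ ℕ.*-monoʳ-≤ 2 (ℕ.*-monoʳ-≤ R.H (y≤ j<B)) ⟩
        2 ℕ.* (R.H ℕ.* (M ℕ.* B))  ≡⟨ regroup R.H M B ⟩
        M ℕ.* (2 ℕ.* R.H ℕ.* B)  ≤⟨ ℕ.*-monoʳ-≤ M (ℕ.m≤n+m (2 ℕ.* R.H ℕ.* B) B) ⟩
        M ℕ.* (K ℕ.* B)  ≤⟨ x≥ i ⟩
        x i  ∎
        where
        open ℕ.≤-Reasoning
        regroup : ∀ H M B → 2 ℕ.* (H ℕ.* (M ℕ.* B)) ≡ M ℕ.* (2 ℕ.* H ℕ.* B)
        regroup = ℕ.solve-∀

      B≤x : ∀ i → B ≤ x i
      B≤x i = begin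
        B  ≡⟨ ℕ.*-identityˡ B ⟨
        1 ℕ.* B  ≤⟨ ℕ.*-mono-≤ M≥1 (ℕ.m≤m+n B (2 ℕ.* R.H ℕ.* B)) ⟩
        M ℕ.* (K ℕ.* B)  ≤⟨ x≥ i ⟩
        x i  ∎
        where open ℕ.≤-Reasoning

      U-lower : ∀ {i j} → j < B → B ℕ.^ d ≤ 2 ℕ.* abs a ℕ.* U i j
      U-lower {i} {j} j<B = begin
        B ℕ.^ d  ≤⟨ ℕ.^-monoˡ-≤ d (B≤x i) ⟩
        x i ℕ.^ d  ≤⟨ sheared-≥ c F a≢0 (x i) (y j) (y≤x {i} j<B) (2Hy≤x {i} j<B) ⟩
        2 ℕ.* abs (value i j)  ≡⟨ cong (2 ℕ.*_) (abs-value i j) ⟩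
        2 ℕ.* (abs a ℕ.* U i j)  ≡⟨ ℕ.*-assoc 2 (abs a) (U i j) ⟨
        2 ℕ.* abs a ℕ.* U i j  ∎
        where open ℕ.≤-Reasoning

      U≢0 : ∀ {i j} → j < B → NonZero (U i j)
      U≢0 {i} {j} j<B = ℕ.≢-nonZero λ eq → ℕ.<⇒≱ (ℕ.m^n>0 B {{ℕ.>-nonZero B≥1}} d)
        (subst (B ℕ.^ d ≤_) (trans (cong (2 ℕ.* abs a ℕ.*_) eq) (ℕ.*-zeroʳ (2 ℕ.* abs a))) (U-lower {i} j<B))

      value-≤ : ∀ {i j} → i < B → j < B → abs (value i j) ≤ V ℕ.* B ℕ.^ d
      value-≤ {i} {j} i<B j<B = begin
        abs (value i j)  ≤⟨ proj₂ (sheared-≤ c F) (x i) (y j) (y≤x {i} j<B) ⟩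
        A ℕ.* x i ℕ.^ d  ≤⟨ ℕ.*-monoʳ-≤ A (ℕ.^-monoˡ-≤ d (x≤ i<B)) ⟩
        A ℕ.* (M ℕ.* (suc K ℕ.* B)) ℕ.^ d  ≡⟨ cong (λ z → A ℕ.* z ℕ.^ d) (ℕ.*-assoc M (suc K) B) ⟨
        A ℕ.* (M ℕ.* suc K ℕ.* B) ℕ.^ d  ≡⟨ cong (A ℕ.*_) (SmoothParts.*-^ (M ℕ.* suc K) B d) ⟩
        A ℕ.* ((M ℕ.* suc K) ℕ.^ d ℕ.* B ℕ.^ d) ≡⟨ ℕ.*-assoc A ((M ℕ.* suc K) ℕ.^ d) (B ℕ.^ d) ⟨
        V ℕ.* B ℕ.^ d  ∎
        where open ℕ.≤-Reasoning

      U-upper : ∀ {i j} → i < B → j < B → U i j ≤ V ℕ.* B ℕ.^ d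
      U-upper {i} {j} i<B j<B = begin
        U i j  ≡⟨ ℕ.*-identityˡ (U i j) ⟨
        1 ℕ.* U i j  ≤⟨ ℕ.*-monoˡ-≤ (U i j) (abs≢0 a≢0) ⟩
        abs a ℕ.* U i j  ≡⟨ abs-value i j ⟨
        abs (value i j)  ≤⟨ value-≤ i<B j<B ⟩
        V ℕ.* B ℕ.^ d  ∎
        where open ℕ.≤-Reasoning

      ∣U⇒∣value : ∀ {q} i j → q ℕ.∣ U i j → + q ℤ.∣ value i j
      ∣U⇒∣value {q} i j q∣U = ∣-cong (sym (value≡a*u i j)) (ℤ.∣n⇒∣m*n a {u i j} (ℤ.∣ᵤ⇒∣ q∣U))

      -- Here u = x^d + step · h with |step| = N (j + 1), so a prime dividing u and the step divides
      -- x^d.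
      step-∣⇒∣x : ∀ {p} → Prime p → ∀ i j → p ℕ.∣ U i j → p ℕ.∣ N ℕ.* suc j → p ℕ.∣ x i
      step-∣⇒∣x {p} pr i j p∣U p∣step = ℤ.∣⇒∣ᵤ (prime-∣-^ pr (+ x i) d
        (ℤ.∣m+n∣n⇒∣m {m = (+ x i) ℤ.^ d} {n = step j ℤ.* R.h (+ x i) (+ y j)} (ℤ.∣ᵤ⇒∣ p∣U)
          (ℤ.∣m⇒∣m*n {m = step j} (R.h (+ x i) (+ y j)) (ℤ.∣ᵤ⇒∣ (subst (p ℕ.∣_) (sym abs-step) p∣step)))))
        where
        abs-step : abs (step j) ≡ N ℕ.* suc j
        abs-step = trans (abs-* a (+ (abs (∂-resultant F) ℕ.* 12 ℕ.* suc j)))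
          (sym (ℕ.*-assoc (abs a) (abs (∂-resultant F) ℕ.* 12) (suc j)))

      prime-∣M⇒∣N : ∀ {p} → Prime p → p ℕ.∣ M → p ℕ.∣ N
      prime-∣M⇒∣N pr p∣M = [ (λ p∣a → ℕ.∣m⇒∣m*n (abs (∂-resultant F) ℕ.* 12) p∣a) , (λ p∣N → p∣N) ]′ (euclidsLemma (abs a) N pr p∣M)

      ∣x⇒∤M : ∀ {g} i → g ℕ.∣ x i → g ℕ.∣ M → g ≡ 1
      ∣x⇒∤M {g} i g∣x g∣M = ℕ.∣1⇒≡1 (ℕ.∣m+n∣m⇒∣n (subst (g ℕ.∣_) (ℕ.+-comm 1 (M ℕ.* (K ℕ.* B ℕ.+ i))) g∣x)
        (ℕ.∣m⇒∣m*n (K ℕ.* B ℕ.+ i) g∣M))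

      -- A prime dividing u and M divides N, hence the step, hence x, which is 1 modulo M. Since `a`
      -- and the resultant divide M, the bad primes are excluded at once.
      ∣U⇒∤M : ∀ {p} → Prime p → ∀ i j → p ℕ.∣ U i j → ¬ (p ℕ.∣ M)
      ∣U⇒∤M pr i j p∣U p∣M with refl ← ∣x⇒∤M i (step-∣⇒∣x pr i j p∣U (ℕ.∣m⇒∣m*n (suc j) (prime-∣M⇒∣N pr p∣M))) p∣M =
        ¬prime[1] pr

      ∣U⇒∤a : ∀ {p} → Prime p → ∀ i j → p ℕ.∣ U i j → ¬ (+ p ℤ.∣ a)
      ∣U⇒∤a pr i j p∣U p∣a = ∣U⇒∤M pr i j p∣U (ℕ.∣m⇒∣m*n N (ℤ.∣⇒∣ᵤ p∣a))

      ∣U⇒∤R : ∀ {p} → Prime p → ∀ i j → p ℕ.∣ U i j → ¬ (+ p ℤ.∣ ∂-resultant F)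
      ∣U⇒∤R pr i j p∣U p∣R = ∣U⇒∤M pr i j p∣U (ℕ.∣n⇒∣m*n (abs a) (ℕ.∣n⇒∣m*n (abs a) (ℕ.∣m⇒∣m*n 12 (ℤ.∣⇒∣ᵤ p∣R))))

      ∣U⇒∤y : ∀ {p} → Prime p → ∀ i j → Coprime (x i) (suc j) → p ℕ.∣ U i j → ¬ (+ p ℤ.∣ + y j)
      ∣U⇒∤y {p} pr i j coprime p∣U p∣y with euclidsLemma M (suc j) pr (ℤ.∣⇒∣ᵤ p∣y)
      ... | inj₁ p∣M = ∣U⇒∤M pr i j p∣U p∣M
      ... | inj₂ p∣j with refl ← coprime (step-∣⇒∣x pr i j p∣U (ℕ.∣n⇒∣m*n N p∣j) , p∣j) = ¬prime[1] pr

      point : ℕ × ℕ → ℤ × ℤ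
      point (i , j) = + x i , + y j

      -- Equivalent to coprimality of x and y = M (j + 1), as x is prime to M.
      Coprimes : ℕ × ℕ → Set
      Coprimes (i , j) = Coprime (x i) (suc j)

      ∣-∧-points : ∀ q → .{{NonZero q}} → ∀ P Q → Coprimes P → Coprimes Q →
        q ℕ.∣ U (proj₁ P) (proj₂ P) → q ℕ.∣ U (proj₁ Q) (proj₂ Q) →
        (∀ p → Prime p → p ℕ.∣ q → + p ℤ.∣ point P ∧ point Q) → + q ℤ.∣ point P ∧ point Q
      ∣-∧-points q P@(i , j) Q@(i′ , j′) cP cQ q∣P q∣Q local =
        ∣-∧ c F q (+ x i) (+ y j) (+ x i′) (+ y j′) (∣U⇒∣value i j q∣P) (∣U⇒∣value i′ j′ q∣Q) λ p pr p∣q →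
          ∣U⇒∤R pr i j (ℕ.∣-trans p∣q q∣P) ,
          ∣U⇒∤y pr i j cP (ℕ.∣-trans p∣q q∣P) ,
          ∣U⇒∤y pr i′ j′ cQ (ℕ.∣-trans p∣q q∣Q) ,
          local p pr p∣q

-- Bounds for the length of lists without repetition.

module UniqueLists where
  open PrimeDivisors
  open SmoothParts using (_div_)
  open import Data.Nat.Base as ℕ using (ℕ; zero; suc; s≤s; _≤_; _<_; NonZero)
  import Data.Nat.Properties as ℕ
  import Data.Nat.Divisibility as ℕ
  open import Data.Nat.DivMod using (_/_; _%_; m≡m%n+[m/n]*n; m%n<n; /-monoˡ-≤)
  open import Data.Integer.Base as ℤ using (ℤ; +_) renaming (∣_∣ to abs)
  import Data.Integer.Properties as ℤ
  open import Data.Integer.Divisibility.Signed as ℤ using ()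
  open import Data.Integer.Tactic.RingSolver using (solve-∀)
  open import Data.Fin.Base as Fin using (Fin; zero; suc; fromℕ<; toℕ)
  open import Data.Fin.Properties using (injective⇒≤; toℕ-fromℕ<)
  open import Data.List.Base using (List; _∷_; length; lookup)
  open import Data.List.Membership.Propositional using (_∈_)
  open import Data.List.Membership.Propositional.Properties using (∈-lookup)
  open import Data.List.Relation.Unary.All as All using (All; _∷_)
  open import Data.List.Relation.Unary.AllPairs using (_∷_)
  open import Data.List.Relation.Unary.Unique.Propositional using (Unique)
  open import Data.Sum.Base using (inj₁; inj₂)
  open import Data.Empty using (⊥-elim)
  open import Relation.Binary.PropositionalEquality

  lookup-injective : ∀ {A : Set} {L : List A} → Unique L → ∀ i j → lookup L i ≡ lookup L j → i ≡ j
  lookup-injective (P∉ ∷ uL) zero    zero    eq = refl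
  lookup-injective (P∉ ∷ uL) zero    (suc j) eq = ⊥-elim (All.lookup P∉ (∈-lookup j) eq)
  lookup-injective (P∉ ∷ uL) (suc i) zero    eq = ⊥-elim (All.lookup P∉ (∈-lookup i) (sym eq))
  lookup-injective (P∉ ∷ uL) (suc i) (suc j) eq = cong suc (lookup-injective uL i j eq)

  length-≤ : ∀ {A : Set} (g : A → ℕ) m L → Unique L → All (λ P → g P < m) L →
             (∀ {P Q} → P ∈ L → Q ∈ L → g P ≡ g Q → P ≡ Q) → length L ≤ m
  length-≤ g m L uL bounds injective = injective⇒≤ {f = f} f-injective
    where
    f : Fin (length L) → Fin m
    f i = fromℕ< (All.lookup bounds (∈-lookup {xs = L} i))
    f-injective : ∀ {i j} → f i ≡ f j → i ≡ j
    f-injective {i} {j} eq = lookup-injective uL i j (injective (∈-lookup i) (∈-lookup j)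
      (trans (sym (toℕ-fromℕ< _)) (trans (cong toℕ eq) (toℕ-fromℕ< _))))

  abs-difference-≤ : ∀ {a b m} → a ≤ m → b ≤ m → abs (+ a ℤ.- + b) ≤ m
  abs-difference-≤ {a} {b} {m} a≤m b≤m with ℕ.≤-total a b
  ... | inj₁ a≤b = subst (_≤ m) (sym (trans (cong abs (ℤ.[+m]-[+n]≡m⊖n a b)) (ℤ.∣⊖∣-≤ a≤b))) (ℕ.≤-trans (ℕ.m∸n≤m b a) b≤m)
  ... | inj₂ b≤a = subst (_≤ m) (sym (trans (cong abs (ℤ.[+m]-[+n]≡m⊖n a b)) (cong abs (ℤ.⊖-≥ b≤a)))) (ℕ.≤-trans (ℕ.m∸n≤m a b) a≤m)

  ∣∧<⇒≡0 : ∀ {q z} → + q ℤ.∣ z → abs z < q → z ≡ ℤ.0ℤ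
  ∣∧<⇒≡0 {q} {z} q∣z z<q = ℤ.∣i∣≡0⇒i≡0 (small (abs z) (ℤ.∣⇒∣ᵤ q∣z) z<q)
    where
    small : ∀ m → q ℕ.∣ m → m < q → m ≡ 0
    small zero    _   _   = refl
    small (suc m) q∣m m<q = ⊥-elim (ℕ.<⇒≱ m<q (ℕ.∣⇒≤ q∣m))

  -- On a residue class modulo q the quotient by q determines the number.
  length-residue-class : ∀ q → .{{NonZero q}} → ∀ B L → Unique L → All (_< B) L →
    (∀ {i j} → i ∈ L → j ∈ L → + q ℤ.∣ + i ℤ.- + j) → length L ≤ B div q ℕ.+ 1
  length-residue-class (suc q) B L uL bounds pairs =
    length-≤ (_/ suc q) (B / suc q ℕ.+ 1) L uL
      (All.map (λ {i} i<B → ℕ.≤-trans (s≤s (/-monoˡ-≤ (suc q) (ℕ.<⇒≤ i<B))) (ℕ.≤-reflexive (ℕ.+-comm 1 (B / suc q)))) bounds)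
      (λ {i} {j} i∈ j∈ eq → same i j eq (pairs i∈ j∈))
    where
    lemma : ∀ r s k → (r ℤ.+ k) ℤ.- (s ℤ.+ k) ≡ r ℤ.- s
    lemma = solve-∀
    same : ∀ i j → i / suc q ≡ j / suc q → + suc q ℤ.∣ + i ℤ.- + j → i ≡ j
    same i j eq q∣ = begin
      i  ≡⟨ m≡m%n+[m/n]*n i (suc q) ⟩
      i % suc q ℕ.+ i / suc q ℕ.* suc q  ≡⟨ cong₂ (λ r s → r ℕ.+ s ℕ.* suc q) remainders eq ⟩
      j % suc q ℕ.+ j / suc q ℕ.* suc q  ≡⟨ m≡m%n+[m/n]*n j (suc q) ⟨
      j  ∎
      where
      open ≡-Reasoning
      k = j / suc q ℕ.* suc q
      difference : + i ℤ.- + j ≡ + (i % suc q) ℤ.- + (j % suc q)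
      difference = begin
        + i ℤ.- + j
          ≡⟨ cong₂ (λ m n → + m ℤ.- + n) (trans (m≡m%n+[m/n]*n i (suc q)) (cong (λ s → i % suc q ℕ.+ s ℕ.* suc q) eq)) (m≡m%n+[m/n]*n j (suc q)) ⟩
        + (i % suc q ℕ.+ k) ℤ.- + (j % suc q ℕ.+ k)
          ≡⟨ cong₂ ℤ._-_ (ℤ.pos-+ (i % suc q) k) (ℤ.pos-+ (j % suc q) k) ⟩
        (+ (i % suc q) ℤ.+ + k) ℤ.- (+ (j % suc q) ℤ.+ + k)
          ≡⟨ lemma (+ (i % suc q)) (+ (j % suc q)) (+ k) ⟩
        + (i % suc q) ℤ.- + (j % suc q) ∎
      remainders : i % suc q ≡ j % suc q
      remainders = ℤ.+-injective (ℤ.i-j≡0⇒i≡j (+ (i % suc q)) (+ (j % suc q))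
        (∣∧<⇒≡0 (∣-cong difference q∣)
          (s≤s (abs-difference-≤ (ℕ.s≤s⁻¹ (m%n<n i (suc q))) (ℕ.s≤s⁻¹ (m%n<n j (suc q)))))))

-- Divisibility by prime powers in a row, and the multiplicity of a value.

module Representations where
  open PrimeDivisors
  open FormCalculus
  open Lagrange
  open SmoothParts hiding (*-^)
  open Growth
  open Box
  open UniqueLists
  open import Data.Nat.Base as ℕ using (ℕ; suc; z≤n; s≤s; _≤_; _<_; NonZero)
  import Data.Nat.Properties as ℕ
  import Data.Nat.Divisibility as ℕ
  open import Data.Nat.Coprimality as Coprimality using (Coprime; coprime-divisor)
  open import Data.Nat.Primality using (Prime; prime⇒irreducible; ¬prime[1]; prime⇒nonZero)
  open import Data.Nat.Primality.Factorisation using (factorisationHasAllPrimeFactors)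
  open import Data.Nat.ListAction using (product)
  import Data.Nat.Tactic.RingSolver as ℕ
  open import Data.Integer.Base as ℤ using (ℤ; +_; 0ℤ; 1ℤ) renaming (∣_∣ to abs)
  import Data.Integer.Properties as ℤ
  open import Data.Integer.Divisibility.Signed as ℤ using ()
  open import Data.Integer.Tactic.RingSolver using (solve-∀)
  open import Data.List.Base using ([]; _∷_; length; filter)
  open import Data.List.Membership.Propositional using (_∈_)
  open import Data.List.Relation.Unary.All as All using (All; []; _∷_)
  open import Data.List.Relation.Unary.All.Properties using (filter⁺; all-filter)
  open import Data.List.Relation.Unary.AllPairs using ([]; _∷_)
  open import Data.List.Relation.Unary.Any using (here; there)
  open import Data.List.Relation.Unary.Unique.Propositional using (Unique)
  import Data.List.Relation.Unary.Unique.Propositional.Properties as Unique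
  open import Data.Product.Base using (_×_; _,_; proj₁; proj₂)
  open import Data.Sum.Base using (inj₁; inj₂; [_,_]′)
  open import Data.Empty using (⊥-elim)
  open import Relation.Nullary using (¬_)
  open import Relation.Binary.PropositionalEquality

  prime-∣-^⇒≡ : ∀ {p p′} → Prime p → Prime p′ → ∀ k → p′ ℕ.∣ p ℕ.^ k → p′ ≡ p
  prime-∣-^⇒≡ {p} {p′} pr pr′ k p′∣
    with prime⇒irreducible pr (ℤ.∣⇒∣ᵤ (prime-∣-^ pr′ (+ p) k (ℤ.∣ᵤ⇒∣ (subst (p′ ℕ.∣_) (sym (abs-^ (+ p) k)) p′∣))))
  ... | inj₁ refl = ⊥-elim (¬prime[1] pr′)
  ... | inj₂ eq   = eq

  module Bounds {n} (F : Form ℤ (suc (suc n))) (c : ℤ)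
                (a≢0 : eval F 1ℤ c ≢ 0ℤ) (R≢0 : ∂-resultant F ≢ 0ℤ) (B : ℕ) (B≥1 : 1 ≤ B) where
    open Points F c a≢0 R≢0
    open InBox B B≥1

    InRow : ℕ → ℕ → Set
    InRow j i = i < B × Coprime (x i) (suc j)

    x-difference : ∀ i i′ → + x i ℤ.- + x i′ ≡ + M ℤ.* (+ i ℤ.- + i′)
    x-difference i i′ = trans (cong₂ ℤ._-_ (expand i) (expand i′)) (lemma (+ M) (+ (K ℕ.* B)) (+ i) (+ i′))
      where
      expand : ∀ i → + x i ≡ 1ℤ ℤ.+ + M ℤ.* (+ (K ℕ.* B) ℤ.+ + i)
      expand i = trans (ℤ.pos-+ 1 (M ℕ.* (K ℕ.* B ℕ.+ i)))
        (cong (λ z → 1ℤ ℤ.+ z) (trans (ℤ.pos-* M (K ℕ.* B ℕ.+ i)) (cong (+ M ℤ.*_) (ℤ.pos-+ (K ℕ.* B) i))))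
      lemma : ∀ m k i i′ → (1ℤ ℤ.+ m ℤ.* (k ℤ.+ i)) ℤ.- (1ℤ ℤ.+ m ℤ.* (k ℤ.+ i′)) ≡ m ℤ.* (i ℤ.- i′)
      lemma = solve-∀

    -- The solutions form at most d classes modulo p. Within a class Hensel's lemma gives q ∣ M (i -
    -- i′) y for q = p^(k+1), because the points share y; M y is prime to q, so the i are congruent
    -- modulo q.
    multiples-in-row : ∀ {p} → Prime p → ∀ k j L → Unique L → All (InRow j) L →
      multiples (λ i → U i j) (p ℕ.^ suc k) L ≤ d ℕ.* (B div p ℕ.^ suc k ℕ.+ 1)
    multiples-in-row {p} pr k j L uL inRow =
      bound (filter (λ i → q ℕ.∣? U i j) L) (Unique.filter⁺ (λ i → q ℕ.∣? U i j) uL)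
        (All.zip (filter⁺ (λ i → q ℕ.∣? U i j) inRow , all-filter (λ i → q ℕ.∣? U i j) L))
      where
      q = p ℕ.^ suc k
      p∣q : p ℕ.∣ q
      p∣q = ℕ.m∣m*n (p ℕ.^ k)
      instance
        p≢0 = prime⇒nonZero pr
        q≢0 = ℕ.m^n≢0 p (suc k)
      Good : ℕ → Set
      Good i = InRow j i × q ℕ.∣ U i j
      pt : ℕ → ℤ × ℤ
      pt i = point (i , j)

      class : ∀ L → Unique L → All Good L →
        (∀ {P Q} → P ∈ L → Q ∈ L → All (λ p → + p ℤ.∣ pt P ∧ pt Q) (p ∷ [])) → length L ≤ B div q ℕ.+ 1
      class L uL good pairs = length-residue-class q B L uL (All.map (λ g → proj₁ (proj₁ g)) good) λ {i} {i′} i∈ i′∈ →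
        let (i<B , ci) , q∣i = All.lookup good i∈
            (_ , ci′) , q∣i′ = All.lookup good i′∈
        in ∣-*-cancel q (+ i ℤ.- + i′) (+ M ℤ.* + y j)
             (∣-cong (trans (factor (+ x i) (+ x i′) (+ y j)) (trans (cong (ℤ._* + y j) (x-difference i i′)) (regroup (+ M) (+ i ℤ.- + i′) (+ y j))))
               (∣-∧-points q (i , j) (i′ , j) ci ci′ q∣i q∣i′ (λ p′ pr′ p′∣q →
                 subst (λ r → + r ℤ.∣ pt i ∧ pt i′) (sym (prime-∣-^⇒≡ pr pr′ (suc k) p′∣q)) (All.head (pairs i∈ i′∈)))))
             (λ p′ pr′ p′∣q p′∣My →
               [ (λ p′∣M → ∣U⇒∤M pr′ i j (ℕ.∣-trans p′∣q q∣i) (ℤ.∣⇒∣ᵤ p′∣M))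
               , ∣U⇒∤y pr′ i j ci (ℕ.∣-trans p′∣q q∣i) ]′ (prime-∣-* pr′ (+ M) (+ y j) p′∣My))
        where
        factor : ∀ x x′ y → x ℤ.* y ℤ.- x′ ℤ.* y ≡ (x ℤ.- x′) ℤ.* y
        factor = solve-∀
        regroup : ∀ m δ y → m ℤ.* δ ℤ.* y ≡ δ ℤ.* (m ℤ.* y)
        regroup = solve-∀

      bound : ∀ L → Unique L → All Good L → length L ≤ d ℕ.* (B div q ℕ.+ 1)
      bound [] uL good = z≤n
      bound L@(i₀ ∷ _) uL good@((_ , q∣i₀) ∷ _) =
        subst (λ e → length L ≤ e ℕ.* (B div q ℕ.+ 1)) (ℕ.*-identityʳ d)
          (length-common-zeros pt d (isForm-sheared c F) (p ∷ []) (pr ∷ []) (∣U⇒∤a pr i₀ j (ℕ.∣-trans p∣q q∣i₀) ∷ []) Good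
            (λ {i} ((_ , ci) , q∣i) → (∣U⇒∤y pr i j ci (ℕ.∣-trans p∣q q∣i) , ∣U⇒∣value i j (ℕ.∣-trans p∣q q∣i)) ∷ [])
            class L uL good)

    -- Bounds the determinant of any two points of the box: it is a difference of two natural
    -- numbers, each at most D.
    D : ℕ
    D = M ℕ.* (suc K ℕ.* B) ℕ.* (M ℕ.* B)

    Good : ℕ → ℕ → ℕ → ℕ × ℕ → Set
    Good z S w (i , j) = i < B × j < B × Coprime (x i) (suc j) × U i j ≡ w × smooth (suc z) w < S

    -- Points proportional modulo each of the boundedly many prime factors of the
    -- rough part of w are proportional modulo the rough part itself; it exceeds
    -- their determinant, which therefore vanishes.
    length-fibre : ∀ z S t → 2 ℕ.* abs a ℕ.* S ℕ.* D < B ℕ.^ d → V ℕ.* B ℕ.^ d < suc z ℕ.^ suc t →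
      ∀ w L → Unique L → All (Good z S w) L → length L ≤ d ℕ.^ t
    length-fibre z S t small few w [] uL good = z≤n
    length-fibre z S t small few w L@((i₀ , j₀) ∷ _) uL good@((i₀<B , j₀<B , c₀ , U≡w , s<S) ∷ _) = begin
      length L  ≤⟨ length-common-zeros point d (isForm-sheared c F) ps (roughFactors-prime (suc z) w)
            (All.tabulate λ {p} p∈ → ∣U⇒∤a (prime∈ p∈) i₀ j₀ (subst (p ℕ.∣_) (sym U≡w) (∈⇒∣w p∈)))
            (Good z S w) zeros class L uL good ⟩
      d ℕ.^ length ps ℕ.* 1  ≡⟨ ℕ.*-identityʳ (d ℕ.^ length ps) ⟩
      d ℕ.^ length ps  ≤⟨ ℕ.^-monoʳ-≤ d length≤t ⟩
      d ℕ.^ t  ∎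
      where
      open ℕ.≤-Reasoning
      -- Repeated primes stay in the list; the bound t on its length allows for them.
      ps = roughFactors (suc z) w
      q = rough (suc z) w
      instance
        w≢0 : NonZero w
        w≢0 = subst NonZero U≡w (U≢0 {i₀} j₀<B)
        q≢0 : NonZero q
        q≢0 = ℕ.>-nonZero (rough≥1 (suc z) w)
      prime∈ : ∀ {p} → p ∈ ps → Prime p
      prime∈ = All.lookup (roughFactors-prime (suc z) w)
      ∈⇒∣q : ∀ {p qs} → p ∈ qs → p ℕ.∣ product qs
      ∈⇒∣q {p} {q ∷ qs} (here refl) = ℕ.m∣m*n (product qs)
      ∈⇒∣q {p} {q ∷ qs} (there p∈)  = ℕ.∣n⇒∣m*n q (∈⇒∣q p∈)
      ∈⇒∣w : ∀ {p} → p ∈ ps → p ℕ.∣ w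
      ∈⇒∣w p∈ = ℕ.∣-trans (∈⇒∣q p∈) (rough∣ (suc z) w)
      D<q : D < q
      D<q = ℕ.≰⇒> λ q≤D → ℕ.<-irrefl refl (begin-strict
        B ℕ.^ d  ≤⟨ U-lower {i₀} j₀<B ⟩
        2 ℕ.* abs a ℕ.* U i₀ j₀  ≡⟨ cong (2 ℕ.* abs a ℕ.*_) (trans U≡w (sym (smooth*rough (suc z) w))) ⟩
        2 ℕ.* abs a ℕ.* (smooth (suc z) w ℕ.* q)  ≤⟨ ℕ.*-monoʳ-≤ (2 ℕ.* abs a) (ℕ.*-mono-≤ (ℕ.<⇒≤ s<S) q≤D) ⟩
        2 ℕ.* abs a ℕ.* (S ℕ.* D)  ≡⟨ ℕ.*-assoc (2 ℕ.* abs a) S D ⟨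
        2 ℕ.* abs a ℕ.* S ℕ.* D  <⟨ small ⟩
        B ℕ.^ d  ∎)
      length≤t : length ps ≤ t
      length≤t = ℕ.≮⇒≥ λ t<l → ℕ.<-irrefl refl (begin-strict
        V ℕ.* B ℕ.^ d  <⟨ few ⟩
        suc z ℕ.^ suc t  ≤⟨ ℕ.^-monoʳ-≤ (suc z) t<l ⟩
        suc z ℕ.^ length ps  ≤⟨ product-≥^ (suc z) (roughFactors-≥ (suc z) w) ⟩
        q  ≤⟨ ℕ.∣⇒≤ (rough∣ (suc z) w) ⟩
        w  ≡⟨ U≡w ⟨
        U i₀ j₀  ≤⟨ U-upper i₀<B j₀<B ⟩
        V ℕ.* B ℕ.^ d  ∎)
      zeros : ∀ {P} → Good z S w P → All (λ p → ¬ (+ p ℤ.∣ proj₂ (point P)) × (+ p ℤ.∣ sheared c F (proj₁ (point P)) (proj₂ (point P)))) ps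
      zeros {i , j} (_ , _ , cP , U≡w , _) = All.tabulate λ {p} p∈ →
        let p∣U = subst (p ℕ.∣_) (sym U≡w) (∈⇒∣w p∈) in ∣U⇒∤y (prime∈ p∈) i j cP p∣U , ∣U⇒∣value i j p∣U

      equal : ∀ P Q → Good z S w P → Good z S w Q → All (λ p → + p ℤ.∣ point P ∧ point Q) ps → P ≡ Q
      equal P@(i , j) Q@(i′ , j′) (i<B , j<B , cP , UP , _) (i′<B , j′<B , cQ , UQ , _) pairs = cong₂ _,_ i≡i′ j≡j′
        where
        q∣∧ : + q ℤ.∣ point P ∧ point Q
        q∣∧ = ∣-∧-points q P Q cP cQ (subst (q ℕ.∣_) (sym UP) (rough∣ (suc z) w)) (subst (q ℕ.∣_) (sym UQ) (rough∣ (suc z) w))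
          λ p pr p∣q → All.lookup pairs (factorisationHasAllPrimeFactors pr p∣q (roughFactors-prime (suc z) w))
        ∧≤D : abs (point P ∧ point Q) ≤ D
        ∧≤D = subst (λ e → abs e ≤ D) (cong₂ ℤ._-_ (ℤ.pos-* (x i) (y j′)) (ℤ.pos-* (x i′) (y j)))
          (abs-difference-≤ (ℕ.*-mono-≤ (x≤ i<B) (y≤ j′<B)) (ℕ.*-mono-≤ (x≤ i′<B) (y≤ j<B)))
        parallel : x i ℕ.* y j′ ≡ x i′ ℕ.* y j
        parallel = ℤ.+-injective (trans (ℤ.pos-* (x i) (y j′)) (trans
          (ℤ.i-j≡0⇒i≡j (+ x i ℤ.* + y j′) (+ x i′ ℤ.* + y j) (∣∧<⇒≡0 q∣∧ (ℕ.≤-<-trans ∧≤D D<q)))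
          (sym (ℤ.pos-* (x i′) (y j)))))
        regroup : ∀ x m s → m ℕ.* (x ℕ.* s) ≡ x ℕ.* (m ℕ.* s)
        regroup = ℕ.solve-∀
        reduced : x i ℕ.* suc j′ ≡ x i′ ℕ.* suc j
        reduced = ℕ.*-cancelˡ-≡ _ _ M {{ℕ.>-nonZero M≥1}}
          (trans (regroup (x i) M (suc j′)) (trans parallel (sym (regroup (x i′) M (suc j)))))
        -- The fractions x / (j + 1) are equal and in lowest terms, so their numerators agree.
        x≡x′ : x i ≡ x i′
        x≡x′ = ℕ.∣-antisym
          (coprime-divisor cP (subst (x i ℕ.∣_) (trans reduced (ℕ.*-comm (x i′) (suc j))) (ℕ.m∣m*n (suc j′))))
          (coprime-divisor cQ (subst (x i′ ℕ.∣_) (trans (sym reduced) (ℕ.*-comm (x i) (suc j′))) (ℕ.m∣m*n (suc j))))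
        i≡i′ : i ≡ i′
        i≡i′ = ℕ.+-cancelˡ-≡ (K ℕ.* B) i i′ (ℕ.*-cancelˡ-≡ _ _ M {{ℕ.>-nonZero M≥1}} (ℕ.suc-injective x≡x′))
        j≡j′ : j ≡ j′
        j≡j′ = ℕ.suc-injective (ℕ.*-cancelˡ-≡ (suc j) (suc j′) (x i) (trans (cong (ℕ._* suc j) x≡x′) (sym reduced)))

      class : ∀ L → Unique L → All (Good z S w) L → (∀ {P Q} → P ∈ L → Q ∈ L → All (λ p → + p ℤ.∣ point P ∧ point Q) ps) → length L ≤ 1
      class []      uL good pairs = z≤n
      class (P ∷ []) uL good pairs = s≤s z≤n
      class (P ∷ Q ∷ L) ((P≢Q ∷ _) ∷ _) (gP ∷ gQ ∷ _) pairs =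
        ⊥-elim (P≢Q (equal P Q gP gQ (pairs (here refl) (there (here refl)))))

-- Union bounds, fibres, and sums over divisors.

module Counting where
  open SmoothParts hiding (*-^)
  open Lagrange using (length-filter-split)
  open import Data.Nat.Base
  open import Data.Nat.Properties
  open import Data.Nat.Divisibility
  open import Data.Nat.DivMod using (m/n*n≤m; m*n/n≡m; m<n*o⇒m/o<n; /-monoˡ-≤)
  open import Data.Nat.Tactic.RingSolver using (solve-∀)
  open import Data.List.Base using ([]; _∷_; length; filter; map)
  open import Data.List.Membership.Propositional using (_∈_)
  open import Data.List.Relation.Unary.All as All using (All; []; _∷_)
  open import Data.List.Relation.Unary.All.Properties using (filter⁺; all-filter)
  open import Data.List.Relation.Unary.Any using (here; there)
  open import Data.List.Relation.Unary.Unique.Propositional using (Unique)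
  import Data.List.Relation.Unary.Unique.Propositional.Properties as Unique
  open import Data.Product.Base using (∃; _×_; _,_)
  open import Data.Empty using (⊥-elim)
  open import Function.Base using (_∘_)
  open import Level using (0ℓ)
  open import Relation.Nullary using (Dec; ¬_; yes; no)
  open import Relation.Nullary.Decidable using (¬?)
  open import Relation.Unary using (Pred; Decidable)
  open import Relation.Binary.Definitions using (DecidableEquality)
  open import Relation.Binary.PropositionalEquality

  Σ<-0 : ∀ n → Σ< n (λ _ → 0) ≡ 0
  Σ<-0 n = trans (Σ<-const n 0) (*-zeroʳ n)

  Σ<-swap : ∀ m n (f : ℕ → ℕ → ℕ) → Σ< m (λ j → Σ< n (λ g → f g j)) ≡ Σ< n (λ g → Σ< m (f g))
  Σ<-swap zero    n f = sym (Σ<-0 n)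
  Σ<-swap (suc m) n f = trans (cong (_+ Σ< n (λ g → f g m)) (Σ<-swap m n f)) (sym (Σ<-+ n (λ g → Σ< m (f g)) (λ g → f g m)))

  term≤Σ< : ∀ n f {g} → g < n → f g ≤ Σ< n f
  term≤Σ< (suc n) f {g} g<1+n with g ≟ n
  ... | yes refl = m≤n+m (f n) (Σ< n f)
  ... | no g≢n   = ≤-trans (term≤Σ< n f (≤∧≢⇒< (s≤s⁻¹ g<1+n) g≢n)) (m≤m+n (Σ< n f) (f n))

  -- The union bound, for predicates that together cover P.
  length-filter-cover : ∀ {A : Set} {P : Pred A 0ℓ} {T : ℕ → Pred A 0ℓ} (P? : Decidable P) (T? : ∀ g → Decidable (T g)) n →
    (∀ a → P a → ∃ λ g → g < n × T g a) → ∀ L → length (filter P? L) ≤ Σ< n (λ g → length (filter (T? g) L))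
  length-filter-cover P? T? n cover [] = z≤n
  length-filter-cover P? T? n cover (a ∷ L) = begin
    length (filter P? (a ∷ L))
      ≤⟨ step ⟩
    Σ< n (λ g → ⟦ T? g a ⟧) + length (filter P? L)
      ≤⟨ +-monoʳ-≤ (Σ< n (λ g → ⟦ T? g a ⟧)) (length-filter-cover P? T? n cover L) ⟩
    Σ< n (λ g → ⟦ T? g a ⟧) + Σ< n (λ g → length (filter (T? g) L))
      ≡⟨ Σ<-+ n (λ g → ⟦ T? g a ⟧) (λ g → length (filter (T? g) L)) ⟨
    Σ< n (λ g → ⟦ T? g a ⟧ + length (filter (T? g) L))
      ≡⟨ Σ<-cong n filter-∷ ⟨
    Σ< n (λ g → length (filter (T? g) (a ∷ L))) ∎
    where
    open ≤-Reasoning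
    filter-∷ : ∀ g → length (filter (T? g) (a ∷ L)) ≡ ⟦ T? g a ⟧ + length (filter (T? g) L)
    filter-∷ g with T? g a
    ... | yes _ = refl
    ... | no _  = refl
    step : length (filter P? (a ∷ L)) ≤ Σ< n (λ g → ⟦ T? g a ⟧) + length (filter P? L)
    step with P? a
    ... | no _  = m≤n+m (length (filter P? L)) (Σ< n (λ g → ⟦ T? g a ⟧))
    ... | yes Pa with g , g<n , Tga ← cover a Pa =
      +-monoˡ-≤ (length (filter P? L)) (≤-trans (≤-reflexive (sym (⟦⟧-true (T? g a) Tga))) (term≤Σ< n (λ g → ⟦ T? g a ⟧) g<n))

  length-filter-none : ∀ {A : Set} {P : Pred A 0ℓ} (P? : Decidable P) L → (∀ a → ¬ P a) → length (filter P? L) ≡ 0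
  length-filter-none P? []      none = refl
  length-filter-none P? (a ∷ L) none with P? a
  ... | yes Pa = ⊥-elim (none a Pa)
  ... | no _   = length-filter-none P? L none

  -- The list is split by its values in W, one fibre at a time. Q carries the property of the points
  -- under which a fibre is known to be small.
  length-fibres : ∀ {A B : Set} {Q : Pred A 0ℓ} (_≟ᴮ_ : DecidableEquality B) (v : A → B) m →
    (∀ w L → Unique L → All (λ a → Q a × v a ≡ w) L → length L ≤ m) →
    ∀ W L → Unique L → All Q L → All (λ a → v a ∈ W) L → length L ≤ length W * m
  length-fibres _≟ᴮ_ v m fibre []      []      uL qL        []       = z≤n
  length-fibres _≟ᴮ_ v m fibre (w ∷ W) L       uL qL        ∈W       = begin
    length L
      ≡⟨ length-filter-split here? L ⟩
    length (filter here? L) + length (filter (¬? ∘ here?) L)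
      ≤⟨ +-mono-≤
           (fibre w (filter here? L) (Unique.filter⁺ here? uL) (All.zip (filter⁺ here? qL , all-filter here? L)))
           (length-fibres _≟ᴮ_ v m fibre W (filter (¬? ∘ here?) L) (Unique.filter⁺ (¬? ∘ here?) uL) (filter⁺ (¬? ∘ here?) qL)
             (All.map elsewhere (All.zip (filter⁺ (¬? ∘ here?) ∈W , all-filter (¬? ∘ here?) L)))) ⟩
    m + length W * m ∎
    where
    open ≤-Reasoning
    here? : Decidable (λ a → v a ≡ w)
    here? a = v a ≟ᴮ w
    elsewhere : ∀ {a} → v a ∈ w ∷ W × v a ≢ w → v a ∈ W
    elsewhere (here eq  , v≢w) = ⊥-elim (v≢w eq)
    elsewhere (there ∈W , _)   = ∈W

  Σ-indicator-∣ : ∀ g B → Σ< B (λ j → ⟦ g ∣? suc j ⟧) ≤ B div g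
  Σ-indicator-∣ g zero    = z≤n
  Σ-indicator-∣ zero (suc B) rewrite ⟦⟧-false (0 ∣? suc B) (λ 0∣ → 1+n≢0 (0∣⇒≡0 0∣)) =
    ≤-trans (≤-reflexive (+-identityʳ _)) (Σ-indicator-∣ zero B)
  Σ-indicator-∣ (suc g) (suc B) = by-cases (suc g ∣? suc B)
    where
    open ≤-Reasoning
    by-cases : (∣B? : Dec (suc g ∣ suc B)) → Σ< B (λ j → ⟦ suc g ∣? suc j ⟧) + ⟦ ∣B? ⟧ ≤ suc B / suc g
    by-cases (no _) = begin
      Σ< B (λ j → ⟦ suc g ∣? suc j ⟧) + 0  ≡⟨ +-identityʳ _ ⟩
      Σ< B (λ j → ⟦ suc g ∣? suc j ⟧)  ≤⟨ Σ-indicator-∣ (suc g) B ⟩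
      B / suc g  ≤⟨ /-monoˡ-≤ (suc g) (n≤1+n B) ⟩
      suc B / suc g  ∎
    by-cases (yes (divides q eq)) = begin
      Σ< B (λ j → ⟦ suc g ∣? suc j ⟧) + 1  ≤⟨ +-monoˡ-≤ 1 (Σ-indicator-∣ (suc g) B) ⟩
      B / suc g + 1  ≡⟨ +-comm (B / suc g) 1 ⟩
      suc (B / suc g)  ≤⟨ m<n*o⇒m/o<n (≤-reflexive eq) ⟩
      q  ≡⟨ m*n/n≡m q (suc g) ⟨
      q * suc g / suc g  ≡⟨ cong (_/ suc g) eq ⟨
      suc B / suc g  ∎

  div*≤ : ∀ B g → (B div g) * g ≤ B
  div*≤ B zero    = z≤n
  div*≤ B (suc g) = m/n*n≤m B (suc g)

  -- Σ_{g > 4} 1/g² ≤ 1/4, by comparison with the telescoping series of 1/(g - 1) - 1/g.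
  Σ-square-div : ∀ B m → Σ< (suc (4 + m)) (λ g → ⟦ 5 ≤? g ⟧ * (B div g * (B div g))) * (4 * (4 + m)) ≤ B * B * m
  Σ-square-div B zero    = z≤n
  Σ-square-div B (suc m) = *-cancelˡ-≤ n (begin
    n * ((S + (q * q + 0)) * (4 * suc n))
      ≡⟨ expand n S q ⟩
    suc n * (S * (4 * n)) + 4 * (q * suc n * (q * n))
      ≤⟨ +-mono-≤ (*-monoʳ-≤ (suc n) (Σ-square-div B m))
           (*-monoʳ-≤ 4 (*-mono-≤ (div*≤ B (suc n)) (≤-trans (*-monoʳ-≤ q (n≤1+n n)) (div*≤ B (suc n))))) ⟩
    suc n * (B * B * m) + 4 * (B * B)
      ≡⟨ collect m B ⟩
    n * (B * B * suc m) ∎)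
    where
    open ≤-Reasoning
    n = 4 + m
    q = B div suc n
    S = Σ< (suc n) (λ g → ⟦ 5 ≤? g ⟧ * (B div g * (B div g)))
    expand : ∀ n S q → n * ((S + (q * q + 0)) * (4 * suc n)) ≡ suc n * (S * (4 * n)) + 4 * (q * suc n * (q * n))
    expand = solve-∀
    collect : ∀ m B → suc (4 + m) * (B * B * m) + 4 * (B * B) ≡ (4 + m) * (B * B * suc m)
    collect = solve-∀

  4*Σ-square-div : ∀ B m → 4 * Σ< (suc (4 + m)) (λ g → ⟦ 5 ≤? g ⟧ * (B div g * (B div g))) ≤ B * B
  4*Σ-square-div B m = *-cancelʳ-≤ _ _ (4 + m) (begin
    4 * S * (4 + m)  ≡⟨ regroup S (4 + m) ⟩
    S * (4 * (4 + m))  ≤⟨ Σ-square-div B m ⟩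
    B * B * m  ≤⟨ *-monoʳ-≤ (B * B) (m≤n+m m 4) ⟩
    B * B * (4 + m)  ∎)
    where
    open ≤-Reasoning
    S = Σ< (suc (4 + m)) (λ g → ⟦ 5 ≤? g ⟧ * (B div g * (B div g)))
    regroup : ∀ S n → 4 * S * n ≡ S * (4 * n)
    regroup = solve-∀

-- At least half of the points of the box are coprime.

module CoprimePairs where
  open PrimeDivisors
  open FormCalculus using (∂-resultant)
  open SmoothParts hiding (*-^)
  open Lagrange using (length-filter-split)
  open Box
  open UniqueLists
  open Representations
  open Counting
  open import Data.Nat.Base
  open import Data.Nat.Properties
  open import Data.Nat.Divisibility
  open import Data.Nat.Coprimality using (Coprime; coprime?; gcd≡1⇒coprime)
  open import Data.Nat.GCD using (gcd; gcd[m,n]∣m; gcd[m,n]∣n)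
  open import Data.Nat.Primality using (Prime; ¬prime[1])
  open import Data.Nat.Tactic.RingSolver using (solve-∀)
  open import Data.Integer.Base as ℤ using (ℤ; 0ℤ; 1ℤ)
  import Data.Integer.Divisibility.Signed as ℤ
  import Data.Integer.Properties as ℤ
  open import Data.List.Base using (List; length; filter; upTo)
  open import Data.List.Properties using (length-upTo)
  open import Data.List.Membership.Propositional.Properties using (∈-upTo⁻)
  open import Data.List.Relation.Unary.All as All using (All)
  open import Data.List.Relation.Unary.All.Properties using (filter⁺; all-filter)
  open import Data.List.Relation.Unary.Unique.Propositional using (Unique)
  import Data.List.Relation.Unary.Unique.Propositional.Properties as Unique
  open import Data.Product.Base using (∃; _×_; _,_; proj₁; proj₂)
  open import Data.Empty using (⊥-elim)
  open import Function.Base using (_∘_)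
  open import Relation.Nullary using (¬_; yes; no)
  open import Relation.Nullary.Decidable using (¬?; _×-dec_)
  open import Relation.Unary using (Decidable)
  open import Relation.Binary.PropositionalEquality

  module Rows {n} (F : Form ℤ (suc (suc n))) (c : ℤ)
              (a≢0 : eval F 1ℤ c ≢ 0ℤ) (R≢0 : ∂-resultant F ≢ 0ℤ) (B : ℕ) (B≥1 : 1 ≤ B) where
    open Points F c a≢0 R≢0
    open InBox B B≥1
    open Bounds F c a≢0 R≢0 B B≥1

    coprimeRow? : ∀ j → Decidable (λ i → Coprime (x i) (suc j))
    coprimeRow? j i = coprime? (x i) (suc j)

    coprimeRow : ℕ → List ℕ
    coprimeRow j = filter (coprimeRow? j) (upTo B)

    upTo-< : All (_< B) (upTo B)
    upTo-< = All.tabulate ∈-upTo⁻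

    coprimeRow-unique : ∀ j → Unique (coprimeRow j)
    coprimeRow-unique j = Unique.filter⁺ (coprimeRow? j) (Unique.upTo⁺ B)

    coprimeRow-inRow : ∀ j → All (InRow j) (coprimeRow j)
    coprimeRow-inRow j = All.zip (filter⁺ (coprimeRow? j) upTo-< , all-filter (coprimeRow? j) (upTo B))

    -- From 5 on, the sum of 1/g² is at most 1/4; the divisors 2, 3 and 4 do not occur, as x ≡ 1
    -- modulo 12.
    CommonDivisor : ℕ → ℕ → ℕ → Set
    CommonDivisor j g i = 5 ≤ g × g ∣ x i × g ∣ suc j

    commonDivisor? : ∀ j g → Decidable (CommonDivisor j g)
    commonDivisor? j g i = (5 ≤? g) ×-dec (g ∣? x i) ×-dec (g ∣? suc j)

    12∣M : 12 ∣ M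
    12∣M = ∣n⇒∣m*n (ℤ.∣ a ∣) (∣n⇒∣m*n (ℤ.∣ a ∣) (∣n⇒∣m*n (ℤ.∣ ∂-resultant F ∣) ∣-refl))

    ∣x⇒≥5 : ∀ g i → g ∣ x i → g ≢ 1 → 5 ≤ g
    ∣x⇒≥5 0 i g∣x g≢1 with () ← 0∣⇒≡0 g∣x
    ∣x⇒≥5 1 i g∣x g≢1 = ⊥-elim (g≢1 refl)
    ∣x⇒≥5 2 i g∣x g≢1 = ⊥-elim (g≢1 (∣x⇒∤M i g∣x (∣-trans (divides 6 refl) 12∣M)))
    ∣x⇒≥5 3 i g∣x g≢1 = ⊥-elim (g≢1 (∣x⇒∤M i g∣x (∣-trans (divides 4 refl) 12∣M)))
    ∣x⇒≥5 4 i g∣x g≢1 = ⊥-elim (g≢1 (∣x⇒∤M i g∣x (∣-trans (divides 3 refl) 12∣M)))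
    ∣x⇒≥5 (suc (suc (suc (suc (suc g))))) i g∣x g≢1 = s≤s (s≤s (s≤s (s≤s (s≤s z≤n))))

    -- The greatest common divisor serves as `g`. The range up to 4 + B is the one summed in
    -- `4*Σ-square-div`.
    commonDivisor : ∀ {j} → j < B → ∀ i → ¬ Coprime (x i) (suc j) → ∃ λ g → g < suc (4 + B) × CommonDivisor j g i
    commonDivisor {j} j<B i ¬coprime =
      g , s≤s (≤-trans (∣⇒≤ g∣j) (≤-trans j<B (m≤n+m B 4))) , ∣x⇒≥5 g i g∣x (¬coprime ∘ gcd≡1⇒coprime) , g∣x , g∣j
      where
      g = gcd (x i) (suc j)
      g∣x = gcd[m,n]∣m (x i) (suc j)
      g∣j = gcd[m,n]∣n (x i) (suc j)

    -- The x i form an arithmetic progression with difference M, and a divisor g of some x i is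
    -- prime to M; so the indices lie in one class modulo g.
    length-∣x : ∀ g L → 1 ≤ g → Unique L → All (λ i → i < B × g ∣ x i) L → length L ≤ B div g + 1
    length-∣x g L g≥1 uL gL = length-residue-class g {{>-nonZero g≥1}} B L uL (All.map proj₁ gL) λ {i} {i′} i∈ i′∈ →
      let g∣x = proj₂ (All.lookup gL i∈) ; g∣x′ = proj₂ (All.lookup gL i′∈) in
      ∣-*-cancel g {{>-nonZero g≥1}} (ℤ.+ i ℤ.- ℤ.+ i′) (ℤ.+ M)
        (∣-cong (trans (x-difference i i′) (ℤ.*-comm (ℤ.+ M) (ℤ.+ i ℤ.- ℤ.+ i′))) (ℤ.∣m∣n⇒∣m-n {m = ℤ.+ x i} {n = ℤ.+ x i′} (ℤ.∣ᵤ⇒∣ g∣x) (ℤ.∣ᵤ⇒∣ g∣x′)))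
        (λ p pr p∣g p∣M → ¬prime[1] (subst Prime (∣x⇒∤M i (∣-trans p∣g g∣x) (ℤ.∣⇒∣ᵤ p∣M)) pr))

    weight : ℕ → ℕ
    weight g = ⟦ 5 ≤? g ⟧ * (B div g + 1)

    length-commonDivisor : ∀ j g → length (filter (commonDivisor? j g) (upTo B)) ≤ ⟦ g ∣? suc j ⟧ * weight g
    length-commonDivisor j g = by-cases (5 ≤? g) (g ∣? suc j)
      where
      open import Relation.Nullary using (Dec)
      L = filter (commonDivisor? j g) (upTo B)
      by-cases : (g≥5? : Dec (5 ≤ g)) (g∣j? : Dec (g ∣ suc j)) → length L ≤ ⟦ g∣j? ⟧ * (⟦ g≥5? ⟧ * (B div g + 1))
      by-cases (no g≱5)  _         = ≤-trans (≤-reflexive (length-filter-none (commonDivisor? j g) (upTo B) (λ _ → g≱5 ∘ proj₁))) z≤n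
      by-cases (yes _)   (no g∤j)  = ≤-trans (≤-reflexive (length-filter-none (commonDivisor? j g) (upTo B) (λ _ → g∤j ∘ proj₂ ∘ proj₂))) z≤n
      by-cases (yes g≥5) (yes _)   = ≤-trans
        (length-∣x g L (≤-trans (s≤s z≤n) g≥5) (Unique.filter⁺ (commonDivisor? j g) (Unique.upTo⁺ B))
          (All.zip (filter⁺ (commonDivisor? j g) upTo-< , All.map (λ z → proj₁ (proj₂ z)) (all-filter (commonDivisor? j g) (upTo B)))))
        (≤-reflexive (sym (trans (+-identityʳ _) (+-identityʳ _))))

    length-noncoprime : ∀ j → j < B → B ≤ length (coprimeRow j) + Σ< (suc (4 + B)) (λ g → ⟦ g ∣? suc j ⟧ * weight g)
    length-noncoprime j j<B = begin
      B
        ≡⟨ length-upTo B ⟨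
      length (upTo B)
        ≡⟨ length-filter-split (coprimeRow? j) (upTo B) ⟩
      length (coprimeRow j) + length (filter (¬? ∘ coprimeRow? j) (upTo B))
        ≤⟨ +-monoʳ-≤ (length (coprimeRow j)) (length-filter-cover (¬? ∘ coprimeRow? j) (commonDivisor? j) (suc (4 + B)) (commonDivisor j<B) (upTo B)) ⟩
      length (coprimeRow j) + Σ< (suc (4 + B)) (λ g → length (filter (commonDivisor? j g) (upTo B)))
        ≤⟨ +-monoʳ-≤ (length (coprimeRow j)) (Σ<-mono (suc (4 + B)) (λ g _ → length-commonDivisor j g)) ⟩
      length (coprimeRow j) + Σ< (suc (4 + B)) (λ g → ⟦ g ∣? suc j ⟧ * weight g) ∎
      where open ≤-Reasoning

    -- Over all rows, g accounts for at most ⌊B/g⌋ (⌊B/g⌋ + 1) ≤ 2 ⌊B/g⌋² pairs: the summand 1 is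
    -- absorbed because a nonzero quotient is at least 1. Summing over g ≥ 5 gives B²/2.
    2*noncoprime-≤ : 2 * Σ< B (λ j → Σ< (suc (4 + B)) (λ g → ⟦ g ∣? suc j ⟧ * weight g)) ≤ B * B
    2*noncoprime-≤ = begin
      2 * Σ< B (λ j → Σ< G (λ g → ⟦ g ∣? suc j ⟧ * weight g))
        ≡⟨ cong (2 *_) (Σ<-swap B G (λ g j → ⟦ g ∣? suc j ⟧ * weight g)) ⟩
      2 * Σ< G (λ g → Σ< B (λ j → ⟦ g ∣? suc j ⟧ * weight g))
        ≤⟨ *-monoʳ-≤ 2 (Σ<-mono G (λ g _ → column g)) ⟩
      2 * Σ< G (λ g → 2 * (⟦ 5 ≤? g ⟧ * (B div g * (B div g))))
        ≡⟨ cong (2 *_) (Σ<-* G 2 (λ g → ⟦ 5 ≤? g ⟧ * (B div g * (B div g)))) ⟩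
      2 * (2 * Σ< G (λ g → ⟦ 5 ≤? g ⟧ * (B div g * (B div g))))
        ≡⟨ *-assoc 2 2 (Σ< G (λ g → ⟦ 5 ≤? g ⟧ * (B div g * (B div g)))) ⟨
      4 * Σ< G (λ g → ⟦ 5 ≤? g ⟧ * (B div g * (B div g)))
        ≤⟨ 4*Σ-square-div B B ⟩
      B * B ∎
      where
      open ≤-Reasoning
      G = suc (4 + B)
      q*[q+1]≤ : ∀ q → q * (q + 1) ≤ 2 * (q * q)
      q*[q+1]≤ zero    = z≤n
      q*[q+1]≤ (suc q) = begin
        suc q * (suc q + 1)  ≤⟨ *-monoʳ-≤ (suc q) (+-monoʳ-≤ (suc q) (s≤s z≤n)) ⟩
        suc q * (suc q + suc q)  ≡⟨ lemma (suc q) ⟩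
        2 * (suc q * suc q)  ∎
        where
        lemma : ∀ q → q * (q + q) ≡ 2 * (q * q)
        lemma = solve-∀
      column : ∀ g → Σ< B (λ j → ⟦ g ∣? suc j ⟧ * weight g) ≤ 2 * (⟦ 5 ≤? g ⟧ * (B div g * (B div g)))
      column g = begin
        Σ< B (λ j → ⟦ g ∣? suc j ⟧ * weight g)
          ≡⟨ Σ<-cong B (λ j → *-comm ⟦ g ∣? suc j ⟧ (weight g)) ⟩
        Σ< B (λ j → weight g * ⟦ g ∣? suc j ⟧)
          ≡⟨ Σ<-* B (weight g) (λ j → ⟦ g ∣? suc j ⟧) ⟩
        weight g * Σ< B (λ j → ⟦ g ∣? suc j ⟧)
          ≤⟨ *-monoʳ-≤ (weight g) (Σ-indicator-∣ g B) ⟩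
        ⟦ 5 ≤? g ⟧ * (B div g + 1) * (B div g)
          ≡⟨ lemma ⟦ 5 ≤? g ⟧ (B div g) ⟩
        ⟦ 5 ≤? g ⟧ * (B div g * (B div g + 1))
          ≤⟨ *-monoʳ-≤ ⟦ 5 ≤? g ⟧ (q*[q+1]≤ (B div g)) ⟩
        ⟦ 5 ≤? g ⟧ * (2 * (B div g * (B div g)))
          ≡⟨ lemma′ ⟦ 5 ≤? g ⟧ (B div g) ⟩
        2 * (⟦ 5 ≤? g ⟧ * (B div g * (B div g))) ∎
        where
        lemma : ∀ e q → e * (q + 1) * q ≡ e * (q * (q + 1))
        lemma = solve-∀
        lemma′ : ∀ e q → e * (2 * (q * q)) ≡ 2 * (e * (q * q))
        lemma′ = solve-∀

-- A positive proportion of good points, and the distinct values they take.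

module ManyValues where
  open FormCalculus using (∂-resultant)
  open SmoothParts hiding (*-^)
  open Lagrange using (length-filter-split)
  open Box
  open Representations
  open Counting
  open CoprimePairs
  open import Data.Nat.Base
  open import Data.Nat.Properties
  open import Data.Nat.Divisibility using (_∣?_)
  open import Data.Nat.Coprimality using (Coprime)
  open import Data.Nat.ListAction using (product)
  open import Data.Nat.Tactic.RingSolver using (solve-∀)
  open import Data.Integer.Base as ℤ using (ℤ; 0ℤ; 1ℤ) renaming (∣_∣ to abs)
  import Data.Integer.Properties as ℤ
  open import Data.List.Base using (List; []; _∷_; _++_; length; filter; map; deduplicate)
  open import Data.List.Properties using (length-++; length-map)
  open import Data.List.Membership.Propositional using (_∈_)
  open import Data.List.Membership.Propositional.Properties using (∈-map⁺; ∈-map⁻; ∈-deduplicate⁺; ∈-deduplicate⁻)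
  open import Data.List.Relation.Unary.All as All using (All; []; _∷_)
  open import Data.List.Relation.Unary.All.Properties using (filter⁺; all-filter; map⁺; ++⁺)
  open import Data.List.Relation.Unary.AllPairs using ([]; _∷_)
  open import Data.List.Relation.Unary.Unique.Propositional using (Unique)
  import Data.List.Relation.Unary.Unique.Propositional.Properties as Unique
  import Data.List.Relation.Unary.Unique.DecSetoid.Properties as UniqueDec
  open import Data.Product.Base using (∃; _×_; _,_; proj₂)
  open import Function.Base using (_∘_)
  open import Relation.Nullary using (¬_)
  open import Relation.Nullary.Decidable using (¬?)
  open import Relation.Unary using (Decidable)
  open import Relation.Binary.PropositionalEquality
  open import Relation.Binary.PropositionalEquality.Properties using (decSetoid)

  ^-cancel-≤ : ∀ z → 2 ≤ z → ∀ {m n} → z ^ m ≤ z ^ n → m ≤ n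
  ^-cancel-≤ z z≥2 le = ≮⇒≥ λ n<m → <⇒≱ (^-monoʳ-< z z≥2 n<m) le

  module AtScale {n} (F : Form ℤ (suc (suc n))) (c : ℤ)
                 (a≢0 : eval F 1ℤ c ≢ 0ℤ) (R≢0 : ∂-resultant F ≢ 0ℤ)
                 (z b κ t : ℕ) (z≥2 : 2 ≤ z) (B≥1 : 1 ≤ z * b) where
    B : ℕ
    B = z * b

    open Points F c a≢0 R≢0
    open InBox B B≥1
    open Bounds F c a≢0 R≢0 B B≥1
    open Rows F c a≢0 R≢0 B B≥1

    -- The product of the smooth parts in a row is at most z^(E B): 4 d B in the exponent comes from
    -- `mertens`, and one more B from the error term d κ (z + 1). With S = z^(4E), comparing
    -- exponents leaves at most B/4 bad points.
    E S : ℕ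
    E = suc (4 * d)
    S = z ^ (4 * E)

    -- `small` makes the rough part exceed every determinant, `few` bounds the number of its prime
    -- factors by t, `V<` bounds the valuations by κ, and `dκ≤` absorbs the error term.
    module _ (small : 2 * abs a * S * D < B ^ d) (few : V * B ^ d < suc z ^ suc t)
             (V< : V * B ^ d < 2 ^ κ) (dκ≤ : d * κ * suc z ≤ B) where

      s : ℕ → ℕ → ℕ
      s j i = smooth (suc z) (U i j)

      large? : ∀ j → Decidable (λ i → S ≤ s j i)
      large? j i = S ≤? s j i

      goodRow badRow : ℕ → List ℕ
      goodRow j = filter (¬? ∘ large? j) (coprimeRow j)
      badRow  j = filter (large? j) (coprimeRow j)

      instance
        z≢0 : NonZero z
        z≢0 = >-nonZero (≤-trans (s≤s z≤n) z≥2)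

      4*badRow-≤ : ∀ j → j < B → 4 * length (badRow j) ≤ B
      4*badRow-≤ j j<B = *-cancelˡ-≤ E (^-cancel-≤ z z≥2 (begin
        z ^ (E * (4 * l))  ≡⟨ cong (z ^_) (regroup E l) ⟩
        z ^ (4 * E * l)  ≡⟨ ^-*-assoc z (4 * E) l ⟨
        S ^ l  ≤⟨ markov (λ i → U i j) (s j) S (coprimeRow j) (λ i → smooth≥1 (suc z) (U i j)) ⟩
        product (map (s j) (coprimeRow j))  ≤⟨ product-smooth-≤ (λ i → U i j) z b d κ (coprimeRow j) bounds
            (λ pr k → multiples-in-row pr k j (coprimeRow j) (coprimeRow-unique j) (coprimeRow-inRow j)) ⟩
        z ^ (4 * d * B + d * κ * suc z)  ≤⟨ ^-monoʳ-≤ z (+-monoʳ-≤ (4 * d * B) dκ≤) ⟩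
        z ^ (4 * d * B + B)  ≡⟨ cong (z ^_) (+-comm (4 * d * B) B) ⟩
        z ^ (E * B)  ∎))
        where
        open ≤-Reasoning
        l = length (badRow j)
        regroup : ∀ E l → E * (4 * l) ≡ 4 * E * l
        regroup = solve-∀
        bounds : All (λ i → NonZero (U i j) × U i j < 2 ^ κ) (coprimeRow j)
        bounds = All.map (λ {i} (i<B , _) → U≢0 {i} j<B , ≤-<-trans (U-upper i<B j<B) V<) (coprimeRow-inRow j)

      points : ℕ → List (ℕ × ℕ)
      points zero    = []
      points (suc j) = map (_, j) (goodRow j) ++ points j

      length-points : ∀ m → length (points m) ≡ Σ< m (length ∘ goodRow)
      length-points zero    = refl
      length-points (suc m) = begin
        length (map (_, m) (goodRow m) ++ points m)  ≡⟨ length-++ (map (_, m) (goodRow m)) ⟩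
        length (map (_, m) (goodRow m)) + length (points m)
          ≡⟨ cong₂ _+_ (length-map (_, m) (goodRow m)) (length-points m) ⟩
        length (goodRow m) + Σ< m (length ∘ goodRow)  ≡⟨ +-comm (length (goodRow m)) (Σ< m (length ∘ goodRow)) ⟩
        Σ< m (length ∘ goodRow) + length (goodRow m)  ∎
        where open ≡-Reasoning

      points-< : ∀ m → All (λ P → proj₂ P < m) (points m)
      points-< zero    = []
      points-< (suc m) = ++⁺ (map⁺ (All.universal (λ _ → ≤-refl) (goodRow m))) (All.map m<n⇒m<1+n (points-< m))

      points-unique : ∀ m → Unique (points m)
      points-unique zero    = []
      points-unique (suc m) = Unique.++⁺
        (Unique.map⁺ (λ { refl → refl }) (Unique.filter⁺ (¬? ∘ large? m) (coprimeRow-unique m)))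
        (points-unique m)
        (λ { (∈row , ∈points) → disjoint ∈row ∈points })
        where
        disjoint : ∀ {P} → P ∈ map (_, m) (goodRow m) → ¬ (P ∈ points m)
        disjoint ∈row ∈points with ∈-map⁻ (_, m) ∈row
        ... | i , _ , refl = <-irrefl refl (All.lookup (points-< m) ∈points)

      GoodPoint : ℕ × ℕ → Set
      GoodPoint (i , j) = i < B × j < B × Coprime (x i) (suc j) × s j i < S

      points-good : ∀ m → m ≤ B → All GoodPoint (points m)
      points-good zero    _   = []
      points-good (suc m) m<B = ++⁺
        (map⁺ (All.map good
          (All.zip (filter⁺ (¬? ∘ large? m) (coprimeRow-inRow m) , all-filter (¬? ∘ large? m) (coprimeRow m)))))
        (points-good m (<⇒≤ m<B))
        where
        good : ∀ {i} → InRow m i × ¬ (S ≤ s m i) → GoodPoint (i , m)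
        good ((i<B , coprime) , s≱S) = i<B , m<B , coprime , ≰⇒> s≱S

      -- At most half of the B² points are not coprime, and at most a quarter are coprime with a
      -- large smooth part.
      B²≤4*points : B * B ≤ 4 * length (points B)
      B²≤4*points = +-cancelˡ-≤ (3 * (B * B)) _ _ (begin
        3 * (B * B) + B * B
          ≡⟨ four B ⟩
        4 * (B * B)
          ≡⟨ cong (4 *_) (Σ<-const B B) ⟨
        4 * Σ< B (λ _ → B)
          ≤⟨ *-monoʳ-≤ 4 (Σ<-mono B row) ⟩
        4 * Σ< B (λ j → length (badRow j) + length (goodRow j) + nc j)
          ≡⟨ cong (4 *_) (trans (Σ<-+ B (λ j → length (badRow j) + length (goodRow j)) nc)
               (cong (_+ Σ< B nc) (Σ<-+ B (length ∘ badRow) (length ∘ goodRow)))) ⟩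
        4 * (Σ< B (length ∘ badRow) + Σ< B (length ∘ goodRow) + Σ< B nc)
          ≡⟨ distrib (Σ< B (length ∘ badRow)) (Σ< B (length ∘ goodRow)) (Σ< B nc) ⟩
        4 * Σ< B (length ∘ badRow) + 2 * (2 * Σ< B nc) + 4 * Σ< B (length ∘ goodRow)
          ≤⟨ +-monoˡ-≤ (4 * Σ< B (length ∘ goodRow)) (+-mono-≤ bad (*-monoʳ-≤ 2 2*noncoprime-≤)) ⟩
        B * B + 2 * (B * B) + 4 * Σ< B (length ∘ goodRow)
          ≡⟨ cong (λ l → 3 * (B * B) + 4 * l) (sym (length-points B)) ⟩
        3 * (B * B) + 4 * length (points B) ∎)
        where
        open ≤-Reasoning
        nc : ℕ → ℕ
        nc j = Σ< (suc (4 + B)) (λ g → ⟦ g ∣? suc j ⟧ * weight g)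
        four : ∀ B → 3 * (B * B) + B * B ≡ 4 * (B * B)
        four = solve-∀
        distrib : ∀ b g c → 4 * (b + g + c) ≡ 4 * b + 2 * (2 * c) + 4 * g
        distrib = solve-∀
        row : ∀ j → j < B → B ≤ length (badRow j) + length (goodRow j) + nc j
        row j j<B = subst (λ l → B ≤ l + nc j) (length-filter-split (large? j) (coprimeRow j)) (length-noncoprime j j<B)
        bad : 4 * Σ< B (length ∘ badRow) ≤ B * B
        bad = begin
          4 * Σ< B (length ∘ badRow)  ≡⟨ Σ<-* B 4 (length ∘ badRow) ⟨
          Σ< B (λ j → 4 * length (badRow j))  ≤⟨ Σ<-mono B 4*badRow-≤ ⟩
          Σ< B (λ _ → B)  ≡⟨ Σ<-const B B ⟩
          B * B  ∎

      valueAt : ℕ × ℕ → ℤ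
      valueAt (i , j) = value i j

      -- The value determines U, because its absolute value is |a| U; so `length-fibre` applies.
      length-value-fibre : ∀ w L → Unique L → All (λ P → GoodPoint P × valueAt P ≡ w) L → length L ≤ d ^ t
      length-value-fibre w []            uL good = z≤n
      length-value-fibre w L@((i₀ , j₀) ∷ _) uL good@((_ , v₀≡w) ∷ _) =
        length-fibre z S t small few (U i₀ j₀) L uL (All.map same good)
        where
        same : ∀ {P} → GoodPoint P × valueAt P ≡ w → Good z S (U i₀ j₀) P
        same {i , j} ((i<B , j<B , coprime , s<S) , v≡w) = i<B , j<B , coprime , U≡U₀ , subst (λ m → smooth (suc z) m < S) U≡U₀ s<S
          where
          U≡U₀ : U i j ≡ U i₀ j₀
          U≡U₀ = *-cancelˡ-≡ (U i j) (U i₀ j₀) (abs a) {{>-nonZero (abs≢0 a≢0)}}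
            (trans (sym (abs-value i j)) (trans (cong abs (trans v≡w (sym v₀≡w))) (abs-value i₀ j₀)))

      values : List ℤ
      values = deduplicate ℤ._≟_ (map valueAt (points B))

      values-unique : Unique values
      values-unique = UniqueDec.deduplicate-! (decSetoid ℤ._≟_) (map valueAt (points B))

      B²≤values : B * B ≤ 4 * (length values * d ^ t)
      B²≤values = ≤-trans B²≤4*points (*-monoʳ-≤ 4
        (length-fibres ℤ._≟_ valueAt (d ^ t) length-value-fibre values (points B) (points-unique B) (points-good B ≤-refl)
          (All.tabulate λ P∈ → ∈-deduplicate⁺ ℤ._≟_ (∈-map⁺ valueAt P∈))))

      values-represented : ∀ {m} → m ∈ values → (∃ λ x → ∃ λ y → eval F x y ≡ m) × abs m ≤ V * B ^ d
      values-represented m∈ with ∈-map⁻ valueAt (∈-deduplicate⁻ ℤ._≟_ (map valueAt (points B)) m∈)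
      ... | (i , j) , P∈ , refl =
        let i<B , j<B , _ = All.lookup (points-good B ≤-refl) P∈ in
        (ℤ.+ x i , c ℤ.* ℤ.+ x i ℤ.+ ℤ.+ y j , refl) , value-≤ i<B j<B

-- Choice of the parameters in terms of z.

module Scales where
  open FormCalculus using (∂-resultant)
  open Box using (module Points)
  open Representations using (module Bounds)
  open ManyValues using (module AtScale)
  open import Data.Nat.Base
  open import Data.Nat.Properties
  open import Data.Nat.Tactic.RingSolver using (solve-∀)
  open import Data.Integer.Base as ℤ using (ℤ; 0ℤ; 1ℤ) renaming (∣_∣ to abs)
  open import Data.List.Base using (length)
  open import Data.List.Membership.Propositional using (_∈_)
  open import Data.List.Relation.Unary.Unique.Propositional using (Unique)
  open import Data.Product.Base using (∃; _×_; _,_)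
  open import Relation.Binary.PropositionalEquality

  n<2^n : ∀ n → n < 2 ^ n
  n<2^n zero    = s≤s z≤n
  n<2^n (suc n) = begin-strict
    suc n  <⟨ s≤s (n<2^n n) ⟩
    suc (2 ^ n)  ≤⟨ +-monoˡ-≤ (2 ^ n) (m^n>0 2 n) ⟩
    2 ^ n + 2 ^ n  ≡⟨ cong (2 ^ n +_) (+-identityʳ (2 ^ n)) ⟨
    2 ^ suc n  ∎
    where open ≤-Reasoning

  module _ {n} (F : Form ℤ (suc (suc (suc n)))) (c : ℤ)
           (a≢0 : eval F 1ℤ c ≢ 0ℤ) (R≢0 : ∂-resultant F ≢ 0ℤ) where
    open Points F c a≢0 R≢0

    -- T′ is the exponent of S, and T = 2 T′ makes B = S². With t = T d and V ≤ z one has V B^d ≤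
    -- z^(t+1). C is 2 |a| D / B², and z₀ makes z large against V, C and d (t + 1).
    T′ T t C z₀ : ℕ
    T′ = 4 * suc (4 * d)
    T  = T′ + T′
    t  = T * d
    C  = 2 * abs a * (M * suc K * M)
    z₀ = 2 + (V + C + d * suc t)

    module At (z : ℕ) (z≥z₀ : z₀ ≤ z) where
      open ≤-Reasoning

      z≥2 : 2 ≤ z
      z≥2 = ≤-trans (m≤m+n 2 (V + C + d * suc t)) z≥z₀
      sum≤z : V + C + d * suc t ≤ z
      sum≤z = ≤-trans (m≤n+m (V + C + d * suc t) 2) z≥z₀
      V≤z : V ≤ z
      V≤z = ≤-trans (m≤m+n V C) (≤-trans (m≤m+n (V + C) (d * suc t)) sum≤z)
      C<z : C < z
      C<z = ≤-trans (s≤s (≤-trans (m≤n+m C V) (≤-trans (m≤m+n (V + C) (d * suc t)) (n≤1+n _)))) z≥z₀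
      dt≤z : d * suc t ≤ z
      dt≤z = ≤-trans (m≤n+m (d * suc t) (V + C)) sum≤z

      instance
        z≢0 : NonZero z
        z≢0 = >-nonZero (≤-trans (s≤s z≤n) z≥2)

      -- The crude z < 2^z gives z^(t+1) < 2^κ. This is harmless: d κ (z + 1) ≤ z⁴, far below B.
      b κ : ℕ
      b = z ^ pred T
      κ = z * suc t

      B≥1 : 1 ≤ z * b
      B≥1 = m^n>0 z T

      open AtScale F c a≢0 R≢0 z b κ t z≥2 B≥1
      open Bounds F c a≢0 R≢0 B B≥1 using (D)

      instance
        B≢0 : NonZero B
        B≢0 = >-nonZero B≥1

      B≡S*S : B ≡ S * S
      B≡S*S = ^-distribˡ-+-* z T′ T′

      z≤S : z ≤ S
      z≤S = m≤m*n z (z ^ pred T′) {{m^n≢0 z (pred T′)}}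

      -- The constant is absorbed by C < z ≤ S, and S² B² = B³ remains; this is where d ≥ 3 enters.
      small : 2 * abs a * S * D < B ^ d
      small = begin-strict
        2 * abs a * S * D  ≡⟨ regroup (abs a) S M (suc K) B ⟩
        C * (S * (B * B))  <⟨ *-monoˡ-< (S * (B * B)) {{m*n≢0 S (B * B) {{m^n≢0 z T′}} {{m*n≢0 B B}}}} (<-≤-trans C<z z≤S) ⟩
        S * (S * (B * B))  ≡⟨ *-assoc S S (B * B) ⟨
        S * S * (B * B)  ≡⟨ cong (_* (B * B)) B≡S*S ⟨
        B * (B * B)  ≤⟨ *-monoʳ-≤ B (*-monoʳ-≤ B (m≤m*n B (B ^ n) {{m^n≢0 B n}})) ⟩
        B ^ d  ∎
        where
        regroup : ∀ a S M k B → 2 * a * S * (M * (k * B) * (M * B)) ≡ 2 * a * (M * k * M) * (S * (B * B))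
        regroup = solve-∀

      VB^d≤ : V * B ^ d ≤ z ^ suc t
      VB^d≤ = begin
        V * B ^ d  ≤⟨ *-monoˡ-≤ (B ^ d) V≤z ⟩
        z * B ^ d  ≡⟨ cong (z *_) (^-*-assoc z T d) ⟩
        z ^ suc t  ∎

      few : V * B ^ d < suc z ^ suc t
      few = ≤-<-trans VB^d≤ (^-monoˡ-< (suc t) ≤-refl)

      V< : V * B ^ d < 2 ^ κ
      V< = begin-strict
        V * B ^ d  ≤⟨ VB^d≤ ⟩
        z ^ suc t  <⟨ ^-monoˡ-< (suc t) (n<2^n z) ⟩
        (2 ^ z) ^ suc t  ≡⟨ ^-*-assoc 2 z (suc t) ⟩
        2 ^ κ  ∎

      dκ≤ : d * κ * suc z ≤ B
      dκ≤ = begin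
        d * (z * suc t) * suc z  ≡⟨ regroup d z (suc t) ⟩
        d * suc t * (z * suc z)  ≤⟨ *-mono-≤ dt≤z (*-monoʳ-≤ z suc-z≤) ⟩
        z * (z * (z * z))  ≡⟨ cong (λ y → z * (z * (z * y))) (*-identityʳ z) ⟨
        z ^ 4  ≤⟨ ^-monoʳ-≤ z 4≤T ⟩
        B  ∎
        where
        regroup : ∀ d z s → d * (z * s) * suc z ≡ d * s * (z * suc z)
        regroup = solve-∀
        suc-z≤ : suc z ≤ z * z
        suc-z≤ = begin
          1 + z  ≤⟨ +-monoˡ-≤ z (≤-trans (s≤s z≤n) z≥2) ⟩
          z + z  ≡⟨ cong (z +_) (+-identityʳ z) ⟨
          2 * z  ≤⟨ *-monoˡ-≤ z z≥2 ⟩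
          z * z  ∎
        4≤T : 4 ≤ T
        4≤T = ≤-trans (m≤m*n 4 (suc (4 * d))) (m≤m+n T′ T′)

    many-values : ∀ z → z₀ ≤ z → ∃ λ W → Unique W ×
      (∀ {m} → m ∈ W → (∃ λ x → ∃ λ y → eval F x y ≡ m) × abs m ≤ V * (z ^ T) ^ d) ×
      z ^ T * z ^ T ≤ 4 * (length W * d ^ t)
    many-values z z≥z₀ =
      values small few V< dκ≤ , values-unique small few V< dκ≤ ,
      values-represented small few V< dκ≤ , B²≤values small few V< dκ≤
      where
      open At z z≥z₀
      open AtScale F c a≢0 R≢0 z b κ t z≥2 B≥1

-- Consequences of the nonzero discriminant.

module Nondegeneracy where
  open PrimeDivisors
  open FormCalculus
  open import Data.Nat.Base as ℕ using (ℕ; suc)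
  import Data.Nat.Properties as ℕ
  import Data.Nat.Divisibility as ℕ
  open import Data.Integer.Base using (ℤ; +_; 0ℤ; 1ℤ; -1ℤ; _+_; _*_; _^_)
  open import Data.Integer.Properties using (*-zeroʳ; i*j≡0⇒i≡0∨j≡0; ^-zeroˡ; _≟_)
  open import Data.Integer.Divisibility.Signed
  open import Data.Integer.Tactic.RingSolver using (solve-∀)
  open import Data.Rational.Base as ℚ using (0ℚ)
  import Data.Rational.Properties as ℚ
  open import Data.Vec.Base using (_∷_)
  open import Data.Product.Base using (∃; _,_)
  open import Data.Sum.Base using (inj₂; [_,_]′)
  open import Relation.Nullary using (yes; no)
  open import Relation.Binary.PropositionalEquality

  ∂-resultant≢0 : ∀ {n} (F : Form ℤ (suc (suc n))) → discriminant F ≢ 0ℚ → ∂-resultant F ≢ 0ℤ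
  ∂-resultant≢0 {n} F disc≢0 R≡0 = disc≢0 (trans
    (cong (λ r → (sign * r) ℚ./ (suc (suc n) ℕ.^ n)) (trans (sym (∂-resultant-≡ F)) R≡0))
    (trans (cong (λ z → z ℚ./ (suc (suc n) ℕ.^ n)) (*-zeroʳ sign)) (ℚ.0/n≡0 (suc (suc n) ℕ.^ n))))
    where
    sign = -1ℤ ^ ((suc (suc n) ℕ.* suc n) ℕ./ 2)
    instance _ = ℕ.m^n≢0 (suc (suc n)) n

  -- If the coefficient a of X^d vanishes, then the coefficient b of X^(d-1) Y
  -- does not, and F(1, 2b) = 2b · b · odd.
  nonzero-value : ∀ {n} (F : Form ℤ (suc (suc n))) → ∂-resultant F ≢ 0ℤ → ∃ λ c → eval F 1ℤ c ≢ 0ℤ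
  nonzero-value {n} F@(a ∷ b ∷ G) R≢0 with a ≟ 0ℤ
  ... | no a≢0 = 0ℤ , λ eq → a≢0 (trans (sym at-0) eq)
    where
    lemma : ∀ a f → a * 1ℤ + 0ℤ * f ≡ a
    lemma = solve-∀
    at-0 : eval F 1ℤ 0ℤ ≡ a
    at-0 = trans (cong (λ u → a * u + 0ℤ * eval (b ∷ G) 1ℤ 0ℤ) (^-zeroˡ (suc (suc n)))) (lemma a (eval (b ∷ G) 1ℤ 0ℤ))
  ... | yes a≡0 = c , λ eq → nonzero (trans (sym at-c) eq)
    where
    c = + 2 * b
    g = eval G 1ℤ c
    lemma : ∀ b g → 0ℤ * 1ℤ + + 2 * b * (b * 1ℤ + + 2 * b * g) ≡ + 2 * (b * (b * (1ℤ + + 2 * g)))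
    lemma = solve-∀
    at-c : eval F 1ℤ c ≡ + 2 * (b * (b * (1ℤ + + 2 * g)))
    at-c = trans (cong₂ (λ e u → e * 1ℤ ^ suc (suc n) + c * (b * u + c * g)) a≡0 (^-zeroˡ (suc n)))
             (trans (cong (λ u → 0ℤ * u + c * (b * 1ℤ + c * g)) (^-zeroˡ (suc (suc n)))) (lemma b g))
    ∂X-head : ∀ m {a} → a ≡ 0ℤ → + m * a ≡ 0ℤ
    ∂X-head m refl = *-zeroʳ (+ m)
    b≢0 : b ≢ 0ℤ
    b≢0 b≡0 = R≢0 (0∣⇒≡0 (∣-∂-resultant-heads F 0ℤ
      (∣-cong (sym (∂X-head (suc (suc n)) a≡0)) (divides 0ℤ refl))
      (∣-cong (sym (∂X-head 1 b≡0)) (divides 0ℤ refl))))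
    odd : 1ℤ + + 2 * g ≢ 0ℤ
    odd eq with () ← ℕ.∣1⇒≡1 (∣⇒∣ᵤ (∣m+n∣n⇒∣m {m = 1ℤ} {n = + 2 * g} (∣-cong (sym eq) (divides {+ 2} 0ℤ refl)) (∣m⇒∣m*n g (∣-refl {+ 2}))))
    nonzero : + 2 * (b * (b * (1ℤ + + 2 * g))) ≢ 0ℤ
    nonzero eq with i*j≡0⇒i≡0∨j≡0 (+ 2) eq
    ... | inj₂ eq₁ = [ b≢0 , (λ eq₂ → [ b≢0 , odd ]′ (i*j≡0⇒i≡0∨j≡0 b eq₂)) ]′ (i*j≡0⇒i≡0∨j≡0 b eq₁)

-- Rational substitutions and the clearing of denominators.

module Substitution where
  open import Data.Nat.Base as ℕ using (ℕ; zero; suc)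
  import Data.Nat.Properties as ℕ
  open import Data.Integer.Base as ℤ using (ℤ; +_)
  import Data.Integer.Properties as ℤ
  import Data.Integer.Tactic.RingSolver as ℤ
  open import Data.Rational.Base using (ℚ; mkℚ; 0ℚ; 1ℚ; _+_; _*_; ↥_; ↧ₙ_; toℚᵘ; *≡*)
  open import Data.Rational.Properties
    using (toℚᵘ-injective; toℚᵘ-fromℚᵘ; toℚᵘ-homo-+; toℚᵘ-homo-*; +-*-commutativeRing; _≟_; *-identityˡ; *-assoc)
  open import Data.Rational.Unnormalised.Base as ℚᵘ using (ℚᵘ; mkℚᵘ; _≃_)
  import Data.Rational.Unnormalised.Properties as ℚᵘ
  open import Data.Vec.Base using ([]; _∷_; _∷ʳ_; map)
  open import Data.Product.Base using (∃; _×_; _,_)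
  open import Relation.Nullary.Decidable using (dec⇒maybe)
  open import Relation.Binary.PropositionalEquality
  open import Tactic.RingSolver using (solve-∀)
  open import Tactic.RingSolver.Core.AlmostCommutativeRing using (AlmostCommutativeRing; fromCommutativeRing)
  open import Level using (0ℓ)

  ℚ-ring : AlmostCommutativeRing 0ℓ 0ℓ
  ℚ-ring = fromCommutativeRing +-*-commutativeRing (λ p → dec⇒maybe (0ℚ ≟ p))

  evalℚ : ∀ {d} → Form ℚ d → ℚ → ℚ → ℚ
  evalℚ {zero}  (a ∷ []) x y = a
  evalℚ {suc d} (a ∷ F)  x y = a * x ^ℚ suc d + y * evalℚ F x y

  evalℚ-⊕ : ∀ {d} (F G : Form ℚ d) x y → evalℚ (F ⊕ G) x y ≡ evalℚ F x y + evalℚ G x y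
  evalℚ-⊕ {zero}  (a ∷ []) (b ∷ []) x y = refl
  evalℚ-⊕ {suc d} (a ∷ F) (b ∷ G) x y rewrite evalℚ-⊕ F G x y =
    lemma a b (x ^ℚ suc d) y (evalℚ F x y) (evalℚ G x y)
    where
    lemma : ∀ a b u y f g → (a + b) * u + y * (f + g) ≡ (a * u + y * f) + (b * u + y * g)
    lemma = solve-∀ ℚ-ring

  evalℚ-⊙ : ∀ {d} k (F : Form ℚ d) x y → evalℚ (k ⊙ F) x y ≡ k * evalℚ F x y
  evalℚ-⊙ {zero}  k (a ∷ []) x y = refl
  evalℚ-⊙ {suc d} k (a ∷ F)  x y rewrite evalℚ-⊙ k F x y = lemma k a (x ^ℚ suc d) y (evalℚ F x y)
    where
    lemma : ∀ k a u y f → k * a * u + y * (k * f) ≡ k * (a * u + y * f)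
    lemma = solve-∀ ℚ-ring

  evalℚ-∷ʳ0 : ∀ {d} (F : Form ℚ d) x y → evalℚ (F ∷ʳ 0ℚ) x y ≡ x * evalℚ F x y
  evalℚ-∷ʳ0 {zero}  (a ∷ []) x y = lemma a x y
    where
    lemma : ∀ a x y → a * (x * 1ℚ) + y * 0ℚ ≡ x * a
    lemma = solve-∀ ℚ-ring
  evalℚ-∷ʳ0 {suc d} (a ∷ F)  x y rewrite evalℚ-∷ʳ0 F x y = lemma a x (x ^ℚ suc d) y (evalℚ F x y)
    where
    lemma : ∀ a x u y f → a * (x * u) + y * (x * f) ≡ x * (a * u + y * f)
    lemma = solve-∀ ℚ-ring

  evalℚ-linear· : ∀ {d} p q (F : Form ℚ d) x y → evalℚ (linear· p q F) x y ≡ (p * x + q * y) * evalℚ F x y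
  evalℚ-linear· {d} p q F x y = begin
    evalℚ ((p ⊙ F ∷ʳ 0ℚ) ⊕ (0ℚ ∷ q ⊙ F)) x y
      ≡⟨ evalℚ-⊕ (p ⊙ F ∷ʳ 0ℚ) (0ℚ ∷ q ⊙ F) x y ⟩
    evalℚ (p ⊙ F ∷ʳ 0ℚ) x y + (0ℚ * x ^ℚ suc d + y * evalℚ (q ⊙ F) x y)
      ≡⟨ cong₂ (λ u v → u + (0ℚ * x ^ℚ suc d + y * v)) (trans (evalℚ-∷ʳ0 (p ⊙ F) x y) (cong (x *_) (evalℚ-⊙ p F x y))) (evalℚ-⊙ q F x y) ⟩
    x * (p * evalℚ F x y) + (0ℚ * x ^ℚ suc d + y * (q * evalℚ F x y))
      ≡⟨ lemma p q x y (x ^ℚ suc d) (evalℚ F x y) ⟩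
    (p * x + q * y) * evalℚ F x y ∎
    where
    open ≡-Reasoning
    lemma : ∀ p q x y u f → x * (p * f) + (0ℚ * u + y * (q * f)) ≡ (p * x + q * y) * f
    lemma = solve-∀ ℚ-ring

  evalℚ-linear^ : ∀ p q n x y → evalℚ (linear^ p q n) x y ≡ (p * x + q * y) ^ℚ n
  evalℚ-linear^ p q zero    x y = refl
  evalℚ-linear^ p q (suc n) x y =
    trans (evalℚ-linear· p q (linear^ p q n) x y) (cong ((p * x + q * y) *_) (evalℚ-linear^ p q n x y))

  evalℚ-∘ᶠ : ∀ {d} (F : Form ℚ d) γ x y → let open GL₂ γ in
             evalℚ (F ∘ᶠ γ) x y ≡ evalℚ F (a₁ * x + a₂ * y) (a₃ * x + a₄ * y)
  evalℚ-∘ᶠ {zero}  (a ∷ []) γ x y = refl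
  evalℚ-∘ᶠ {suc d} (a ∷ F)  γ x y = trans
    (evalℚ-⊕ (a ⊙ linear^ a₁ a₂ (suc d)) (linear· a₃ a₄ (F ∘ᶠ γ)) x y)
    (cong₂ _+_
      (trans (evalℚ-⊙ a (linear^ a₁ a₂ (suc d)) x y) (cong (a *_) (evalℚ-linear^ a₁ a₂ (suc d) x y)))
      (trans (evalℚ-linear· a₃ a₄ (F ∘ᶠ γ) x y) (cong ((a₃ * x + a₄ * y) *_) (evalℚ-∘ᶠ F γ x y))))
    where open GL₂ γ

  *-^ℚ : ∀ s x n → (s * x) ^ℚ n ≡ s ^ℚ n * x ^ℚ n
  *-^ℚ s x zero    = refl
  *-^ℚ s x (suc n) rewrite *-^ℚ s x n = lemma s x (s ^ℚ n) (x ^ℚ n)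
    where
    lemma : ∀ s x u v → s * x * (u * v) ≡ s * u * (x * v)
    lemma = solve-∀ ℚ-ring

  evalℚ-homogeneous : ∀ {d} (F : Form ℚ d) s x y → evalℚ F (s * x) (s * y) ≡ s ^ℚ d * evalℚ F x y
  evalℚ-homogeneous {zero}  (a ∷ []) s x y = sym (*-identityˡ a)
  evalℚ-homogeneous {suc d} (a ∷ F)  s x y rewrite *-^ℚ s x (suc d) | evalℚ-homogeneous F s x y =
    lemma a s (s ^ℚ d) (x ^ℚ suc d) y (evalℚ F x y)
    where
    lemma : ∀ a s u v y f → a * (s * u * v) + s * y * (u * f) ≡ s * u * (a * v + y * f)
    lemma = solve-∀ ℚ-ring

  toℚᵘ-toℚ : ∀ a → toℚᵘ (toℚ a) ≃ mkℚᵘ a 0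
  toℚᵘ-toℚ a = toℚᵘ-fromℚᵘ (mkℚᵘ a 0)

  toℚ-+ : ∀ a b → toℚ (a ℤ.+ b) ≡ toℚ a + toℚ b
  toℚ-+ a b = toℚᵘ-injective (begin
    toℚᵘ (toℚ (a ℤ.+ b))  ≈⟨ toℚᵘ-toℚ (a ℤ.+ b) ⟩
    mkℚᵘ (a ℤ.+ b) 0  ≈⟨ ℚᵘ.*≡* (lemma a b) ⟩
    mkℚᵘ a 0 ℚᵘ.+ mkℚᵘ b 0  ≈⟨ ℚᵘ.+-cong (ℚᵘ.≃-sym (toℚᵘ-toℚ a)) (ℚᵘ.≃-sym (toℚᵘ-toℚ b)) ⟩
    toℚᵘ (toℚ a) ℚᵘ.+ toℚᵘ (toℚ b)  ≈⟨ ℚᵘ.≃-sym (toℚᵘ-homo-+ (toℚ a) (toℚ b)) ⟩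
    toℚᵘ (toℚ a + toℚ b)  ∎)
    where
    open ℚᵘ.≃-Reasoning
    lemma : ∀ a b → (a ℤ.+ b) ℤ.* ℤ.1ℤ ≡ (a ℤ.* ℤ.1ℤ ℤ.+ b ℤ.* ℤ.1ℤ) ℤ.* ℤ.1ℤ
    lemma = ℤ.solve-∀

  toℚ-* : ∀ a b → toℚ (a ℤ.* b) ≡ toℚ a * toℚ b
  toℚ-* a b = toℚᵘ-injective (begin
    toℚᵘ (toℚ (a ℤ.* b))  ≈⟨ toℚᵘ-toℚ (a ℤ.* b) ⟩
    mkℚᵘ (a ℤ.* b) 0  ≈⟨ ℚᵘ.*≡* refl ⟩
    mkℚᵘ a 0 ℚᵘ.* mkℚᵘ b 0  ≈⟨ ℚᵘ.*-cong (ℚᵘ.≃-sym (toℚᵘ-toℚ a)) (ℚᵘ.≃-sym (toℚᵘ-toℚ b)) ⟩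
    toℚᵘ (toℚ a) ℚᵘ.* toℚᵘ (toℚ b)  ≈⟨ ℚᵘ.≃-sym (toℚᵘ-homo-* (toℚ a) (toℚ b)) ⟩
    toℚᵘ (toℚ a * toℚ b)  ∎)
    where open ℚᵘ.≃-Reasoning

  toℚ-injective : ∀ {a b} → toℚ a ≡ toℚ b → a ≡ b
  toℚ-injective {a} {b} eq with ℚᵘ.≃-trans (ℚᵘ.≃-sym (toℚᵘ-toℚ a)) (ℚᵘ.≃-trans (ℚᵘ.≃-reflexive (cong toℚᵘ eq)) (toℚᵘ-toℚ b))
  ... | ℚᵘ.*≡* a*1≡b*1 = trans (sym (ℤ.*-identityʳ a)) (trans a*1≡b*1 (ℤ.*-identityʳ b))

  toℚ-^ : ∀ a n → toℚ (a ℤ.^ n) ≡ toℚ a ^ℚ n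
  toℚ-^ a zero    = refl
  toℚ-^ a (suc n) = trans (toℚ-* a (a ℤ.^ n)) (cong (toℚ a *_) (toℚ-^ a n))

  evalℚ-toℚ : ∀ {d} (F : Form ℤ d) x y → evalℚ (map toℚ F) (toℚ x) (toℚ y) ≡ toℚ (eval F x y)
  evalℚ-toℚ {zero}  (a ∷ []) x y = refl
  evalℚ-toℚ {suc d} (a ∷ F)  x y = sym (trans (toℚ-+ (a ℤ.* x ℤ.^ suc d) (y ℤ.* eval F x y))
    (cong₂ _+_
      (trans (toℚ-* a (x ℤ.^ suc d)) (cong (toℚ a *_) (toℚ-^ x (suc d))))
      (trans (toℚ-* y (eval F x y)) (cong (toℚ y *_) (sym (evalℚ-toℚ F x y))))))

  clear-denominator : ∀ q → toℚ (+ ↧ₙ q) * q ≡ toℚ (↥ q)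
  clear-denominator q@(mkℚ n d-1 _) = toℚᵘ-injective (begin
    toℚᵘ (toℚ (+ suc d-1) * q)  ≈⟨ toℚᵘ-homo-* (toℚ (+ suc d-1)) q ⟩
    toℚᵘ (toℚ (+ suc d-1)) ℚᵘ.* mkℚᵘ n d-1  ≈⟨ ℚᵘ.*-congʳ {mkℚᵘ n d-1} (toℚᵘ-toℚ (+ suc d-1)) ⟩
    mkℚᵘ (+ suc d-1) 0 ℚᵘ.* mkℚᵘ n d-1  ≈⟨ ℚᵘ.*≡* (cross n) ⟩
    mkℚᵘ n 0  ≈⟨ ℚᵘ.≃-sym (toℚᵘ-toℚ n) ⟩
    toℚᵘ (toℚ n)  ∎)
    where
    open ℚᵘ.≃-Reasoning
    cross : ∀ n → + suc d-1 ℤ.* n ℤ.* + 1 ≡ n ℤ.* + suc (d-1 ℕ.+ 0)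
    cross n rewrite ℕ.+-identityʳ d-1 = trans (ℤ.*-identityʳ (+ suc d-1 ℤ.* n)) (ℤ.*-comm (+ suc d-1) n)

  -- With D the product of the denominators of γ, the vector D γ(x, y) is integral, and homogeneity
  -- gives F₁(D γ(x, y)) = D^d F₁(γ(x, y)) = D^d F₂(x, y).
  isomorphic-values : ∀ {d} (F₁ F₂ : Form ℤ d) γ → map toℚ F₁ ∘ᶠ γ ≡ map toℚ F₂ →
    ∃ λ D → ℕ.NonZero D × (∀ x y → ∃ λ X → ∃ λ Y → eval F₁ X Y ≡ (+ D) ℤ.^ d ℤ.* eval F₂ x y)
  isomorphic-values {d} F₁ F₂ γ eq = D , nonZero , represent
    where
    open GL₂ γ
    D₁ D₂ D₃ D₄ D : ℕ
    D₁ = ↧ₙ a₁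
    D₂ = ↧ₙ a₂
    D₃ = ↧ₙ a₃
    D₄ = ↧ₙ a₄
    D = D₁ ℕ.* D₂ ℕ.* (D₃ ℕ.* D₄)
    nonZero : ℕ.NonZero D
    nonZero = ℕ.m*n≢0 (D₁ ℕ.* D₂) (D₃ ℕ.* D₄) {{ℕ.m*n≢0 D₁ D₂}} {{ℕ.m*n≢0 D₃ D₄}}
    δ : ℚ
    δ = toℚ (+ D)
    δ≡ : δ ≡ toℚ (+ D₁) * toℚ (+ D₂) * (toℚ (+ D₃) * toℚ (+ D₄))
    δ≡ = trans (cong toℚ (ℤ.pos-* (D₁ ℕ.* D₂) (D₃ ℕ.* D₄)))
      (trans (toℚ-* (+ (D₁ ℕ.* D₂)) (+ (D₃ ℕ.* D₄)))
        (cong₂ _*_ (trans (cong toℚ (ℤ.pos-* D₁ D₂)) (toℚ-* (+ D₁) (+ D₂)))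
                   (trans (cong toℚ (ℤ.pos-* D₃ D₄)) (toℚ-* (+ D₃) (+ D₄)))))
    integral : ∀ q E → δ ≡ toℚ E * toℚ (+ ↧ₙ q) → δ * q ≡ toℚ (E ℤ.* ↥ q)
    integral q E δ≡ = begin
      δ * q  ≡⟨ cong (_* q) δ≡ ⟩
      toℚ E * toℚ (+ ↧ₙ q) * q  ≡⟨ *-assoc (toℚ E) (toℚ (+ ↧ₙ q)) q ⟩
      toℚ E * (toℚ (+ ↧ₙ q) * q)  ≡⟨ cong (toℚ E *_) (clear-denominator q) ⟩
      toℚ E * toℚ (↥ q)  ≡⟨ toℚ-* E (↥ q) ⟨
      toℚ (E ℤ.* ↥ q)  ∎
      where open ≡-Reasoning
    cofactor : ∀ E₁ E₂ E₃ e → δ ≡ toℚ E₁ * (toℚ E₂ * toℚ E₃) * e → δ ≡ toℚ (E₁ ℤ.* (E₂ ℤ.* E₃)) * e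
    cofactor E₁ E₂ E₃ e eq = trans eq (cong (_* e) (sym (trans (toℚ-* E₁ (E₂ ℤ.* E₃)) (cong (toℚ E₁ *_) (toℚ-* E₂ E₃)))))
    -- Eᵢ is D divided by the denominator of aᵢ, so that D aᵢ is the integer Eᵢ · ↥ aᵢ.
    E₁ E₂ E₃ E₄ : ℤ
    E₁ = + D₂ ℤ.* (+ D₃ ℤ.* + D₄)
    E₂ = + D₁ ℤ.* (+ D₃ ℤ.* + D₄)
    E₃ = + D₁ ℤ.* (+ D₂ ℤ.* + D₄)
    E₄ = + D₁ ℤ.* (+ D₂ ℤ.* + D₃)
    p₁ : ∀ a b c e → a * b * (c * e) ≡ b * (c * e) * a
    p₁ = solve-∀ ℚ-ring
    p₂ : ∀ a b c e → a * b * (c * e) ≡ a * (c * e) * b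
    p₂ = solve-∀ ℚ-ring
    p₃ : ∀ a b c e → a * b * (c * e) ≡ a * (b * e) * c
    p₃ = solve-∀ ℚ-ring
    p₄ : ∀ a b c e → a * b * (c * e) ≡ a * (b * c) * e
    p₄ = solve-∀ ℚ-ring
    combine : ∀ p q e e′ x y → δ * p ≡ toℚ e → δ * q ≡ toℚ e′ → toℚ (e ℤ.* x ℤ.+ e′ ℤ.* y) ≡ δ * (p * toℚ x + q * toℚ y)
    combine p q e e′ x y eq eq′ = begin
      toℚ (e ℤ.* x ℤ.+ e′ ℤ.* y)  ≡⟨ toℚ-+ (e ℤ.* x) (e′ ℤ.* y) ⟩
      toℚ (e ℤ.* x) + toℚ (e′ ℤ.* y)  ≡⟨ cong₂ _+_ (toℚ-* e x) (toℚ-* e′ y) ⟩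
      toℚ e * toℚ x + toℚ e′ * toℚ y  ≡⟨ cong₂ (λ u v → u * toℚ x + v * toℚ y) eq eq′ ⟨
      δ * p * toℚ x + δ * q * toℚ y  ≡⟨ lemma δ p q (toℚ x) (toℚ y) ⟩
      δ * (p * toℚ x + q * toℚ y)  ∎
      where
      open ≡-Reasoning
      lemma : ∀ δ p q x y → δ * p * x + δ * q * y ≡ δ * (p * x + q * y)
      lemma = solve-∀ ℚ-ring
    represent : ∀ x y → ∃ λ X → ∃ λ Y → eval F₁ X Y ≡ (+ D) ℤ.^ d ℤ.* eval F₂ x y
    represent x y = X , Y , toℚ-injective (begin
      toℚ (eval F₁ X Y)
        ≡⟨ evalℚ-toℚ F₁ X Y ⟨
      evalℚ (map toℚ F₁) (toℚ X) (toℚ Y)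
        ≡⟨ cong₂ (evalℚ (map toℚ F₁))
             (combine a₁ a₂ (E₁ ℤ.* ↥ a₁) (E₂ ℤ.* ↥ a₂) x y (integral a₁ E₁ (cofactor (+ D₂) (+ D₃) (+ D₄) (toℚ (+ D₁)) (trans δ≡ (p₁ (toℚ (+ D₁)) (toℚ (+ D₂)) (toℚ (+ D₃)) (toℚ (+ D₄))))))
            (integral a₂ E₂ (cofactor (+ D₁) (+ D₃) (+ D₄) (toℚ (+ D₂)) (trans δ≡ (p₂ (toℚ (+ D₁)) (toℚ (+ D₂)) (toℚ (+ D₃)) (toℚ (+ D₄)))))))
             (combine a₃ a₄ (E₃ ℤ.* ↥ a₃) (E₄ ℤ.* ↥ a₄) x y (integral a₃ E₃ (cofactor (+ D₁) (+ D₂) (+ D₄) (toℚ (+ D₃)) (trans δ≡ (p₃ (toℚ (+ D₁)) (toℚ (+ D₂)) (toℚ (+ D₃)) (toℚ (+ D₄))))))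
            (integral a₄ E₄ (cofactor (+ D₁) (+ D₂) (+ D₃) (toℚ (+ D₄)) (trans δ≡ (p₄ (toℚ (+ D₁)) (toℚ (+ D₂)) (toℚ (+ D₃)) (toℚ (+ D₄))))))) ⟩
      evalℚ (map toℚ F₁) (δ * (a₁ * toℚ x + a₂ * toℚ y)) (δ * (a₃ * toℚ x + a₄ * toℚ y))
        ≡⟨ evalℚ-homogeneous (map toℚ F₁) δ (a₁ * toℚ x + a₂ * toℚ y) (a₃ * toℚ x + a₄ * toℚ y) ⟩
      δ ^ℚ d * evalℚ (map toℚ F₁) (a₁ * toℚ x + a₂ * toℚ y) (a₃ * toℚ x + a₄ * toℚ y)
        ≡⟨ cong (δ ^ℚ d *_) (sym (evalℚ-∘ᶠ (map toℚ F₁) γ (toℚ x) (toℚ y))) ⟩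
      δ ^ℚ d * evalℚ (map toℚ F₁ ∘ᶠ γ) (toℚ x) (toℚ y)
        ≡⟨ cong (λ G → δ ^ℚ d * evalℚ G (toℚ x) (toℚ y)) eq ⟩
      δ ^ℚ d * evalℚ (map toℚ F₂) (toℚ x) (toℚ y)
        ≡⟨ cong₂ _*_ (sym (toℚ-^ (+ D) d)) (evalℚ-toℚ F₂ x y) ⟩
      toℚ ((+ D) ℤ.^ d) * toℚ (eval F₂ x y)
        ≡⟨ toℚ-* ((+ D) ℤ.^ d) (eval F₂ x y) ⟨
      toℚ ((+ D) ℤ.^ d ℤ.* eval F₂ x y) ∎)
      where
      open ≡-Reasoning
      X = E₁ ℤ.* ↥ a₁ ℤ.* x ℤ.+ E₂ ℤ.* ↥ a₂ ℤ.* y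
      Y = E₃ ℤ.* ↥ a₃ ℤ.* x ℤ.+ E₄ ℤ.* ↥ a₄ ℤ.* y

-- From values in boxes to common values up to an arbitrary large N.

module Assembly where
  open FormCalculus using (eval-homogeneous; ∂-resultant)
  open SmoothParts using (*-^)
  open UniqueLists using (lookup-injective)
  open Growth using (abs-^)
  open Scales
  open Box using (module Points)
  open Nondegeneracy
  open Substitution
  open import Data.Nat.Base as ℕ using (ℕ; zero; suc; _≤_; _<_; _+_; _*_; _^_; z≤n; s≤s; NonZero)
  open import Data.Nat.Properties hiding (_≟_)
  open import Data.Nat.Tactic.RingSolver using (solve-∀)
  open import Data.Integer.Base as ℤ using (ℤ; 0ℤ; 1ℤ; -[1+_]) renaming (∣_∣ to abs)
  import Data.Integer.Properties as ℤ
  open import Data.Rational.Base as ℚ using (ℚ; 0ℚ; 1ℚ; toℚᵘ)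
  import Data.Rational.Properties as ℚ
  open import Data.Rational.Unnormalised.Base as ℚᵘ using (mkℚᵘ)
  import Data.Rational.Unnormalised.Properties as ℚᵘ
  open import Data.Fin.Base using (Fin)
  open import Data.Vec.Base using (map)
  open import Data.List.Base using (length; lookup)
  open import Data.List.Membership.Propositional.Properties using (∈-lookup)
  open import Data.Product.Base using (∃; _×_; _,_; proj₁; proj₂)
  open import Data.Empty using (⊥-elim)
  open import Relation.Nullary using (yes; no)
  open import Relation.Binary.PropositionalEquality

  -- Linear search upwards from z₀. The fuel N suffices, as Q (z + 1)^e ≥ z + 1 exceeds N once z ≥
  -- N.
  root : ∀ Q e → .{{NonZero Q}} → .{{NonZero e}} → ∀ N z₀ → Q * z₀ ^ e ≤ N →
         ∃ λ z → z₀ ≤ z × Q * z ^ e ≤ N × N < Q * suc z ^ e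
  root Q e N z₀ start = search N z₀ (m≤m+n N z₀) ≤-refl start
    where
    search : ∀ fuel z → N ≤ fuel + z → z₀ ≤ z → Q * z ^ e ≤ N → ∃ λ z → z₀ ≤ z × Q * z ^ e ≤ N × N < Q * suc z ^ e
    search fuel z N≤ z₀≤z below with Q * suc z ^ e ≤? N
    ... | no above = z , z₀≤z , below , ≰⇒> above
    search (suc fuel) z N≤ z₀≤z below | yes below′ =
      search fuel (suc z) (≤-trans N≤ (≤-reflexive (sym (+-suc fuel z)))) (m≤n⇒m≤1+n z₀≤z) below′
    search zero z N≤ z₀≤z below | yes below′ = ⊥-elim (<-irrefl refl (begin-strict
      N  ≤⟨ N≤ ⟩
      z  <⟨ ≤-refl ⟩
      suc z  ≡⟨ *-identityʳ (suc z) ⟨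
      suc z ^ 1  ≤⟨ ^-monoʳ-≤ (suc z) (ℕ.>-nonZero⁻¹ e) ⟩
      suc z ^ e  ≤⟨ m≤n*m (suc z ^ e) Q ⟩
      Q * suc z ^ e  ≤⟨ below′ ⟩
      N  ∎))
      where open ≤-Reasoning

  abs≤⇒interval : ∀ {N} m → abs m ≤ N → Interval N m
  abs≤⇒interval {N} (ℤ.+ m)  m≤N = ℤ.≤-trans ℤ.neg-≤-pos (ℤ.+≤+ {0} z≤n) , ℤ.+≤+ m≤N
  abs≤⇒interval {N} -[1+ m ] m≤N = ℤ.neg-mono-≤ (ℤ.+≤+ m≤N) , ℤ.-≤+

  toℚ-mono : ∀ {m n} → m ≤ n → toℚ (ℤ.+ m) ℚ.≤ toℚ (ℤ.+ n)
  toℚ-mono {m} {n} m≤n = ℚ.toℚᵘ-cancel-≤ (ℚᵘ.≤-respˡ-≃ (ℚᵘ.≃-sym (toℚᵘ-toℚ (ℤ.+ m)))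
    (ℚᵘ.≤-respʳ-≃ (ℚᵘ.≃-sym (toℚᵘ-toℚ (ℤ.+ n))) (ℚᵘ.*≤* (ℤ.*-monoʳ-≤-nonNeg 1ℤ (ℤ.+≤+ m≤n)))))

  module Reciprocal (c : ℕ) where
    r : ℚ
    r = 1ℤ ℚ./ suc c

    toℚᵘ-r : toℚᵘ r ℚᵘ.≃ mkℚᵘ 1ℤ c
    toℚᵘ-r = ℚ.toℚᵘ-fromℚᵘ (mkℚᵘ 1ℤ c)

    r>0 : 0ℚ ℚ.< r
    r>0 = ℚ.toℚᵘ-cancel-< (ℚᵘ.<-respʳ-≃ (ℚᵘ.≃-sym toℚᵘ-r) (ℚᵘ.*<* (ℤ.+<+ (s≤s z≤n))))

    instance
      r-nonNegative : ℚ.NonNegative r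
      r-nonNegative = ℚ.nonNegative (ℚ.<⇒≤ r>0)

    r*[1+c]≡1 : r ℚ.* toℚ (ℤ.+ suc c) ≡ 1ℚ
    r*[1+c]≡1 = ℚ.toℚᵘ-injective (begin
      toℚᵘ (r ℚ.* toℚ (ℤ.+ suc c))  ≈⟨ ℚ.toℚᵘ-homo-* r (toℚ (ℤ.+ suc c)) ⟩
      toℚᵘ r ℚᵘ.* toℚᵘ (toℚ (ℤ.+ suc c))  ≈⟨ ℚᵘ.*-cong toℚᵘ-r (toℚᵘ-toℚ (ℤ.+ suc c)) ⟩
      mkℚᵘ 1ℤ c ℚᵘ.* mkℚᵘ (ℤ.+ suc c) 0  ≈⟨ ℚᵘ.*≡* cross ⟩
      mkℚᵘ 1ℤ 0  ∎)
      where
      open ℚᵘ.≃-Reasoning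
      cross : 1ℤ ℤ.* ℤ.+ suc c ℤ.* 1ℤ ≡ 1ℤ ℤ.* ℤ.+ suc (c * 1)
      cross = trans (ℤ.*-identityʳ (1ℤ ℤ.* ℤ.+ suc c)) (cong (λ k → 1ℤ ℤ.* ℤ.+ suc k) (sym (*-identityʳ c)))

    r≤1 : r ℚ.≤ 1ℚ
    r≤1 = subst₂ ℚ._≤_ (ℚ.*-identityʳ r) r*[1+c]≡1 (ℚ.*-monoˡ-≤-nonNeg r (toℚ-mono {1} {suc c} (s≤s z≤n)))

    r^n≤1 : ∀ n → r ^ℚ n ℚ.≤ 1ℚ
    r^n≤1 zero    = ℚ.≤-refl
    r^n≤1 (suc n) = ℚ.≤-trans (ℚ.*-monoˡ-≤-nonNeg r (r^n≤1 n)) (ℚ.≤-trans (ℚ.≤-reflexive (ℚ.*-identityʳ r)) r≤1)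

    -- Since 0 ≤ r ≤ 1, the power r^(n+1) is at most r = 1/(1 + c). Thus a rational constant serves
    -- without extracting a root.
    r^[1+n]*m≤ : ∀ n {m k} → m ≤ suc c * k → r ^ℚ suc n ℚ.* toℚ (ℤ.+ m) ℚ.≤ toℚ (ℤ.+ k)
    r^[1+n]*m≤ n {m} {k} m≤ = begin
      r ^ℚ suc n ℚ.* toℚ (ℤ.+ m)
        ≤⟨ ℚ.*-monoʳ-≤-nonNeg (toℚ (ℤ.+ m)) {{ℚ.nonNegative (toℚ-mono {0} {m} z≤n)}} r^[1+n]≤r ⟩
      r ℚ.* toℚ (ℤ.+ m)
        ≤⟨ ℚ.*-monoˡ-≤-nonNeg r (toℚ-mono m≤) ⟩
      r ℚ.* toℚ (ℤ.+ (suc c * k))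
        ≡⟨ cong (r ℚ.*_) (trans (cong toℚ (ℤ.pos-* (suc c) k)) (toℚ-* (ℤ.+ suc c) (ℤ.+ k))) ⟩
      r ℚ.* (toℚ (ℤ.+ suc c) ℚ.* toℚ (ℤ.+ k))
        ≡⟨ ℚ.*-assoc r (toℚ (ℤ.+ suc c)) (toℚ (ℤ.+ k)) ⟨
      r ℚ.* toℚ (ℤ.+ suc c) ℚ.* toℚ (ℤ.+ k)
        ≡⟨ cong (ℚ._* toℚ (ℤ.+ k)) r*[1+c]≡1 ⟩
      1ℚ ℚ.* toℚ (ℤ.+ k)
        ≡⟨ ℚ.*-identityˡ (toℚ (ℤ.+ k)) ⟩
      toℚ (ℤ.+ k) ∎
      where
      open ℚ.≤-Reasoning
      r^[1+n]≤r : r ^ℚ suc n ℚ.≤ r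
      r^[1+n]≤r = ℚ.≤-trans (ℚ.*-monoˡ-≤-nonNeg r (r^n≤1 n)) (ℚ.≤-reflexive (ℚ.*-identityʳ r))

  module _ {n} (F₁ F₂ : Form ℤ (suc (suc (suc n)))) (R≢0 : ∂-resultant F₂ ≢ 0ℤ)
           (γ : GL₂) (F₁∘γ≡F₂ : map toℚ F₁ ∘ᶠ γ ≡ map toℚ F₂) where

    private
      d : ℕ
      d = suc (suc (suc n))
      c : ℤ
      c = proj₁ (nonzero-value F₂ R≢0)
      a≢0 : eval F₂ 1ℤ c ≢ 0ℤ
      a≢0 = proj₂ (nonzero-value F₂ R≢0)
      module P = Points F₂ c a≢0 R≢0
      iso = isomorphic-values F₁ F₂ γ F₁∘γ≡F₂
      D : ℕ
      D = proj₁ iso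
      instance
        D≢0 : NonZero D
        D≢0 = proj₁ (proj₂ iso)
      -- The common values found are D^d times integers of size at most V z^e, hence the bound Q
      -- z^e; `suc` keeps Q nonzero. m bounds how often a value is taken. C₃ combines N ≤ Q 2^e B^d
      -- with B² ≤ 4 m k, where k is the number of values.
      e m Q C₃ N₀ : ℕ
      e  = T F₂ c a≢0 R≢0 * d
      m  = d ^ t F₂ c a≢0 R≢0
      Q  = suc (D ^ d * P.V)
      C₃ = Q * 2 ^ e * (Q * 2 ^ e) * (4 * m) ^ d
      N₀ = Q * z₀ F₂ c a≢0 R≢0 ^ e

    -- Membership in `CommonValues` spelled out for the underlying forms. The last inequality is k ≥
    -- const · N^(2/d), raised to the power d.
    ManyCommonValues : ℕ → ℕ → Set
    ManyCommonValues C N = ∃ λ k →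
      (∃ λ (f : Fin k → ℤ) → (∀ {i j} → f i ≡ f j → i ≡ j) × (∀ i →
        (∃ λ x → ∃ λ y → eval F₁ x y ≡ f i) × (∃ λ x → ∃ λ y → eval F₂ x y ≡ f i) × Interval N (f i)))
      × N ^ 2 ≤ suc C * k ^ d

    common-values : ∀ N → N₀ ≤ N → ManyCommonValues C₃ N
    common-values N N₀≤N = k , (f , f-injective , f-common) , N²≤
      where
      open ≤-Reasoning
      τ = T F₂ c a≢0 R≢0
      found = root Q e N (z₀ F₂ c a≢0 R≢0) N₀≤N
      z = proj₁ found
      z≥z₀ = proj₁ (proj₂ found)
      below = proj₁ (proj₂ (proj₂ found))
      above = proj₂ (proj₂ (proj₂ found))
      many = many-values F₂ c a≢0 R≢0 z z≥z₀
      W = proj₁ many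
      W-unique = proj₁ (proj₂ many)
      W-values = proj₁ (proj₂ (proj₂ many))
      W-many = proj₂ (proj₂ (proj₂ many))
      k = length W
      B = z ^ τ
      scale : ℤ
      scale = (ℤ.+ D) ℤ.^ d
      abs-scale : abs scale ≡ D ^ d
      abs-scale = abs-^ (ℤ.+ D) d
      instance
        scale≢0 : ℤ.NonZero scale
        scale≢0 = subst NonZero (sym abs-scale) (m^n≢0 D d)
      f : Fin k → ℤ
      f i = scale ℤ.* lookup W i
      f-injective : ∀ {i j} → f i ≡ f j → i ≡ j
      f-injective {i} {j} eq = lookup-injective W-unique i j (ℤ.*-cancelˡ-≡ scale (lookup W i) (lookup W j) eq)
      f-≤ : ∀ i → abs (f i) ≤ N
      f-≤ i = begin
        abs (scale ℤ.* lookup W i)  ≡⟨ trans (ℤ.abs-* scale (lookup W i)) (cong (_* abs (lookup W i)) abs-scale) ⟩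
        D ^ d * abs (lookup W i)  ≤⟨ *-monoʳ-≤ (D ^ d) (proj₂ (W-values (∈-lookup i))) ⟩
        D ^ d * (P.V * B ^ d)  ≡⟨ *-assoc (D ^ d) P.V (B ^ d) ⟨
        D ^ d * P.V * B ^ d  ≤⟨ *-monoˡ-≤ (B ^ d) (n≤1+n (D ^ d * P.V)) ⟩
        Q * B ^ d  ≡⟨ cong (Q *_) (^-*-assoc z τ d) ⟩
        Q * z ^ e  ≤⟨ below ⟩
        N  ∎
      -- D^d F₂(x, y) is a value of F₁ by `isomorphic-values`, and the value of F₂ at (D x, D y).
      f-common : ∀ i → (∃ λ x → ∃ λ y → eval F₁ x y ≡ f i) × (∃ λ x → ∃ λ y → eval F₂ x y ≡ f i) × Interval N (f i)
      f-common i =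
        let (x , y , F₂xy≡) , _ = W-values (∈-lookup i)
            X , Y , F₁XY≡ = proj₂ (proj₂ iso) x y
        in (X , Y , trans F₁XY≡ (cong (scale ℤ.*_) F₂xy≡))
         , (ℤ.+ D ℤ.* x , ℤ.+ D ℤ.* y , trans (eval-homogeneous F₂ (ℤ.+ D) x y) (cong (scale ℤ.*_) F₂xy≡))
         , abs≤⇒interval (f i) (f-≤ i)

      z≥1 : 1 ≤ z
      z≥1 = ≤-trans (s≤s z≤n) z≥z₀

      -- N lies below the bound for z + 1 ≤ 2 z, so passing to a scale costs at most the factor 2^e.
      N≤ : N ≤ Q * 2 ^ e * B ^ d
      N≤ = begin
        N  ≤⟨ <⇒≤ above ⟩
        Q * suc z ^ e  ≤⟨ *-monoʳ-≤ Q (^-monoˡ-≤ e (≤-trans (+-monoˡ-≤ z z≥1) (≤-reflexive (cong (z +_) (sym (+-identityʳ z)))))) ⟩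
        Q * (2 * z) ^ e  ≡⟨ cong (Q *_) (*-^ 2 z e) ⟩
        Q * (2 ^ e * z ^ e)  ≡⟨ *-assoc Q (2 ^ e) (z ^ e) ⟨
        Q * 2 ^ e * z ^ e  ≡⟨ cong (Q * 2 ^ e *_) (^-*-assoc z τ d) ⟨
        Q * 2 ^ e * B ^ d  ∎

      N²≤ : N ^ 2 ≤ suc C₃ * k ^ d
      N²≤ = begin
        N ^ 2
          ≤⟨ ^-monoˡ-≤ 2 N≤ ⟩
        (Q * 2 ^ e * B ^ d) ^ 2
          ≡⟨ square (Q * 2 ^ e) (B ^ d) ⟩
        Q * 2 ^ e * (Q * 2 ^ e) * (B ^ d * B ^ d)
          ≡⟨ cong (Q * 2 ^ e * (Q * 2 ^ e) *_) (sym (*-^ B B d)) ⟩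
        Q * 2 ^ e * (Q * 2 ^ e) * (B * B) ^ d
          ≤⟨ *-monoʳ-≤ (Q * 2 ^ e * (Q * 2 ^ e)) (^-monoˡ-≤ d (≤-trans W-many (≤-reflexive (regroup k m)))) ⟩
        Q * 2 ^ e * (Q * 2 ^ e) * (4 * m * k) ^ d
          ≡⟨ cong (Q * 2 ^ e * (Q * 2 ^ e) *_) (*-^ (4 * m) k d) ⟩
        Q * 2 ^ e * (Q * 2 ^ e) * ((4 * m) ^ d * k ^ d)
          ≡⟨ *-assoc (Q * 2 ^ e * (Q * 2 ^ e)) ((4 * m) ^ d) (k ^ d) ⟨
        C₃ * k ^ d
          ≤⟨ *-monoˡ-≤ (k ^ d) (n≤1+n C₃) ⟩
        suc C₃ * k ^ d ∎
        where
        square : ∀ u v → (u * v) ^ 2 ≡ u * u * (v * v)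
        square u v = trans (cong (u * v *_) (*-identityʳ (u * v))) (lemma u v)
          where
          lemma : ∀ u v → u * v * (u * v) ≡ u * u * (v * v)
          lemma = solve-∀
        regroup : ∀ k m → 4 * (k * m) ≡ 4 * m * k
        regroup = solve-∀

    eventually-many : ∃ λ C₃ → ∃ λ N₀ → ∀ N → N₀ ≤ N → ManyCommonValues C₃ N
    eventually-many = C₃ , N₀ , common-values

-- The bound with C - o(1) for every N.

open import Data.Nat.Base as ℕ using (ℕ; suc; _≤_; s≤s; z≤n)
open import Data.Nat.Properties using (_≤?_)
import Data.Integer.Base as ℤ
open import Data.Rational.Base as ℚ using (ℚ; 0ℚ; _<_; _-_; ∣_∣)
import Data.Rational.Properties as ℚ
open import Data.Product.Base using (∃; _×_; _,_)
open import Relation.Nullary using (Dec; yes; no; contradiction)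
open import Relation.Binary.PropositionalEquality using (sym; trans; cong; subst)

module LowerBound (d : ℕ) (F₁ F₂ : Bin (suc d)) (C₃ N₀ : ℕ)
  (many : ∀ N → N₀ ≤ N → ∃ λ k → k ≤♯ CommonValues F₁ F₂ N × N ℕ.^ 2 ≤ suc C₃ ℕ.* k ℕ.^ suc d) where

  open Assembly.Reciprocal C₃ public renaming (r to C; r>0 to C>0)

  -- Before N₀ the error term is C, which reduces the claim to 0 ≤ k^d; from N₀ on it is 0. The
  -- decision is an explicit argument so that later proofs can match on it.
  cutoff : ∀ N → Dec (N₀ ≤ N) → ℚ
  cutoff N (yes _) = 0ℚ
  cutoff N (no _)  = C

  o : ℕ → ℚ
  o N = cutoff N (N₀ ≤? N)

  o-vanishing : Vanishing o
  o-vanishing ε ε>0 = N₀ , λ N N₀≤N → small N (N₀ ≤? N) N₀≤N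
    where
    small : ∀ N N₀≤?N → N₀ ≤ N → ∣ cutoff N N₀≤?N ∣ < ε
    small N (yes _)   _    = ε>0
    small N (no N₀≰N) N₀≤N = contradiction N₀≤N N₀≰N

  bound : ∀ N → 𝒩[ F₁ , F₂ ⨾ N ]≥ (C - o N) ·N^2/d
  bound N = by-cases (N₀ ≤? N)
    where
    by-cases : ∀ N₀≤?N → 𝒩[ F₁ , F₂ ⨾ N ]≥ (C - cutoff N N₀≤?N) ·N^2/d
    by-cases (yes N₀≤N) = let k , common , N²≤ = many N N₀≤N in
      k , common , λ _ → subst (λ q → q ^ℚ suc d ℚ.* toℚ (ℤ.+ (N ℕ.^ 2)) ℚ.≤ toℚ (ℤ.+ (k ℕ.^ suc d)))
        (sym (ℚ.+-identityʳ C)) (r^[1+n]*m≤ d N²≤)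
    -- The empty family suffices: C - C = 0, and the exponent is positive.
    by-cases (no _) = 0 , ((λ ()) , (λ { {()} }) , λ ()) , λ _ → ℚ.≤-reflexive
      (trans (cong (ℚ._* toℚ (ℤ.+ (N ℕ.^ 2)))
        (trans (cong (ℚ._* ((C - C) ^ℚ d)) (ℚ.+-inverseʳ C)) (ℚ.*-zeroˡ ((C - C) ^ℚ d)))) (ℚ.*-zeroˡ (toℚ (ℤ.+ (N ℕ.^ 2)))))

proposition1p9 : (d : ℕ) → 3 ≤ d → (F₁ F₂ : Bin d) → Isomorphic F₁ F₂ →
    ∃ λ (C : ℚ) → 0ℚ < C ×
    ∃ λ (o : ℕ → ℚ) → Vanishing o ×
    (∀ N → 1 ≤ N → 𝒩[ F₁ , F₂ ⨾ N ]≥ (C - o N) ·N^2/d)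
proposition1p9 (suc (suc (suc n))) (s≤s (s≤s (s≤s z≤n))) F₁ F₂ (γ , F₁∘γ≡F₂) =
  let C₃ , N₀ , many = Assembly.eventually-many (form F₁) (form F₂) (Nondegeneracy.∂-resultant≢0 (form F₂) (nonzeroDiscriminant F₂)) γ F₁∘γ≡F₂
      open LowerBound (suc (suc n)) F₁ F₂ C₃ N₀ many
  in C , C>0 , o , o-vanishing , λ N _ → bound N
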